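{- Let $n\ge 3$ and, for a vincular 3-pattern $\phi$, write $$\overline{\mathrm{pat}_\phi}=a_1e_1+a_2e_2+a_3e_3+a_4e_4+a_6e_6$$ (the coefficients of $e_5$ and $e_7$ being $0$). Writing each row as "patterns: $(a_1;a_2;a_3;a_4;a_6)$", the coefficients are: Classical patterns: $(1\text{ - }2\text{ - }3)$: $\bigl(\tfrac16\binom n3;\ \tfrac{(n+1)(3n-4)}{60};\ \tfrac{n+1}{30};\ \tfrac{3n-2}{30};\ \tfrac1{15}\bigr)$. $(1\text{ - }3\text{ - }2),(2\text{ - }1\text{ - }3)$: $\bigl(\tfrac16\binom n3;\ \tfrac{(n+1)(n-3)}{60};\ -\tfrac{n+1}{60};\ -\tfrac{n+1}{20};\ -\tfrac1{30}\bigr)$. $(2\text{ - }3\text{ - }1),(3\text{ - }1\text{ - }2)$: $\bigl(\tfrac16\binom n3;\ -\tfrac{(n+1)(3n-4)}{120};\ -\tfrac{n+1}{60};\ \tfrac{n+1}{30};\ -\tfrac1{30}\bigr)$. $(3\text{ - }2\text{ - }1)$: $\bigl(\tfrac16\binom n3;\ -\tfrac{(n+1)(n-3)}{30};\ \tfrac{n+1}{30};\ -\tfrac{2n-3}{30};\ \tfrac1{15}\bigr)$. $(12\text{ - }3),(1\text{ - }23)$: $\bigl(\tfrac16\binom{n-1}2;\ \tfrac{n^2+3n-6}{12n};\ \tfrac{n+2}{12n};\ \tfrac{5n-6}{12n};\ \tfrac1{4n}\bigr)$. $(13\text{ - }2),(2\text{ - }13)$: $\bigl(\tfrac16\binom{n-1}2;\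 \tfrac{n-3}{6n};\ -\tfrac{n-1}{6n};\ -\tfrac1{2n};\ 0\bigr)$. $(21\text{ - }3),(1\text{ - }32)$: $\bigl(\tfrac16\binom{n-1}2;\ \tfrac{n(n-3)}{12n};\ \tfrac{n-4}{12n};\ -\tfrac14;\ -\tfrac1{4n}\bigr)$. $(23\text{ - }1),(3\text{ - }12)$: $\bigl(\tfrac16\binom{n-1}2;\ -\tfrac{n(n-1)}{12n};\ \tfrac{n-4}{12n};\ \tfrac1{12};\ -\tfrac1{4n}\bigr)$. $(31\text{ - }2),(2\text{ - }31)$: $\bigl(\tfrac16\binom{n-1}2;\ -\tfrac{2n-3}{6n};\ -\tfrac{n-1}{6n};\ \tfrac1{2n};\ 0\bigr)$. $(32\text{ - }1),(3\text{ - }21)$: $\bigl(\tfrac16\binom{n-1}2;\ -\tfrac{(n+2)(n-3)}{12n};\ \tfrac{n+2}{12n};\ -\tfrac{n-2}{4n};\ \tfrac1{4n}\bigr)$. $[1\text{ - }2\text{ - }3),(1\text{ - }2\text{ - }3]$: $\bigl(\tfrac16\binom{n-1}2;\ \tfrac{5n-7}{24};\ \tfrac18;\ \tfrac5{24};\ \tfrac1{8n}\bigr)$. $[1\text{ - }3\text{ - }2),(2\text{ - }1\text{ - }3]$: $\bigl(\tfrac16\binom{n-1}2;\ \tfrac{n-3}8;\ -\tfrac18;\ -\tfrac5{24};\ -\tfrac1{8n}\bigr)$. $[2\text{ - }1\text{ - }3),(1\text{ - }3\text{ - }2]$: $\bigl(\tfrac16\binom{n-1}2;\ 0;\ 0;\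 -\tfrac16;\ 0\bigr)$. $[2\text{ - }3\text{ - }1),(3\text{ - }1\text{ - }2]$: $\bigl(\tfrac16\binom{n-1}2;\ -\tfrac{n-2}6;\ 0;\ \tfrac16;\ 0\bigr)$. $[3\text{ - }1\text{ - }2),(2\text{ - }3\text{ - }1]$: $\bigl(\tfrac16\binom{n-1}2;\ -\tfrac{n+1}{24};\ -\tfrac18;\ \tfrac18;\ -\tfrac1{8n}\bigr)$. $[3\text{ - }2\text{ - }1),(3\text{ - }2\text{ - }1]$: $\bigl(\tfrac16\binom{n-1}2;\ -\tfrac{n-3}8;\ \tfrac18;\ -\tfrac18;\ \tfrac1{8n}\bigr)$. $(12\text{ - }3],[1\text{ - }23)$: $\bigl(\tfrac{n-2}6;\ \tfrac13;\ \tfrac{n+2}{6(n)_2};\ \tfrac1{2(n-1)};\ \tfrac1{2(n)_2}\bigr)$. $(13\text{ - }2],[2\text{ - }13)$: $\bigl(\tfrac{n-2}6;\ -\tfrac{n-3}{6n};\ -\tfrac{2n-5}{6(n)_2};\ -\tfrac1{2(n)_2};\ \tfrac1{2(n)_2}\bigr)$. $(21\text{ - }3],[1\text{ - }32)$: $\bigl(\tfrac{n-2}6;\ \tfrac{(2n+1)(n-3)}{6(n)_2};\ \tfrac{n-7}{6(n)_2};\ -\tfrac{n+1}{2(n)_2};\ -\tfrac1{(n)_2}\bigr)$. $(23\text{ - }1],[3\text{ - }12)$: $\bigl(\tfrac{n-2}6;\ -\tfrac{n^2-4n+9}{6(n)_2};\ \tfrac{n-7}{6(n)_2};\ \tfrac{n-3}{2(n)_2};\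 -\tfrac1{(n)_2}\bigr)$. $(31\text{ - }2],[2\text{ - }31)$: $\bigl(\tfrac{n-2}6;\ -\tfrac{n^2+2n-9}{6(n)_2};\ -\tfrac{2n-5}{6(n)_2};\ \tfrac3{2(n)_2};\ \tfrac1{2(n)_2}\bigr)$. $(32\text{ - }1],[3\text{ - }21)$: $\bigl(\tfrac{n-2}6;\ -\tfrac{(n+2)(n-3)}{6(n)_2};\ \tfrac{n+2}{6(n)_2};\ -\tfrac{n-2}{2(n)_2};\ \tfrac1{2(n)_2}\bigr)$. $[12\text{ - }3),(1\text{ - }23]$: $\bigl(\tfrac{n-2}6;\ \tfrac{n^2+5n-12}{6(n)_2};\ \tfrac1{3n};\ \tfrac{n-2}{(n)_2};\ 0\bigr)$. $[13\text{ - }2),(2\text{ - }13]$: $\bigl(\tfrac{n-2}6;\ \tfrac{(n+2)(n-3)}{6(n)_2};\ -\tfrac2{3n};\ -\tfrac1{(n)_2};\ 0\bigr)$. $[21\text{ - }3),(1\text{ - }32]$: $\bigl(\tfrac{n-2}6;\ \tfrac{(n-3)(n-4)}{6(n)_2};\ \tfrac1{3n};\ -\tfrac{n-2}{(n)_2};\ 0\bigr)$. $[23\text{ - }1),(3\text{ - }12]$: $\bigl(\tfrac{n-2}6;\ -\tfrac{n^2-n-3}{3(n)_2};\ \tfrac1{3n};\ \tfrac1{(n)_2};\ 0\bigr)$. $[31\text{ - }2),(2\text{ - }31]$: $\bigl(\tfrac{n-2}6;\ \tfrac{n-6}{6n};\ -\tfrac2{3n};\ \tfrac1{(n)_2};\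 0\bigr)$. $[32\text{ - }1),(3\text{ - }21],[3\text{ - }2\text{ - }1]$: $\bigl(\tfrac{n-2}6;\ -\tfrac{n-3}{3n};\ \tfrac1{3n};\ -\tfrac1{(n)_2};\ 0\bigr)$. $[1\text{ - }2\text{ - }3]$: $\bigl(\tfrac{n-2}6;\ \tfrac{2n-3}{3n};\ \tfrac1{3n};\ \tfrac1{(n)_2};\ 0\bigr)$. $[1\text{ - }3\text{ - }2],[2\text{ - }1\text{ - }3]$: $\bigl(\tfrac{n-2}6;\ \tfrac{n-3}{6n};\ -\tfrac1{6n};\ -\tfrac1{2n};\ 0\bigr)$. $[2\text{ - }3\text{ - }1],[3\text{ - }1\text{ - }2]$: $\bigl(\tfrac{n-2}6;\ -\tfrac{2n-3}{6n};\ -\tfrac1{6n};\ \tfrac1{2n};\ 0\bigr)$. $(123)$: $\bigl(\tfrac{n-2}6;\ \tfrac1n;\ \tfrac1{(n)_2};\ \tfrac1n;\ \tfrac1{(n)_2}\bigr)$. $(132),(213)$: $\bigl(\tfrac{n-2}6;\ \tfrac{n-3}{2(n)_2};\ -\tfrac1{2(n)_2};\ -\tfrac3{2(n)_2};\ -\tfrac1{2(n)_2}\bigr)$. $(231),(312)$: $\bigl(\tfrac{n-2}6;\ -\tfrac1{2n};\ -\tfrac1{2(n)_2};\ \tfrac1{2(n)_2};\ -\tfrac1{2(n)_2}\bigr)$. $(321)$: $\bigl(\tfrac{n-2}6;\ -\tfrac{n-3}{(n)_2};\ \tfrac1{(n)_2};\ -\tfrac{n-3}{(n)_2};\ \tfrac1{(n)_2}\bigr)$.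 $[123),(123]$: $\bigl(\tfrac16;\ \tfrac1{n(n-2)};\ \tfrac1{(n)_3};\ \tfrac1{n(n-2)};\ \tfrac1{(n)_3}\bigr)$. $[132),(213]$: $\bigl(\tfrac16;\ \tfrac{2n-6}{(n)_3};\ -\tfrac2{(n)_3};\ \tfrac{n-6}{(n)_3};\ -\tfrac2{(n)_3}\bigr)$. $[213),(132],[321),(321]$: $\bigl(\tfrac16;\ -\tfrac{n-3}{(n)_3};\ \tfrac1{(n)_3};\ -\tfrac{n-3}{(n)_3};\ \tfrac1{(n)_3}\bigr)$. $[231),(312]$: $\bigl(\tfrac16;\ -\tfrac{2n-5}{(n)_3};\ \tfrac1{(n)_3};\ -\tfrac{n-5}{(n)_3};\ \tfrac1{(n)_3}\bigr)$. $[312),(231]$: $\bigl(\tfrac16;\ \tfrac{n-4}{(n)_3};\ -\tfrac2{(n)_3};\ \tfrac{n-4}{(n)_3};\ -\tfrac2{(n)_3}\bigr)$. $[12\text{ - }3],[1\text{ - }23]$: $\bigl(\tfrac16;\ \tfrac{n+1}{2(n)_2};\ \tfrac1{2(n)_2};\ \tfrac1{2(n)_2};\ -\tfrac1{2(n)_3}\bigr)$. $[13\text{ - }2],[2\text{ - }13]$: $\bigl(\tfrac16;\ 0;\ -\tfrac1{(n)_2};\ 0;\ \tfrac1{(n)_3}\bigr)$. $[21\text{ - }3],[1\text{ - }32]$: $\bigl(\tfrac16;\ \tfrac{n-3}{2(n)_2};\ \tfrac1{2(n)_2};\ -\tfrac3{2(n)_2};\ -\tfrac1{2(n)_3}\bigr)$.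 $[23\text{ - }1],[3\text{ - }12]$: $\bigl(\tfrac16;\ -\tfrac1{2n};\ \tfrac1{2(n)_2};\ \tfrac1{2(n)_2};\ -\tfrac1{2(n)_3}\bigr)$. $[31\text{ - }2],[2\text{ - }31]$: $\bigl(\tfrac16;\ -\tfrac1{(n)_2};\ -\tfrac1{(n)_2};\ \tfrac2{(n)_3};\ \tfrac1{(n)_3}\bigr)$. $[32\text{ - }1],[3\text{ - }21]$: $\bigl(\tfrac16;\ -\tfrac{n-3}{2(n)_2};\ \tfrac1{2(n)_2};\ \tfrac{n-6}{2(n)_3};\ -\tfrac1{2(n)_3}\bigr)$.
   Context: $S_n$ is the symmetric group on $[n]=\{1,\dots,n\}$, permutations written in one-line notation $\pi_1\cdots\pi_n$. For $\lambda\vdash n$, $C_\lambda$ is the conjugacy class of cycle type $\lambda$, and $p,q,r$ are the numbers of parts of $\lambda$ of sizes $1,2,3$. For $s:S_n\to\mathbb R$ the mean statistic is the class function $\overline s(\lambda)=\frac1{|C_\lambda|}\sum_{\pi\in C_\lambda}s(\pi)$. $(n)_k=n(n-1)\cdots(n-k+1)$. Vincular 3-patterns: $\phi$ is a permutation $\phi_1\phi_2\phi_3\in S_3$ enclosed on the left by "[" or "(" and on the right by "]" or ")", with optionally a dash "-" between adjacent letters. An occurrence of $\phi$ in $\pi\in S_n$ is a subsequence $\pi_{i_1}\pi_{i_2}\pi_{i_3}$ ($i_1<i_2<i_3$) in the same relative order as $\phi_1\phi_2\phi_3$ with: $i_2=i_1+1$ if no dash between $\phi_1,\phi_2$; $i_3=i_2+1$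 if no dash between $\phi_2,\phi_3$; $i_1=1$ if $\phi$ begins with "["; $i_3=n$ if $\phi$ ends with "]". $\mathrm{pat}_\phi(\pi)$ is the number of occurrences of $\phi$ in $\pi$. Classical patterns are those of the form $(a\text{ - }b\text{ - }c)$. The functions $e_1,\dots,e_7$ of $\lambda$ are $e_1=1$, $e_2=p-1$, $e_3=\binom{p-1}2+q-1$, $e_4=\binom{p-1}2-q$, $e_5=\binom{p-1}3+(p-1)(q-1)+r$, $e_6=2\binom{p-1}3-p-r+2$, $e_7=\binom{p-1}3-q(p-1)+r$; they equal the irreducible characters $\chi^{(n)},\chi^{(n-1,1)},\chi^{(n-2,2)},\chi^{(n-2,1,1)},\chi^{(n-3,3)},\chi^{(n-3,2,1)},\chi^{(n-3,1,1,1)}$ of $S_n$ (for $n\ge6$ all are characters). For $n\le5$ the formulas give: when $n=3$, $e_3=0$ and $e_6=-e_4$; when $n=4$, $e_6=0$. -}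

module Defs where

open import Data.Bool using (Bool; true; false; _∧_; not; if_then_else_)
open import Data.Nat as ℕ using (ℕ; zero; suc; _∸_; _≡ᵇ_; _<ᵇ_)
open import Data.Nat.DivMod as ℕD using ()
open import Data.Nat.Combinatorics using (_C_)
open import Data.List using (List; []; _∷_; map; concatMap; length; upTo; downFrom; replicate)
open import Data.Nat.ListAction using (sum)
open import Data.List.Relation.Unary.All using (All)
open import Data.List.Relation.Unary.Linked using (Linked)
open import Data.Unit.Base using (⊤; tt)
open import Data.Product using (_×_; _,_)
open import Data.Integer using (+_)
open import Data.Rational using (ℚ; 0ℚ; 1ℚ; _+_; _*_; _-_; -_; _÷_; _/_; ≢-nonZero)
open import Data.Rational.Properties using (_≟_)
import Data.Rational.Literals as ℚLit
import Data.Nat.Literals as ℕLit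
open import Agda.Builtin.FromNat using (Number; fromNat)
open import Relation.Nullary using (yes; no)
open import Relation.Binary.PropositionalEquality using (_≡_)

instance
  ℚ-number : Number ℚ
  ℚ-number = ℚLit.number
  ℕ-number : Number ℕ
  ℕ-number = ℕLit.number
  ⊤-inst : ⊤
  ⊤-inst = tt

filterB : {A : Set} → (A → Bool) → List A → List A
filterB p [] = []
filterB p (x ∷ xs) = if p x then x ∷ filterB p xs else filterB p xs

countB : {A : Set} → (A → Bool) → List A → ℕ
countB p xs = length (filterB p xs)

eqListB : List ℕ → List ℕ → Bool
eqListB [] [] = true
eqListB [] (_ ∷ _) = false
eqListB (_ ∷ _) [] = false
eqListB (x ∷ xs) (y ∷ ys) = (x ≡ᵇ y) ∧ eqListB xs ys

_⇔ᵇ_ : Bool → Bool → Bool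
true ⇔ᵇ b = b
false ⇔ᵇ b = not b

-- The symmetric group S_n, in one-line notation.
-- A permutation π ∈ S_n is the list π₁ ⋯ πₙ.  We use the alphabet
-- {0,…,n-1} (0-based values and positions) instead of {1,…,n};
-- pattern occurrences and cycle types are invariant under this shift.

words : ℕ → ℕ → List (List ℕ)
words n zero = [] ∷ []
words n (suc k) = concatMap (λ w → map (_∷ w) (upTo n)) (words n k)

notInB : ℕ → List ℕ → Bool
notInB x [] = true
notInB x (y ∷ ys) = not (x ≡ᵇ y) ∧ notInB x ys

distinctB : List ℕ → Bool
distinctB [] = true
distinctB (x ∷ xs) = notInB x xs ∧ distinctB xs

Sym : ℕ → List (List ℕ)
Sym n = filterB distinctB (words n n)

app : List ℕ → ℕ → ℕ
app [] i = 0
app (x ∷ xs) zero = x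
app (x ∷ xs) (suc i) = app xs i

iter : List ℕ → ℕ → ℕ → ℕ
iter π zero i = i
iter π (suc k) i = app π (iter π k i)

orbitSearch : List ℕ → ℕ → ℕ → ℕ → ℕ
orbitSearch π i k zero = k
orbitSearch π i k (suc f) = if iter π k i ≡ᵇ i then k else orbitSearch π i (suc k) f

cycleLen : List ℕ → ℕ → ℕ
cycleLen π i = orbitSearch π i 1 (length π)

-- number of cycles of π of length k+1  (= #{i : cycle of i has length k+1}/(k+1))
cyclesOfLen : List ℕ → ℕ → ℕ
cyclesOfLen π k = countB (λ i → cycleLen π i ≡ᵇ suc k) (upTo (length π)) ℕD./ suc k

cycleType : List ℕ → List ℕ
cycleType π = concatMap (λ k → replicate (cyclesOfLen π k) (suc k)) (downFrom (length π))

record Partition (n : ℕ) : Set where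
  field
    parts      : List ℕ
    positive   : All (λ k → 1 ℕ.≤ k) parts
    decreasing : Linked ℕ._≥_ parts
    total      : sum parts ≡ n
open Partition public

conjClass : {n : ℕ} → Partition n → List (List ℕ)
conjClass {n} λ′ = filterB (λ π → eqListB (cycleType π) (parts λ′)) (Sym n)

mult : {n : ℕ} → ℕ → Partition n → ℕ
mult k λ′ = countB (_≡ᵇ k) (parts λ′)

-- "[" / "]" (sq) or "(" / ")" (rd)
data End : Set where
  sq rd : End

data Gap : Set where
  dash adj : Gap

-- vp l φ₁ g₁ φ₂ g₂ φ₃ r  is the pattern  l φ₁ g₁ φ₂ g₂ φ₃ r,
-- e.g.  vp sq 1 dash 2 adj 3 rd  is  [1-23)
record VPat : Set where
  constructor vp
  field
    left  : End
    φ₁    : ℕ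
    gap₁  : Gap
    φ₂    : ℕ
    gap₂  : Gap
    φ₃    : ℕ
    right : End

ltᵇ : ℕ → ℕ → Bool
ltᵇ = _<ᵇ_

sameOrder : ℕ → ℕ → ℕ → ℕ → ℕ → ℕ → Bool
sameOrder x₁ x₂ x₃ f₁ f₂ f₃ =
  (ltᵇ x₁ x₂ ⇔ᵇ ltᵇ f₁ f₂) ∧ (ltᵇ x₂ x₁ ⇔ᵇ ltᵇ f₂ f₁) ∧
  (ltᵇ x₁ x₃ ⇔ᵇ ltᵇ f₁ f₃) ∧ (ltᵇ x₃ x₁ ⇔ᵇ ltᵇ f₃ f₁) ∧
  (ltᵇ x₂ x₃ ⇔ᵇ ltᵇ f₂ f₃) ∧ (ltᵇ x₃ x₂ ⇔ᵇ ltᵇ f₃ f₂)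

gapOK : Gap → ℕ → ℕ → Bool
gapOK dash i j = true
gapOK adj i j = j ≡ᵇ suc i

leftOK : End → ℕ → Bool
leftOK sq i = i ≡ᵇ 0
leftOK rd i = true

-- n = length of π; the last position (0-based) is n-1
rightOK : End → ℕ → ℕ → Bool
rightOK sq n k = suc k ≡ᵇ n
rightOK rd n k = true

isOcc : VPat → List ℕ → ℕ → ℕ → ℕ → Bool
isOcc (vp l f₁ g₁ f₂ g₂ f₃ r) π i₁ i₂ i₃ =
  ltᵇ i₁ i₂ ∧ ltᵇ i₂ i₃ ∧ gapOK g₁ i₁ i₂ ∧ gapOK g₂ i₂ i₃ ∧
  leftOK l i₁ ∧ rightOK r (length π) i₃ ∧
  sameOrder (app π i₁) (app π i₂) (app π i₃) f₁ f₂ f₃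

triples : ℕ → List (ℕ × ℕ × ℕ)
triples n = concatMap (λ a → concatMap (λ b → map (λ c → (a , b , c)) (upTo n)) (upTo n)) (upTo n)

pat : VPat → List ℕ → ℕ
pat φ π = countB (λ { (a , b , c) → isOcc φ π a b c }) (triples (length π))

ℕ→ℚ : ℕ → ℚ
ℕ→ℚ m = + m / 1

-- division in ℚ, made total by x // 0 = 0 (only used with nonzero divisors)
infixl 7 _//_
_//_ : ℚ → ℚ → ℚ
p // q with q ≟ 0ℚ
... | yes _ = 0ℚ
... | no q≢0 = _÷_ p q {{≢-nonZero q≢0}}

mean : {n : ℕ} → (List ℕ → ℕ) → Partition n → ℚ
mean s λ′ = ℕ→ℚ (sum (map s (conjClass λ′))) // ℕ→ℚ (length (conjClass λ′))

-- The functions e₁,…,e₇ of λ (binomials of p-1 read as polynomials,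
-- binom(x,2) = x(x-1)/2, binom(x,3) = x(x-1)(x-2)/6, also when p = 0)

binom2 : ℚ → ℚ
binom2 x = x * (x - 1) // 2

binom3 : ℚ → ℚ
binom3 x = x * (x - 1) * (x - 2) // 6

module _ {n : ℕ} (λ′ : Partition n) where
  private
    p q r p₁ : ℚ
    p = ℕ→ℚ (mult 1 λ′)
    q = ℕ→ℚ (mult 2 λ′)
    r = ℕ→ℚ (mult 3 λ′)
    p₁ = p - 1

  e₁ e₂ e₃ e₄ e₅ e₆ e₇ : ℚ
  e₁ = 1
  e₂ = p₁
  e₃ = binom2 p₁ + q - 1
  e₄ = binom2 p₁ - q
  e₅ = binom3 p₁ + p₁ * (q - 1) + r
  e₆ = 2 * binom3 p₁ - p - r + 2
  e₇ = binom3 p₁ - q * p₁ + r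

record Row : Set where
  constructor row
  field
    patterns : List VPat
    a₁ a₂ a₃ a₄ a₆ : ℚ
open Row public

table : ℕ → List Row
table n =
    row
        ((vp rd 1 dash 2 dash 3 rd) ∷ [])
        (c3 // 6)
        ((N + 1) * (3 * N - 4) // 60)
        ((N + 1) // 30)
        ((3 * N - 2) // 30)
        (1 // 15)
  ∷ row
        ((vp rd 1 dash 3 dash 2 rd) ∷ (vp rd 2 dash 1 dash 3 rd) ∷ [])
        (c3 // 6)
        ((N + 1) * (N - 3) // 60)
        (- ((N + 1) // 60))
        (- ((N + 1) // 20))
        (- (1 // 30))
  ∷ row
        ((vp rd 2 dash 3 dash 1 rd) ∷ (vp rd 3 dash 1 dash 2 rd) ∷ [])
        (c3 // 6)
        (- ((N + 1) * (3 * N - 4) // 120))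
        (- ((N + 1) // 60))
        ((N + 1) // 30)
        (- (1 // 30))
  ∷ row
        ((vp rd 3 dash 2 dash 1 rd) ∷ [])
        (c3 // 6)
        (- ((N + 1) * (N - 3) // 30))
        ((N + 1) // 30)
        (- ((2 * N - 3) // 30))
        (1 // 15)
  ∷ row
        ((vp rd 1 adj 2 dash 3 rd) ∷ (vp rd 1 dash 2 adj 3 rd) ∷ [])
        (c2 // 6)
        ((N * N + 3 * N - 6) // (12 * N))
        ((N + 2) // (12 * N))
        ((5 * N - 6) // (12 * N))
        (1 // (4 * N))
  ∷ row
        ((vp rd 1 adj 3 dash 2 rd) ∷ (vp rd 2 dash 1 adj 3 rd) ∷ [])
        (c2 // 6)
        ((N - 3) // (6 * N))
        (- ((N - 1) // (6 * N)))
        (- (1 // (2 * N)))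
        (0)
  ∷ row
        ((vp rd 2 adj 1 dash 3 rd) ∷ (vp rd 1 dash 3 adj 2 rd) ∷ [])
        (c2 // 6)
        (N * (N - 3) // (12 * N))
        ((N - 4) // (12 * N))
        (- (1 // 4))
        (- (1 // (4 * N)))
  ∷ row
        ((vp rd 2 adj 3 dash 1 rd) ∷ (vp rd 3 dash 1 adj 2 rd) ∷ [])
        (c2 // 6)
        (- (N * (N - 1) // (12 * N)))
        ((N - 4) // (12 * N))
        (1 // 12)
        (- (1 // (4 * N)))
  ∷ row
        ((vp rd 3 adj 1 dash 2 rd) ∷ (vp rd 2 dash 3 adj 1 rd) ∷ [])
        (c2 // 6)
        (- ((2 * N - 3) // (6 * N)))
        (- ((N - 1) // (6 * N)))
        (1 // (2 * N))
        (0)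
  ∷ row
        ((vp rd 3 adj 2 dash 1 rd) ∷ (vp rd 3 dash 2 adj 1 rd) ∷ [])
        (c2 // 6)
        (- ((N + 2) * (N - 3) // (12 * N)))
        ((N + 2) // (12 * N))
        (- ((N - 2) // (4 * N)))
        (1 // (4 * N))
  ∷ row
        ((vp sq 1 dash 2 dash 3 rd) ∷ (vp rd 1 dash 2 dash 3 sq) ∷ [])
        (c2 // 6)
        ((5 * N - 7) // 24)
        (1 // 8)
        (5 // 24)
        (1 // (8 * N))
  ∷ row
        ((vp sq 1 dash 3 dash 2 rd) ∷ (vp rd 2 dash 1 dash 3 sq) ∷ [])
        (c2 // 6)
        ((N - 3) // 8)
        (- (1 // 8))
        (- (5 // 24))
        (- (1 // (8 * N)))
  ∷ row
        ((vp sq 2 dash 1 dash 3 rd) ∷ (vp rd 1 dash 3 dash 2 sq) ∷ [])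
        (c2 // 6)
        (0)
        (0)
        (- (1 // 6))
        (0)
  ∷ row
        ((vp sq 2 dash 3 dash 1 rd) ∷ (vp rd 3 dash 1 dash 2 sq) ∷ [])
        (c2 // 6)
        (- ((N - 2) // 6))
        (0)
        (1 // 6)
        (0)
  ∷ row
        ((vp sq 3 dash 1 dash 2 rd) ∷ (vp rd 2 dash 3 dash 1 sq) ∷ [])
        (c2 // 6)
        (- ((N + 1) // 24))
        (- (1 // 8))
        (1 // 8)
        (- (1 // (8 * N)))
  ∷ row
        ((vp sq 3 dash 2 dash 1 rd) ∷ (vp rd 3 dash 2 dash 1 sq) ∷ [])
        (c2 // 6)
        (- ((N - 3) // 8))
        (1 // 8)
        (- (1 // 8))
        (1 // (8 * N))
  ∷ row
        ((vp rd 1 adj 2 dash 3 sq) ∷ (vp sq 1 dash 2 adj 3 rd) ∷ [])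
        ((N - 2) // 6)
        (1 // 3)
        ((N + 2) // (6 * ff2))
        (1 // (2 * (N - 1)))
        (1 // (2 * ff2))
  ∷ row
        ((vp rd 1 adj 3 dash 2 sq) ∷ (vp sq 2 dash 1 adj 3 rd) ∷ [])
        ((N - 2) // 6)
        (- ((N - 3) // (6 * N)))
        (- ((2 * N - 5) // (6 * ff2)))
        (- (1 // (2 * ff2)))
        (1 // (2 * ff2))
  ∷ row
        ((vp rd 2 adj 1 dash 3 sq) ∷ (vp sq 1 dash 3 adj 2 rd) ∷ [])
        ((N - 2) // 6)
        ((2 * N + 1) * (N - 3) // (6 * ff2))
        ((N - 7) // (6 * ff2))
        (- ((N + 1) // (2 * ff2)))
        (- (1 // ff2))
  ∷ row
        ((vp rd 2 adj 3 dash 1 sq) ∷ (vp sq 3 dash 1 adj 2 rd) ∷ [])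
        ((N - 2) // 6)
        (- ((N * N - 4 * N + 9) // (6 * ff2)))
        ((N - 7) // (6 * ff2))
        ((N - 3) // (2 * ff2))
        (- (1 // ff2))
  ∷ row
        ((vp rd 3 adj 1 dash 2 sq) ∷ (vp sq 2 dash 3 adj 1 rd) ∷ [])
        ((N - 2) // 6)
        (- ((N * N + 2 * N - 9) // (6 * ff2)))
        (- ((2 * N - 5) // (6 * ff2)))
        (3 // (2 * ff2))
        (1 // (2 * ff2))
  ∷ row
        ((vp rd 3 adj 2 dash 1 sq) ∷ (vp sq 3 dash 2 adj 1 rd) ∷ [])
        ((N - 2) // 6)
        (- ((N + 2) * (N - 3) // (6 * ff2)))
        ((N + 2) // (6 * ff2))
        (- ((N - 2) // (2 * ff2)))
        (1 // (2 * ff2))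
  ∷ row
        ((vp sq 1 adj 2 dash 3 rd) ∷ (vp rd 1 dash 2 adj 3 sq) ∷ [])
        ((N - 2) // 6)
        ((N * N + 5 * N - 12) // (6 * ff2))
        (1 // (3 * N))
        ((N - 2) // ff2)
        (0)
  ∷ row
        ((vp sq 1 adj 3 dash 2 rd) ∷ (vp rd 2 dash 1 adj 3 sq) ∷ [])
        ((N - 2) // 6)
        ((N + 2) * (N - 3) // (6 * ff2))
        (- (2 // (3 * N)))
        (- (1 // ff2))
        (0)
  ∷ row
        ((vp sq 2 adj 1 dash 3 rd) ∷ (vp rd 1 dash 3 adj 2 sq) ∷ [])
        ((N - 2) // 6)
        ((N - 3) * (N - 4) // (6 * ff2))
        (1 // (3 * N))
        (- ((N - 2) // ff2))
        (0)
  ∷ row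
        ((vp sq 2 adj 3 dash 1 rd) ∷ (vp rd 3 dash 1 adj 2 sq) ∷ [])
        ((N - 2) // 6)
        (- ((N * N - N - 3) // (3 * ff2)))
        (1 // (3 * N))
        (1 // ff2)
        (0)
  ∷ row
        ((vp sq 3 adj 1 dash 2 rd) ∷ (vp rd 2 dash 3 adj 1 sq) ∷ [])
        ((N - 2) // 6)
        ((N - 6) // (6 * N))
        (- (2 // (3 * N)))
        (1 // ff2)
        (0)
  ∷ row
        ((vp sq 3 adj 2 dash 1 rd) ∷ (vp rd 3 dash 2 adj 1 sq) ∷ (vp sq 3 dash 2 dash 1 sq) ∷ [])
        ((N - 2) // 6)
        (- ((N - 3) // (3 * N)))
        (1 // (3 * N))
        (- (1 // ff2))
        (0)
  ∷ row
        ((vp sq 1 dash 2 dash 3 sq) ∷ [])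
        ((N - 2) // 6)
        ((2 * N - 3) // (3 * N))
        (1 // (3 * N))
        (1 // ff2)
        (0)
  ∷ row
        ((vp sq 1 dash 3 dash 2 sq) ∷ (vp sq 2 dash 1 dash 3 sq) ∷ [])
        ((N - 2) // 6)
        ((N - 3) // (6 * N))
        (- (1 // (6 * N)))
        (- (1 // (2 * N)))
        (0)
  ∷ row
        ((vp sq 2 dash 3 dash 1 sq) ∷ (vp sq 3 dash 1 dash 2 sq) ∷ [])
        ((N - 2) // 6)
        (- ((2 * N - 3) // (6 * N)))
        (- (1 // (6 * N)))
        (1 // (2 * N))
        (0)
  ∷ row
        ((vp rd 1 adj 2 adj 3 rd) ∷ [])
        ((N - 2) // 6)
        (1 // N)
        (1 // ff2)
        (1 // N)
        (1 // ff2)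
  ∷ row
        ((vp rd 1 adj 3 adj 2 rd) ∷ (vp rd 2 adj 1 adj 3 rd) ∷ [])
        ((N - 2) // 6)
        ((N - 3) // (2 * ff2))
        (- (1 // (2 * ff2)))
        (- (3 // (2 * ff2)))
        (- (1 // (2 * ff2)))
  ∷ row
        ((vp rd 2 adj 3 adj 1 rd) ∷ (vp rd 3 adj 1 adj 2 rd) ∷ [])
        ((N - 2) // 6)
        (- (1 // (2 * N)))
        (- (1 // (2 * ff2)))
        (1 // (2 * ff2))
        (- (1 // (2 * ff2)))
  ∷ row
        ((vp rd 3 adj 2 adj 1 rd) ∷ [])
        ((N - 2) // 6)
        (- ((N - 3) // ff2))
        (1 // ff2)
        (- ((N - 3) // ff2))
        (1 // ff2)
  ∷ row
        ((vp sq 1 adj 2 adj 3 rd) ∷ (vp rd 1 adj 2 adj 3 sq) ∷ [])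
        (1 // 6)
        (1 // (N * (N - 2)))
        (1 // ff3)
        (1 // (N * (N - 2)))
        (1 // ff3)
  ∷ row
        ((vp sq 1 adj 3 adj 2 rd) ∷ (vp rd 2 adj 1 adj 3 sq) ∷ [])
        (1 // 6)
        ((2 * N - 6) // ff3)
        (- (2 // ff3))
        ((N - 6) // ff3)
        (- (2 // ff3))
  ∷ row
        ((vp sq 2 adj 1 adj 3 rd) ∷ (vp rd 1 adj 3 adj 2 sq) ∷ (vp sq 3 adj 2 adj 1 rd) ∷ (vp rd 3 adj 2 adj 1 sq) ∷ [])
        (1 // 6)
        (- ((N - 3) // ff3))
        (1 // ff3)
        (- ((N - 3) // ff3))
        (1 // ff3)
  ∷ row
        ((vp sq 2 adj 3 adj 1 rd) ∷ (vp rd 3 adj 1 adj 2 sq) ∷ [])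
        (1 // 6)
        (- ((2 * N - 5) // ff3))
        (1 // ff3)
        (- ((N - 5) // ff3))
        (1 // ff3)
  ∷ row
        ((vp sq 3 adj 1 adj 2 rd) ∷ (vp rd 2 adj 3 adj 1 sq) ∷ [])
        (1 // 6)
        ((N - 4) // ff3)
        (- (2 // ff3))
        ((N - 4) // ff3)
        (- (2 // ff3))
  ∷ row
        ((vp sq 1 adj 2 dash 3 sq) ∷ (vp sq 1 dash 2 adj 3 sq) ∷ [])
        (1 // 6)
        ((N + 1) // (2 * ff2))
        (1 // (2 * ff2))
        (1 // (2 * ff2))
        (- (1 // (2 * ff3)))
  ∷ row
        ((vp sq 1 adj 3 dash 2 sq) ∷ (vp sq 2 dash 1 adj 3 sq) ∷ [])
        (1 // 6)
        (0)
        (- (1 // ff2))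
        (0)
        (1 // ff3)
  ∷ row
        ((vp sq 2 adj 1 dash 3 sq) ∷ (vp sq 1 dash 3 adj 2 sq) ∷ [])
        (1 // 6)
        ((N - 3) // (2 * ff2))
        (1 // (2 * ff2))
        (- (3 // (2 * ff2)))
        (- (1 // (2 * ff3)))
  ∷ row
        ((vp sq 2 adj 3 dash 1 sq) ∷ (vp sq 3 dash 1 adj 2 sq) ∷ [])
        (1 // 6)
        (- (1 // (2 * N)))
        (1 // (2 * ff2))
        (1 // (2 * ff2))
        (- (1 // (2 * ff3)))
  ∷ row
        ((vp sq 3 adj 1 dash 2 sq) ∷ (vp sq 2 dash 3 adj 1 sq) ∷ [])
        (1 // 6)
        (- (1 // ff2))
        (- (1 // ff2))
        (2 // ff3)
        (1 // ff3)
  ∷ row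
        ((vp sq 3 adj 2 dash 1 sq) ∷ (vp sq 3 dash 2 adj 1 sq) ∷ [])
        (1 // 6)
        (- ((N - 3) // (2 * ff2)))
        (1 // (2 * ff2))
        ((N - 6) // (2 * ff3))
        (- (1 // (2 * ff3)))
  ∷ []
  where
  N ff2 ff3 c3 c2 : ℚ
  N = ℕ→ℚ n
  ff2 = N * (N - 1)
  ff3 = N * (N - 1) * (N - 2)
  c3 = ℕ→ℚ (n C 3)
  c2 = ℕ→ℚ ((n ∸ 1) C 2)

rhs : {n : ℕ} → Row → Partition n → ℚ
rhs ρ λ′ = a₁ ρ * e₁ λ′ + a₂ ρ * e₂ λ′ + a₃ ρ * e₃ λ′ + a₄ ρ * e₄ λ′ + a₆ ρ * e₆ λ′

{-# OPTIONS --safe #-}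
module Submission where

-- Over a conjugacy class C, the sum of pat_φ is the sum, over positions a < b < c
-- admitted by φ and values x, y, z ordered as φ, of the number w of π ∈ C with
-- π a = x, π b = y, π c = z.  Conjugation by transpositions shows that w depends
-- only on the coincidences between {a,b,c} and {x,y,z}, that is on the isomorphism
-- type of the graph with edges a → x, b → y, c → z, and double counting gives
-- w (n)_k = Σ_{π ∈ C} (number of copies of the graph in π), where k is its number of
-- vertices.  For each of the ten types that number is a polynomial in n, p, q, r.
-- Merging the increasing sequences of positions and of values yields one of 63
-- Delannoy paths; if φ imposes m end and adjacency conditions, then a path that is
-- compatible with them is realised by (n)_k / ((k - m)! (n)_m) choices of positions
-- and values.  Hence (n)_m times the mean is an explicit combination of the ten
-- polynomials, and each entry of the table is an identity of rational functions
-- in n, p, q, r, decided by normalising polynomials.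

open import Defs
open import Data.Bool using (Bool; true; false; _∧_; not; if_then_else_)
open import Data.Bool.ListAction using (all)
open import Data.Bool.Properties using (∧-assoc; ∧-comm)
open import Data.Nat as ℕ using (ℕ; zero; suc; _∸_; _≡ᵇ_; _<ᵇ_; _≤_; _<_; z≤n; s≤s; _!)
import Data.Nat.Combinatorics as Comb
import Data.Nat.DivMod as ℕD
open import Data.Nat.ListAction using (sum)
import Data.Nat.Properties as ℕₚ
import Data.Nat.Tactic.RingSolver as ℕSolver
open import Data.Integer using (ℤ; +_; -[1+_]; 0ℤ; 1ℤ; _+_; _*_; _-_; -_; +≤+)
  renaming (_≤_ to _≤ℤ_)
import Data.Integer.Properties as ℤₚ
open import Data.Integer.Tactic.RingSolver using (solve-∀)
open import Data.Rational as ℚ using (ℚ; 0ℚ)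
import Data.Rational.Properties as ℚₚ
import Data.Rational.Solver as ℚSolver
import Data.Rational.Unnormalised as ℚᵘ
import Data.Rational.Unnormalised.Properties as ℚᵘₚ
open import Data.Fin as Fin using (Fin)
open import Data.Vec using (Vec; []; _∷_; lookup)
open import Data.List
  using (List; []; _∷_; _++_; map; concatMap; length; upTo; downFrom; replicate; applyUpTo; drop)
import Data.List.Properties as Listₚ
open import Data.List.Membership.Propositional using (_∈_; find)
open import Data.List.Membership.Propositional.Properties
  using (∈-upTo⁺; ∈-upTo⁻; ∈-++⁻; ∈-map⁺; ∈-map⁻; ∈-concatMap⁺; ∈-concatMap⁻)
open import Data.List.Relation.Binary.Permutation.Propositional using (_↭_; ↭-refl; ↭-trans; prep)
  renaming (swap to ↭-swap)
open import Data.List.Relation.Binary.Permutation.Propositional.Properties using ()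
  renaming (map⁺ to ↭-map⁺)
open import Data.List.Relation.Unary.All as All using (All; []; _∷_)
import Data.List.Relation.Unary.All.Properties as Allₚ
open import Data.List.Relation.Unary.AllPairs using ([]; _∷_)
open import Data.List.Relation.Unary.Any as Any using (here; there)
open import Data.List.Relation.Unary.Linked as Linked using (Linked)
open import Data.List.Relation.Unary.Linked.Properties using (Linked⇒All)
open import Data.List.Relation.Unary.Unique.Propositional using (Unique)
import Data.List.Relation.Unary.Unique.Propositional.Properties as Uniqueₚ
open import Data.Maybe using (Maybe; just; nothing; _>>=_)
import Data.Maybe as Maybe
open import Data.Empty using (⊥; ⊥-elim)
open import Data.Product using (_×_; _,_; proj₁; proj₂; ∃)
open import Data.Sum using (inj₁; inj₂)
open import Data.Unit using (⊤; tt)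
open import Function using (_∘_; id)
open import Relation.Nullary using (¬_; yes; no)
open import Relation.Nullary.Decidable using (dec-true; dec-false)
open import Relation.Binary.Definitions using (tri<; tri≈; tri>)
open import Relation.Binary.PropositionalEquality
open import Agda.Builtin.FromNat using (fromNat)

-- Ten types suffice because a partial injection with three edges is a disjoint union of paths and
-- cycles. Division is the obstacle that shapes the proof: (n)_k vanishes when n < k, the number of
-- realisations of a path has a factorial in its denominator, and the numbers of cycles are defined
-- by rounding down. Counts are therefore multiplied out and compared in ℤ, scaled by 720 (n)_m, and
-- ℚ is entered only when the table is reached. If (n)_k = 0, a path with k vertices has no
-- realisation and its shape has no copies, so the scaled identities cover n = 3, 4, 5 as well.
-- Dividing by the size of the class calls for an explicit permutation of each cycle type. The
-- values of an occurrence, like its positions, are written as a decreasing sequence. An occurrence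
-- is then a pair of sets, and the pattern only says which value each position is sent to. Ends and
-- adjacencies become empty gaps among the positions; they are transferred to gaps of the merged
-- sequence, where they are counted by stars and bars.

≡ᵇ-true : ∀ {m n} → m ≡ n → (m ≡ᵇ n) ≡ true
≡ᵇ-true {m} {n} = dec-true (m ℕ.≟ n)

≡ᵇ-false : ∀ {m n} → m ≢ n → (m ≡ᵇ n) ≡ false
≡ᵇ-false {m} {n} = dec-false (m ℕ.≟ n)

≡ᵇ-true⁻¹ : ∀ {m n} → (m ≡ᵇ n) ≡ true → m ≡ n
≡ᵇ-true⁻¹ {m} {n} e with m ℕ.≟ n
... | yes p = p
... | no m≢n with () ← trans (sym (≡ᵇ-false m≢n)) e

≡ᵇ-false⁻¹ : ∀ {m n} → (m ≡ᵇ n) ≡ false → m ≢ n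
≡ᵇ-false⁻¹ e p with () ← trans (sym (≡ᵇ-true p)) e

<ᵇ-true : ∀ {m n} → m < n → (m <ᵇ n) ≡ true
<ᵇ-true {m} {n} = dec-true (m ℕ.<? n)

<ᵇ-false : ∀ {m n} → ¬ (m < n) → (m <ᵇ n) ≡ false
<ᵇ-false {m} {n} = dec-false (m ℕ.<? n)

<ᵇ-true⁻¹ : ∀ {m n} → (m <ᵇ n) ≡ true → m < n
<ᵇ-true⁻¹ {m} {n} e with m ℕ.<? n
... | yes p = p
... | no m≮n with () ← trans (sym (<ᵇ-false m≮n)) e

Bool-ext : ∀ {a b} → (a ≡ true → b ≡ true) → (b ≡ true → a ≡ true) → a ≡ b
Bool-ext {true}  {b}     f g = sym (f refl)
Bool-ext {false} {true}  f g = g refl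
Bool-ext {false} {false} f g = refl

∧-true⁻¹ : ∀ {a b} → a ∧ b ≡ true → a ≡ true × b ≡ true
∧-true⁻¹ {true} {true} _ = refl , refl

∧-true : ∀ {a b} → a ≡ true → b ≡ true → a ∧ b ≡ true
∧-true refl refl = refl

not-true⁻¹ : ∀ {a} → not a ≡ true → a ≡ false
not-true⁻¹ {false} _ = refl

≡ᵇ-sym : ∀ m n → (m ≡ᵇ n) ≡ (n ≡ᵇ m)
≡ᵇ-sym m n = Bool-ext {m ≡ᵇ n} {n ≡ᵇ m} (≡ᵇ-true ∘ sym ∘ ≡ᵇ-true⁻¹ {m}) (≡ᵇ-true ∘ sym ∘ ≡ᵇ-true⁻¹ {n})

-- Indicators and finite sums

𝟙 : Bool → ℤ
𝟙 true  = 1ℤ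
𝟙 false = 0ℤ

𝟙-∧ : ∀ a b → 𝟙 (a ∧ b) ≡ 𝟙 a * 𝟙 b
𝟙-∧ true  b = sym (ℤₚ.*-identityˡ (𝟙 b))
𝟙-∧ false b = sym (ℤₚ.*-zeroˡ (𝟙 b))

𝟙-not : ∀ a → 𝟙 (not a) ≡ 1ℤ - 𝟙 a
𝟙-not true  = refl
𝟙-not false = refl

-- When the indicator is 0 both sides vanish, so the equation may be proved under the tested
-- condition. In this way facts such as `P a ≡ a` are used inside a sum.
𝟙-guard : ∀ b {x y} → (b ≡ true → x ≡ y) → 𝟙 b * x ≡ 𝟙 b * y
𝟙-guard true  h = cong (1ℤ *_) (h refl)
𝟙-guard false {x} {y} h = trans (ℤₚ.*-zeroˡ x) (sym (ℤₚ.*-zeroˡ y))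

𝟙-subst : ∀ u x (f : ℕ → ℤ) → 𝟙 (u ≡ᵇ x) * f x ≡ 𝟙 (u ≡ᵇ x) * f u
𝟙-subst u x f = 𝟙-guard (u ≡ᵇ x) (λ e → cong f (sym (≡ᵇ-true⁻¹ e)))

-- Values lie in ℤ rather than ℕ because the counts below subtract, by inclusion and exclusion.
∑ : ∀ {A : Set} → List A → (A → ℤ) → ℤ
∑ []       f = 0ℤ
∑ (x ∷ xs) f = f x + ∑ xs f

syntax ∑ xs (λ x → e) = ∑[ x ∈ xs ] e

∑-cong : ∀ {A : Set} (xs : List A) {f g : A → ℤ} → (∀ {x} → x ∈ xs → f x ≡ g x) → ∑ xs f ≡ ∑ xs g
∑-cong []       h = refl
∑-cong (x ∷ xs) h = cong₂ _+_ (h (here refl)) (∑-cong xs (h ∘ there))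

∑-zero : ∀ {A : Set} (xs : List A) {f : A → ℤ} → (∀ {x} → x ∈ xs → f x ≡ 0ℤ) → ∑ xs f ≡ 0ℤ
∑-zero []       h = refl
∑-zero (x ∷ xs) h = cong₂ _+_ (h (here refl)) (∑-zero xs (h ∘ there))

∑-+ : ∀ {A : Set} (xs : List A) (f g : A → ℤ) → (∑[ x ∈ xs ] (f x + g x)) ≡ ∑ xs f + ∑ xs g
∑-+ []       f g = refl
∑-+ (x ∷ xs) f g rewrite ∑-+ xs f g = lem (f x) (g x) (∑ xs f) (∑ xs g)
  where
  lem : ∀ a b c d → (a + b) + (c + d) ≡ (a + c) + (b + d)
  lem = solve-∀

∑-*ˡ : ∀ {A : Set} (xs : List A) c (f : A → ℤ) → (∑[ x ∈ xs ] (c * f x)) ≡ c * ∑ xs f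
∑-*ˡ []       c f = sym (ℤₚ.*-zeroʳ c)
∑-*ˡ (x ∷ xs) c f = trans (cong (_+_ (c * f x)) (∑-*ˡ xs c f)) (sym (ℤₚ.*-distribˡ-+ c (f x) (∑ xs f)))

∑-*ʳ : ∀ {A : Set} (xs : List A) (f : A → ℤ) c → (∑[ x ∈ xs ] (f x * c)) ≡ ∑ xs f * c
∑-*ʳ []       f c = sym (ℤₚ.*-zeroˡ c)
∑-*ʳ (x ∷ xs) f c = trans (cong (_+_ (f x * c)) (∑-*ʳ xs f c)) (sym (ℤₚ.*-distribʳ-+ c (f x) (∑ xs f)))

∑-neg : ∀ {A : Set} (xs : List A) (f : A → ℤ) → (∑[ x ∈ xs ] (- f x)) ≡ - ∑ xs f
∑-neg []       f = refl
∑-neg (x ∷ xs) f = trans (cong (_+_ (- f x)) (∑-neg xs f)) (sym (ℤₚ.neg-distrib-+ (f x) (∑ xs f)))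

∑-- : ∀ {A : Set} (xs : List A) (f g : A → ℤ) → (∑[ x ∈ xs ] (f x - g x)) ≡ ∑ xs f - ∑ xs g
∑-- xs f g = trans (∑-+ xs f (-_ ∘ g)) (cong (_+_ (∑ xs f)) (∑-neg xs g))

∑-const : ∀ {A : Set} (xs : List A) c → (∑[ _ ∈ xs ] c) ≡ + length xs * c
∑-const []       c = sym (ℤₚ.*-zeroˡ c)
∑-const (x ∷ xs) c = trans (cong (_+_ c) (∑-const xs c)) (sym (ℤₚ.suc-* (+ length xs) c))

∑-++ : ∀ {A : Set} (xs ys : List A) (f : A → ℤ) → ∑ (xs ++ ys) f ≡ ∑ xs f + ∑ ys f
∑-++ []       ys f = sym (ℤₚ.+-identityˡ _)
∑-++ (x ∷ xs) ys f = trans (cong (_+_ (f x)) (∑-++ xs ys f)) (sym (ℤₚ.+-assoc (f x) (∑ xs f) (∑ ys f)))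

∑-map : ∀ {A B : Set} (g : A → B) xs (f : B → ℤ) → ∑ (map g xs) f ≡ ∑ xs (f ∘ g)
∑-map g []       f = refl
∑-map g (x ∷ xs) f = cong (_+_ (f (g x))) (∑-map g xs f)

∑-concatMap : ∀ {A B : Set} (g : A → List B) xs (f : B → ℤ) → ∑ (concatMap g xs) f ≡ (∑[ x ∈ xs ] ∑ (g x) f)
∑-concatMap g []       f = refl
∑-concatMap g (x ∷ xs) f = trans (∑-++ (g x) (concatMap g xs) f) (cong (_+_ (∑ (g x) f)) (∑-concatMap g xs f))

∑-swap : ∀ {A B : Set} (xs : List A) (ys : List B) (f : A → B → ℤ) →
  (∑[ x ∈ xs ] ∑[ y ∈ ys ] f x y) ≡ (∑[ y ∈ ys ] ∑[ x ∈ xs ] f x y)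
∑-swap []       ys f = sym (∑-zero ys (λ _ → refl))
∑-swap (x ∷ xs) ys f = trans (cong (_+_ (∑ ys (f x))) (∑-swap xs ys f)) (sym (∑-+ ys (f x) _))

∑-filterB : ∀ {A : Set} (p : A → Bool) xs (f : A → ℤ) → ∑ (filterB p xs) f ≡ (∑[ x ∈ xs ] (𝟙 (p x) * f x))
∑-filterB p []       f = refl
∑-filterB p (x ∷ xs) f with p x
... | true  = cong₂ _+_ (sym (ℤₚ.*-identityˡ (f x))) (∑-filterB p xs f)
... | false = trans (∑-filterB p xs f) (sym (trans (cong (λ z → z + ∑ xs (λ x → 𝟙 (p x) * f x)) (ℤₚ.*-zeroˡ (f x))) (ℤₚ.+-identityˡ _)))

∑-length : ∀ {A : Set} (xs : List A) → (∑[ _ ∈ xs ] 1ℤ) ≡ + length xs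
∑-length xs = trans (∑-const xs 1ℤ) (ℤₚ.*-identityʳ _)

∑-countB : ∀ {A : Set} (p : A → Bool) xs → + countB p xs ≡ (∑[ x ∈ xs ] 𝟙 (p x))
∑-countB p xs = trans (sym (∑-length (filterB p xs)))
  (trans (∑-filterB p xs (λ _ → 1ℤ)) (∑-cong xs (λ {x} _ → ℤₚ.*-identityʳ (𝟙 (p x)))))

∑-sum-map : ∀ {A : Set} (f : A → ℕ) xs → + sum (map f xs) ≡ (∑[ x ∈ xs ] (+ f x))
∑-sum-map f []       = refl
∑-sum-map f (x ∷ xs) = trans (ℤₚ.pos-+ (f x) (sum (map f xs))) (cong (_+_ (+ f x)) (∑-sum-map f xs))

∑-upTo-suc : ∀ n f → ∑ (upTo (suc n)) f ≡ ∑ (upTo n) f + f n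
∑-upTo-suc n f = trans (cong (λ xs → ∑ xs f) (sym (Listₚ.upTo-∷ʳ n)))
  (trans (∑-++ (upTo n) (n ∷ []) f) (cong (_+_ (∑ (upTo n) f)) (ℤₚ.+-identityʳ (f n))))

∑-upTo-cong : ∀ n {f g : ℕ → ℤ} → (∀ x → x < n → f x ≡ g x) → ∑ (upTo n) f ≡ ∑ (upTo n) g
∑-upTo-cong n h = ∑-cong (upTo n) (λ {x} x∈ → h x (∈-upTo⁻ x∈))

𝟙-<suc : ∀ m n → 𝟙 (m <ᵇ suc n) ≡ 𝟙 (m <ᵇ n) + 𝟙 (m ≡ᵇ n)
𝟙-<suc m n with ℕₚ.<-cmp m n
... | tri< m<n m≢n _ rewrite <ᵇ-true m<n | ≡ᵇ-false m≢n | <ᵇ-true (ℕₚ.m<n⇒m<1+n m<n) = refl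
... | tri≈ m≮n m≡n _ rewrite <ᵇ-false m≮n | ≡ᵇ-true m≡n | <ᵇ-true (s≤s (ℕₚ.≤-reflexive m≡n)) = refl
... | tri> m≮n m≢n n<m rewrite <ᵇ-false m≮n | ≡ᵇ-false m≢n | <ᵇ-false (ℕₚ.<⇒≱ n<m ∘ ℕₚ.≤-pred) = refl

-- The factor `𝟙 (u <ᵇ n)` frees the induction on `n` from a bound on `u`.
∑-δ : ∀ n u (f : ℕ → ℤ) → (∑[ x ∈ upTo n ] (𝟙 (u ≡ᵇ x) * f x)) ≡ 𝟙 (u <ᵇ n) * f u
∑-δ zero    u f = refl
∑-δ (suc n) u f = begin
  ∑ (upTo (suc n)) g                      ≡⟨ ∑-upTo-suc n g ⟩
  ∑ (upTo n) g + 𝟙 (u ≡ᵇ n) * f n         ≡⟨ cong₂ _+_ (∑-δ n u f) (𝟙-subst u n f) ⟩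
  𝟙 (u <ᵇ n) * f u + 𝟙 (u ≡ᵇ n) * f u     ≡⟨ sym (ℤₚ.*-distribʳ-+ (f u) (𝟙 (u <ᵇ n)) (𝟙 (u ≡ᵇ n))) ⟩
  (𝟙 (u <ᵇ n) + 𝟙 (u ≡ᵇ n)) * f u         ≡⟨ cong (_* f u) (sym (𝟙-<suc u n)) ⟩
  𝟙 (u <ᵇ suc n) * f u                    ∎
  where
  open ≡-Reasoning
  g = λ x → 𝟙 (u ≡ᵇ x) * f x

∑-δ-< : ∀ {n u} (f : ℕ → ℤ) → u < n → (∑[ x ∈ upTo n ] (𝟙 (u ≡ᵇ x) * f x)) ≡ f u
∑-δ-< {n} {u} f u<n = trans (∑-δ n u f) (trans (cong (λ b → 𝟙 b * f u) (<ᵇ-true u<n)) (ℤₚ.*-identityˡ (f u)))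

-- Decreasing sequences

-- The `k`-subsets of {0, ..., n - 1}, divided according to whether they contain the top element.
-- With the largest element first, removing it is a structural step; positions a < b < c therefore
-- appear as `c ∷ b ∷ a ∷ []`.
dec : ℕ → ℕ → List (List ℕ)
dec zero    n       = [] ∷ []
dec (suc k) zero    = []
dec (suc k) (suc n) = dec (suc k) n ++ map (n ∷_) (dec k n)

Desc : ℕ → List ℕ → Set
Desc n []      = ⊤
Desc n (x ∷ s) = x < n × Desc x s

Desc-weaken : ∀ {m n} s → m ≤ n → Desc m s → Desc n s
Desc-weaken []      m≤n d         = tt
Desc-weaken (x ∷ s) m≤n (x<m , d) = ℕₚ.<-≤-trans x<m m≤n , d

∈-dec⁻ : ∀ k n {s} → s ∈ dec k n → length s ≡ k × Desc n s
∈-dec⁻ zero    n       (here refl) = refl , tt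
∈-dec⁻ (suc k) (suc n) s∈ with ∈-++⁻ (dec (suc k) n) s∈
... | inj₁ s∈₁ = let l , d = ∈-dec⁻ (suc k) n s∈₁ in l , Desc-weaken _ (ℕₚ.n≤1+n n) d
... | inj₂ s∈₂ with _ , s′∈ , refl ← ∈-map⁻ (n ∷_) s∈₂ =
  let l , d = ∈-dec⁻ k n s′∈ in cong suc l , ℕₚ.n<1+n n , d

dec-empty : ∀ {k n} → n < k → dec k n ≡ []
dec-empty {suc k} {zero}  _         = refl
dec-empty {suc k} {suc n} (s≤s n<k)
  rewrite dec-empty {suc k} {n} (ℕₚ.m<n⇒m<1+n n<k) | dec-empty {k} {n} n<k = refl

∑-dec-suc : ∀ k n (f : List ℕ → ℤ) →
  ∑ (dec (suc k) (suc n)) f ≡ ∑ (dec (suc k) n) f + (∑[ s ∈ dec k n ] f (n ∷ s))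
∑-dec-suc k n f = trans (∑-++ (dec (suc k) n) _ f) (cong (_+_ (∑ (dec (suc k) n) f)) (∑-map (n ∷_) (dec k n) f))

∑-dec : ∀ k n (f : List ℕ → ℤ) → ∑ (dec (suc k) n) f ≡ (∑[ x ∈ upTo n ] ∑[ s ∈ dec k x ] f (x ∷ s))
∑-dec k zero    f = refl
∑-dec k (suc n) f = trans (∑-dec-suc k n f)
  (trans (cong (_+ (∑[ s ∈ dec k n ] f (n ∷ s))) (∑-dec k n f))
         (sym (∑-upTo-suc n (λ x → ∑[ s ∈ dec k x ] f (x ∷ s)))))

-- Merging two decreasing sequences

-- Reading the union of two sets from its largest element downwards, a step records whether the
-- element lies in the first set only, in the second only, or in both.
data Step : Set where
  inL inR inLR : Step

left right : List Step → List ℕ → List ℕ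
left (inL  ∷ ℓ) (x ∷ s) = x ∷ left ℓ s
left (inR  ∷ ℓ) (x ∷ s) = left ℓ s
left (inLR ∷ ℓ) (x ∷ s) = x ∷ left ℓ s
left _          _       = []
right (inL  ∷ ℓ) (x ∷ s) = right ℓ s
right (inR  ∷ ℓ) (x ∷ s) = x ∷ right ℓ s
right (inLR ∷ ℓ) (x ∷ s) = x ∷ right ℓ s
right _          _       = []

-- The Delannoy paths from (0,0) to (i,j).
paths : ℕ → ℕ → List (List Step)
paths zero    zero    = [] ∷ []
paths zero    (suc j) = map (inR ∷_) (paths zero j)
paths (suc i) zero    = map (inL ∷_) (paths i zero)
paths (suc i) (suc j) = map (inL ∷_) (paths i (suc j)) ++
  (map (inR ∷_) (paths (suc i) j) ++ map (inLR ∷_) (paths i j))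

private
  over : List (List Step) → ℕ → (List Step → List ℕ → ℤ) → ℤ
  over P n h = ∑[ ℓ ∈ P ] ∑[ s ∈ dec (length ℓ) n ] h ℓ s

  over-zero : ∀ σ P h → over (map (σ ∷_) P) zero h ≡ 0ℤ
  over-zero σ P h = trans (∑-map (σ ∷_) P _) (∑-zero P (λ _ → refl))

  over-suc : ∀ σ P n h → over (map (σ ∷_) P) (suc n) h ≡
    over (map (σ ∷_) P) n h + over P n (λ ℓ s → h (σ ∷ ℓ) (n ∷ s))
  over-suc σ P n h = begin
    over (map (σ ∷_) P) (suc n) h
      ≡⟨ ∑-map (σ ∷_) P _ ⟩
    (∑[ ℓ ∈ P ] ∑[ s ∈ dec (suc (length ℓ)) (suc n) ] h (σ ∷ ℓ) s)
      ≡⟨ ∑-cong P (λ {ℓ} _ → ∑-dec-suc (length ℓ) n (h (σ ∷ ℓ))) ⟩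
    (∑[ ℓ ∈ P ] (∑ (dec (suc (length ℓ)) n) (h (σ ∷ ℓ)) + (∑[ s ∈ dec (length ℓ) n ] h (σ ∷ ℓ) (n ∷ s))))
      ≡⟨ ∑-+ P _ _ ⟩
    (∑[ ℓ ∈ P ] ∑ (dec (suc (length ℓ)) n) (h (σ ∷ ℓ))) + over P n (λ ℓ s → h (σ ∷ ℓ) (n ∷ s))
      ≡⟨ cong (_+ over P n (λ ℓ s → h (σ ∷ ℓ) (n ∷ s))) (sym (∑-map (σ ∷_) P _)) ⟩
    over (map (σ ∷_) P) n h + over P n (λ ℓ s → h (σ ∷ ℓ) (n ∷ s)) ∎
    where open ≡-Reasoning

  over-++ : ∀ P Q n h → over (P ++ Q) n h ≡ over P n h + over Q n h
  over-++ P Q n h = ∑-++ P Q _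

-- A pair of sets amounts to its union `s` together with the membership record `ℓ`. The induction on
-- `n` asks in which of the two sets the top element lies.
∑-merge : ∀ i j n (f : List ℕ → List ℕ → ℤ) →
  (∑[ s ∈ dec i n ] ∑[ t ∈ dec j n ] f s t) ≡
  (∑[ ℓ ∈ paths i j ] ∑[ s ∈ dec (length ℓ) n ] f (left ℓ s) (right ℓ s))
∑-merge zero    zero    n       f = refl
∑-merge (suc i) zero    zero    f = sym (over-zero inL (paths i zero) _)
∑-merge zero    (suc j) zero    f = sym (over-zero inR (paths zero j) _)
∑-merge (suc i) (suc j) zero    f = sym (begin
  over (map (inL ∷_) (paths i (suc j)) ++ (map (inR ∷_) (paths (suc i) j) ++ map (inLR ∷_) (paths i j))) zero h
    ≡⟨ over-++ (map (inL ∷_) (paths i (suc j))) _ zero h ⟩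
  over (map (inL ∷_) (paths i (suc j))) zero h + over (map (inR ∷_) (paths (suc i) j) ++ map (inLR ∷_) (paths i j)) zero h
    ≡⟨ cong₂ _+_ (over-zero inL (paths i (suc j)) h)
        (trans (over-++ (map (inR ∷_) (paths (suc i) j)) _ zero h)
               (cong₂ _+_ (over-zero inR (paths (suc i) j) h) (over-zero inLR (paths i j) h))) ⟩
  0ℤ ∎)
  where
  open ≡-Reasoning
  h = λ ℓ s → f (left ℓ s) (right ℓ s)
∑-merge (suc i) zero    (suc n) f = begin
  (∑[ s ∈ dec (suc i) (suc n) ] ∑[ t ∈ dec zero n ] f s t)
    ≡⟨ ∑-dec-suc i n _ ⟩
  (∑[ s ∈ dec (suc i) n ] ∑[ t ∈ dec zero n ] f s t) + (∑[ s ∈ dec i n ] ∑[ t ∈ dec zero n ] f (n ∷ s) t)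
    ≡⟨ cong₂ _+_ (∑-merge (suc i) zero n f) (∑-merge i zero n (λ s t → f (n ∷ s) t)) ⟩
  over (paths (suc i) zero) n _ + over (paths i zero) n _
    ≡⟨ sym (over-suc inL (paths i zero) n _) ⟩
  over (paths (suc i) zero) (suc n) _ ∎
  where open ≡-Reasoning
∑-merge zero    (suc j) (suc n) f = begin
  (∑[ s ∈ dec zero n ] ∑[ t ∈ dec (suc j) (suc n) ] f s t)
    ≡⟨ cong (_+ 0ℤ) (∑-dec-suc j n _) ⟩
  ((∑[ t ∈ dec (suc j) n ] f [] t) + (∑[ t ∈ dec j n ] f [] (n ∷ t))) + 0ℤ
    ≡⟨ lem (∑[ t ∈ dec (suc j) n ] f [] t) (∑[ t ∈ dec j n ] f [] (n ∷ t)) ⟩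
  (∑[ s ∈ dec zero n ] ∑[ t ∈ dec (suc j) n ] f s t) + (∑[ s ∈ dec zero n ] ∑[ t ∈ dec j n ] f s (n ∷ t))
    ≡⟨ cong₂ _+_ (∑-merge zero (suc j) n f) (∑-merge zero j n (λ s t → f s (n ∷ t))) ⟩
  over (paths zero (suc j)) n _ + over (paths zero j) n _
    ≡⟨ sym (over-suc inR (paths zero j) n _) ⟩
  over (paths zero (suc j)) (suc n) _ ∎
  where
  open ≡-Reasoning
  lem : ∀ a b → (a + b) + 0ℤ ≡ (a + 0ℤ) + (b + 0ℤ)
  lem = solve-∀
∑-merge (suc i) (suc j) (suc n) f = begin
  (∑[ s ∈ dec (suc i) (suc n) ] ∑[ t ∈ dec (suc j) (suc n) ] f s t)
    ≡⟨ ∑-cong (dec (suc i) (suc n)) (λ {s} _ → ∑-dec-suc j n (f s)) ⟩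
  (∑[ s ∈ dec (suc i) (suc n) ] (∑ (dec (suc j) n) (f s) + (∑[ t ∈ dec j n ] f s (n ∷ t))))
    ≡⟨ trans (∑-dec-suc i n _) (cong₂ _+_ (∑-+ (dec (suc i) n) _ _) (∑-+ (dec i n) _ _)) ⟩
  ((∑[ s ∈ dec (suc i) n ] ∑[ t ∈ dec (suc j) n ] f s t) + (∑[ s ∈ dec (suc i) n ] ∑[ t ∈ dec j n ] f s (n ∷ t))) +
  ((∑[ s ∈ dec i n ] ∑[ t ∈ dec (suc j) n ] f (n ∷ s) t) + (∑[ s ∈ dec i n ] ∑[ t ∈ dec j n ] f (n ∷ s) (n ∷ t)))
    ≡⟨ cong₂ _+_ (cong₂ _+_ (∑-merge (suc i) (suc j) n f) (∑-merge (suc i) j n (λ s t → f s (n ∷ t))))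
                 (cong₂ _+_ (∑-merge i (suc j) n (λ s t → f (n ∷ s) t)) (∑-merge i j n (λ s t → f (n ∷ s) (n ∷ t)))) ⟩
  (over (paths (suc i) (suc j)) n h + over R′ n _) + (over L′ n _ + over LR′ n _)
    -- The pairs with the top element in neither set are sorted by the first step of their path, to
    -- be joined with the pairs in which the top element realises that step.
    ≡⟨ cong (λ z → (z + over R′ n _) + (over L′ n _ + over LR′ n _))
        (trans (over-++ L _ n h) (cong (_+_ (over L n h)) (over-++ R _ n h))) ⟩
  ((over L n h + (over R n h + over LR n h)) + over R′ n _) + (over L′ n _ + over LR′ n _)
    ≡⟨ lem (over L n h) (over R n h) (over LR n h) _ _ _ ⟩
  (over L n h + over L′ n _) + ((over R n h + over R′ n _) + (over LR n h + over LR′ n _))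
    ≡⟨ sym (cong₂ _+_ (over-suc inL L′ n h) (cong₂ _+_ (over-suc inR R′ n h) (over-suc inLR LR′ n h))) ⟩
  over L (suc n) h + (over R (suc n) h + over LR (suc n) h)
    ≡⟨ sym (trans (over-++ L _ (suc n) h) (cong (_+_ (over L (suc n) h)) (over-++ R _ (suc n) h))) ⟩
  over (paths (suc i) (suc j)) (suc n) h ∎
  where
  open ≡-Reasoning
  h = λ ℓ s → f (left ℓ s) (right ℓ s)
  L′ = paths i (suc j)
  R′ = paths (suc i) j
  LR′ = paths i j
  L = map (inL ∷_) L′
  R = map (inR ∷_) R′
  LR = map (inLR ∷_) LR′
  lem : ∀ l r b r′ l′ b′ → ((l + (r + b)) + r′) + (l′ + b′) ≡ (l + l′) + ((r + r′) + (b + b′))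
  lem = solve-∀

-- Gap conditions

_⇒ᵇ_ : Bool → Bool → Bool
true  ⇒ᵇ b = b
false ⇒ᵇ b = true

-- A sequence n > x₁ > ⋯ > x_k has k + 1 gaps, the first below n and the last
-- above -1; a flag demands that its gap be empty.
tight : List Bool → ℕ → List ℕ → Bool
tight []       n s       = true
tight (t ∷ ts) n []      = t ⇒ᵇ (n ≡ᵇ zero)
tight (t ∷ ts) n (x ∷ s) = (t ⇒ᵇ (n ≡ᵇ suc x)) ∧ tight ts x s

#free #tight : List Bool → ℕ
#free []           = zero
#free (false ∷ ts) = suc (#free ts)
#free (true  ∷ ts) = #free ts
#tight []           = zero
#tight (false ∷ ts) = #tight ts
#tight (true  ∷ ts) = suc (#tight ts)

#tight+#free : ∀ ts → #tight ts ℕ.+ #free ts ≡ length ts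
#tight+#free []           = refl
#tight+#free (true  ∷ ts) = cong suc (#tight+#free ts)
#tight+#free (false ∷ ts) = trans (ℕₚ.+-suc (#tight ts) (#free ts)) (cong suc (#tight+#free ts))

-- The number of ways to distribute r elements over f gaps.
distribute : ℕ → ℕ → ℕ
distribute zero    zero    = suc zero
distribute zero    (suc r) = zero
distribute (suc f) zero    = suc zero
distribute (suc f) (suc r) = distribute f (suc r) ℕ.+ distribute (suc f) r

distribute-0 : ∀ f → distribute f zero ≡ suc zero
distribute-0 zero    = refl
distribute-0 (suc f) = refl

distribute-1 : ∀ r → distribute (suc zero) r ≡ suc zero
distribute-1 zero    = refl
distribute-1 (suc r) = distribute-1 r

tight-free : ∀ ts m n s → tight (false ∷ ts) m s ≡ tight (false ∷ ts) n s
tight-free ts m n []      = refl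
tight-free ts m n (x ∷ s) = refl

-- Of the `k + r` elements, `r` are left out; they are distributed over the gaps that are not tight.
-- The recursion looks at the top element: below a tight first gap it must be chosen, and below a
-- free one it is either chosen, which closes the gap, or left out.
count-tight : ∀ ts k r → length ts ≡ suc k →
  (∑[ s ∈ dec k (k ℕ.+ r) ] 𝟙 (tight ts (k ℕ.+ r) s)) ≡ + distribute (#free ts) r
count-tight (false ∷ [])     zero    r       refl = cong +_ (sym (distribute-1 r))
count-tight (true  ∷ [])     zero    zero    refl = refl
count-tight (true  ∷ [])     zero    (suc r) refl = refl
count-tight (true  ∷ u ∷ ts) (suc k) r       eq   = begin
  ∑ (dec (suc k) (suc (k ℕ.+ r))) (λ s → 𝟙 (tight (true ∷ u ∷ ts) (suc (k ℕ.+ r)) s))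
    ≡⟨ ∑-dec-suc k (k ℕ.+ r) _ ⟩
  ∑ (dec (suc k) (k ℕ.+ r)) (λ s → 𝟙 (tight (true ∷ u ∷ ts) (suc (k ℕ.+ r)) s)) +
  ∑ (dec k (k ℕ.+ r)) (λ s → 𝟙 (tight (true ∷ u ∷ ts) (suc (k ℕ.+ r)) (k ℕ.+ r ∷ s)))
    ≡⟨ cong₂ _+_ (∑-zero (dec (suc k) (k ℕ.+ r)) (λ {s} s∈ → below s (∈-dec⁻ (suc k) (k ℕ.+ r) s∈)))
        (∑-cong (dec k (k ℕ.+ r)) (λ {s} _ → cong (λ b → 𝟙 (b ∧ tight (u ∷ ts) (k ℕ.+ r) s)) (≡ᵇ-true {k ℕ.+ r} refl))) ⟩
  0ℤ + ∑ (dec k (k ℕ.+ r)) (λ s → 𝟙 (tight (u ∷ ts) (k ℕ.+ r) s))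
    ≡⟨ trans (ℤₚ.+-identityˡ _) (count-tight (u ∷ ts) k r (ℕₚ.suc-injective eq)) ⟩
  + distribute (#free (u ∷ ts)) r ∎
  where
  open ≡-Reasoning
  below : ∀ s → length s ≡ suc k × Desc (k ℕ.+ r) s → 𝟙 (tight (true ∷ u ∷ ts) (suc (k ℕ.+ r)) s) ≡ 0ℤ
  below (x ∷ s) (_ , x< , _) rewrite ≡ᵇ-false (≢-sym (ℕₚ.<⇒≢ x<)) = refl
count-tight (false ∷ u ∷ ts) (suc k) r       eq   = begin
  ∑ (dec (suc k) (suc (k ℕ.+ r))) (λ s → 𝟙 (tight (false ∷ u ∷ ts) (suc (k ℕ.+ r)) s))
    ≡⟨ ∑-dec-suc k (k ℕ.+ r) _ ⟩
  ∑ (dec (suc k) (k ℕ.+ r)) (λ s → 𝟙 (tight (false ∷ u ∷ ts) (suc (k ℕ.+ r)) s)) +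
  ∑ (dec k (k ℕ.+ r)) (λ s → 𝟙 (tight (u ∷ ts) (k ℕ.+ r) s))
    ≡⟨ cong₂ _+_ (rest r) (count-tight (u ∷ ts) k r (ℕₚ.suc-injective eq)) ⟩
  + lower r + + distribute (#free (u ∷ ts)) r
    ≡⟨ sym (ℤₚ.pos-+ (lower r) _) ⟩
  + (lower r ℕ.+ distribute (#free (u ∷ ts)) r)
    ≡⟨ cong +_ (recurrence r) ⟩
  + distribute (suc (#free (u ∷ ts))) r ∎
  where
  open ≡-Reasoning
  -- The sequences that omit the top element: it is one of the `r` left out, so there are none for r
  -- = 0.
  lower : ℕ → ℕ
  lower zero    = zero
  lower (suc r) = distribute (suc (#free (u ∷ ts))) r
  recurrence : ∀ r → lower r ℕ.+ distribute (#free (u ∷ ts)) r ≡ distribute (suc (#free (u ∷ ts))) r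
  recurrence zero    = distribute-0 (#free (u ∷ ts))
  recurrence (suc r) = ℕₚ.+-comm (lower (suc r)) _
  rest : ∀ r → ∑ (dec (suc k) (k ℕ.+ r)) (λ s → 𝟙 (tight (false ∷ u ∷ ts) (suc (k ℕ.+ r)) s)) ≡ + lower r
  rest zero rewrite dec-empty {suc k} {k ℕ.+ zero} (s≤s (ℕₚ.≤-reflexive (ℕₚ.+-identityʳ k))) = refl
  rest (suc r) rewrite ℕₚ.+-suc k r =
    trans (∑-cong (dec (suc k) (suc (k ℕ.+ r)))
            (λ {s} _ → cong 𝟙 (tight-free (u ∷ ts) (suc (suc (k ℕ.+ r))) (suc (k ℕ.+ r)) s)))
          (count-tight (false ∷ u ∷ ts) (suc k) r eq)

-- (n)_k
ff : ℕ → ℕ → ℕ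
ff n       zero    = suc zero
ff zero    (suc k) = zero
ff (suc n) (suc k) = suc n ℕ.* ff n k

ff-< : ∀ {n k} → n < k → ff n k ≡ zero
ff-< {zero}  {suc k} _         = refl
ff-< {suc n} {suc k} (s≤s n<k) rewrite ff-< n<k = ℕₚ.*-zeroʳ n

ff-NonZero : ∀ {n k} → k ≤ n → ℕ.NonZero (ff n k)
ff-NonZero {n}     {zero}  _         = _
ff-NonZero {suc n} {suc k} (s≤s k≤n) = ℕₚ.m*n≢0 (suc n) (ff n k) {{_}} {{ff-NonZero k≤n}}

ff-split : ∀ c m f → ff (c ℕ.+ m) (c ℕ.+ f) ≡ ff (c ℕ.+ m) c ℕ.* ff m f
ff-split zero    m f = sym (ℕₚ.+-identityʳ _)
ff-split (suc c) m f = trans (cong (suc (c ℕ.+ m) ℕ.*_) (ff-split c m f)) (sym (ℕₚ.*-assoc (suc (c ℕ.+ m)) (ff (c ℕ.+ m) c) (ff m f)))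

-- Pascal's rule multiplied by (f + 1)!; it drives both `distribute-ff` and `C-ff`.
ff-pascal : ∀ m f → ff (suc m) (suc f) ≡ ff m (suc f) ℕ.+ suc f ℕ.* ff m f
ff-pascal zero    zero    = refl
ff-pascal zero    (suc f) = sym (ℕₚ.*-zeroʳ f)
ff-pascal (suc m) zero    = lem m
  where
  lem : ∀ m → suc (suc m) ℕ.* suc zero ≡ suc m ℕ.* suc zero ℕ.+ suc zero
  lem = ℕSolver.solve-∀
ff-pascal (suc m) (suc f) = begin
  suc (suc m) ℕ.* X                              ≡⟨⟩
  X ℕ.+ suc m ℕ.* X                              ≡⟨ cong (λ z → X ℕ.+ suc m ℕ.* z) (ff-pascal m f) ⟩
  suc m ℕ.* b ℕ.+ suc m ℕ.* (a ℕ.+ suc f ℕ.* b)  ≡⟨ lem (suc m) a b (suc f) ⟩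
  suc m ℕ.* a ℕ.+ suc (suc f) ℕ.* (suc m ℕ.* b)  ∎
  where
  open ≡-Reasoning
  a = ff m (suc f)
  b = ff m f
  X = ff (suc m) (suc f)
  lem : ∀ m a b f → m ℕ.* b ℕ.+ m ℕ.* (a ℕ.+ f ℕ.* b) ≡ m ℕ.* a ℕ.+ (m ℕ.* b ℕ.+ f ℕ.* (m ℕ.* b))
  lem = ℕSolver.solve-∀

-- Stars and bars: `distribute (suc f) r` is the binomial coefficient of f + r over f, multiplied
-- here by f! to avoid a quotient.
distribute-ff : ∀ f r → distribute (suc f) r ℕ.* f ! ≡ ff (f ℕ.+ r) f
distribute-ff zero    r       = trans (cong (ℕ._* suc zero) (distribute-1 r)) refl
distribute-ff (suc f) zero    = sym (diag (suc f))
  where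
  diag : ∀ f → ff (f ℕ.+ zero) f ≡ f ! ℕ.+ zero
  diag zero    = refl
  diag (suc f) rewrite diag f | ℕₚ.+-identityʳ f | ℕₚ.+-identityʳ (f !) = sym (ℕₚ.+-identityʳ _)
distribute-ff (suc f) (suc r) = begin
  (distribute (suc f) (suc r) ℕ.+ distribute (suc (suc f)) r) ℕ.* (suc f ℕ.* f !)
    ≡⟨ lem (distribute (suc f) (suc r)) (distribute (suc (suc f)) r) (suc f) (f !) ⟩
  distribute (suc (suc f)) r ℕ.* (suc f ℕ.* f !) ℕ.+ suc f ℕ.* (distribute (suc f) (suc r) ℕ.* f !)
    ≡⟨ cong₂ (λ x y → x ℕ.+ suc f ℕ.* y) (distribute-ff (suc f) r) (distribute-ff f (suc r)) ⟩
  ff (suc f ℕ.+ r) (suc f) ℕ.+ suc f ℕ.* ff (f ℕ.+ suc r) f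
    ≡⟨ cong (λ z → ff z (suc f) ℕ.+ suc f ℕ.* ff (f ℕ.+ suc r) f) (sym (ℕₚ.+-suc f r)) ⟩
  ff (f ℕ.+ suc r) (suc f) ℕ.+ suc f ℕ.* ff (f ℕ.+ suc r) f
    ≡⟨ sym (ff-pascal (f ℕ.+ suc r) f) ⟩
  ff (suc f ℕ.+ suc r) (suc f) ∎
  where
  open ≡-Reasoning
  lem : ∀ a b c d → (a ℕ.+ b) ℕ.* (c ℕ.* d) ≡ b ℕ.* (c ℕ.* d) ℕ.+ c ℕ.* (a ℕ.* d)
  lem = ℕSolver.solve-∀

-- Write n = k + r and k = c + f with c tight gaps. The count times f! is (f + r)_f, and (n)_c (n -
-- c)_f = (n)_k because n - c = f + r.
count-tight-ff : ∀ ts k f n → length ts ≡ suc k → #free ts ≡ suc f → k ≤ n →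
  (∑[ s ∈ dec k n ] 𝟙 (tight ts n s)) * + (f ! ℕ.* ff n (#tight ts)) ≡ + ff n k
count-tight-ff ts k f n len free k≤n
  with r , refl ← ℕₚ.m≤n⇒∃[o]m+o≡n k≤n = begin
  (∑[ s ∈ dec k (k ℕ.+ r) ] 𝟙 (tight ts (k ℕ.+ r) s)) * + (f ! ℕ.* ff (k ℕ.+ r) c)
    ≡⟨ cong (_* + (f ! ℕ.* ff (k ℕ.+ r) c)) (trans (count-tight ts k r len) (cong (λ z → + distribute z r) free)) ⟩
  + distribute (suc f) r * + (f ! ℕ.* ff (k ℕ.+ r) c)
    ≡⟨ sym (ℤₚ.pos-* (distribute (suc f) r) _) ⟩
  + (distribute (suc f) r ℕ.* (f ! ℕ.* ff (k ℕ.+ r) c))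
    ≡⟨ cong +_ (trans (sym (ℕₚ.*-assoc (distribute (suc f) r) (f !) _)) (cong (ℕ._* ff (k ℕ.+ r) c) (distribute-ff f r))) ⟩
  + (ff (f ℕ.+ r) f ℕ.* ff (k ℕ.+ r) c)
    ≡⟨ cong +_ (trans (ℕₚ.*-comm (ff (f ℕ.+ r) f) _) (split k≡)) ⟩
  + ff (k ℕ.+ r) k ∎
  where
  open ≡-Reasoning
  c = #tight ts
  k≡ : c ℕ.+ f ≡ k
  k≡ = ℕₚ.suc-injective (trans (sym (ℕₚ.+-suc c f)) (trans (cong (c ℕ.+_) (sym free)) (trans (#tight+#free ts) len)))
  split : ∀ {k} → c ℕ.+ f ≡ k → ff (k ℕ.+ r) c ℕ.* ff (f ℕ.+ r) f ≡ ff (k ℕ.+ r) k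
  split refl rewrite ℕₚ.+-assoc c f r = sym (ff-split c (f ℕ.+ r) f)

-- The gap conditions on a merged sequence that express ts on its left part;
-- a demanded gap cannot contain an element of the right part.
pull : List Step → List Bool → Maybe (List Bool)
pull []         ts           = just ts
pull (_   ∷ ℓ)  []           = nothing
pull (inR ∷ ℓ)  (true  ∷ ts) = nothing
pull (inR ∷ ℓ)  (false ∷ ts) = Maybe.map (false ∷_) (pull ℓ (false ∷ ts))
pull (inL ∷ ℓ)  (t ∷ ts)     = Maybe.map (t ∷_) (pull ℓ ts)
pull (inLR ∷ ℓ) (t ∷ ts)     = Maybe.map (t ∷_) (pull ℓ ts)

tight-maybe : Maybe (List Bool) → ℕ → List ℕ → Bool
tight-maybe nothing   n s = false
tight-maybe (just ts) n s = tight ts n s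

tight-pull-∷ : ∀ t m n x s → tight-maybe (Maybe.map (t ∷_) m) n (x ∷ s) ≡ (t ⇒ᵇ (n ≡ᵇ suc x)) ∧ tight-maybe m x s
tight-pull-∷ t     (just ts) n x s = refl
tight-pull-∷ true  nothing   n x s with n ≡ᵇ suc x
... | true  = refl
... | false = refl
tight-pull-∷ false nothing   n x s = refl

left-Desc : ∀ ℓ n s → Desc n s → Desc n (left ℓ s)
left-Desc []         n s       d         = tt
left-Desc (inL ∷ ℓ)  n []      d         = tt
left-Desc (inR ∷ ℓ)  n []      d         = tt
left-Desc (inLR ∷ ℓ) n []      d         = tt
left-Desc (inL ∷ ℓ)  n (x ∷ s) (x<n , d) = x<n , left-Desc ℓ x s d
left-Desc (inR ∷ ℓ)  n (x ∷ s) (x<n , d) = Desc-weaken (left ℓ s) (ℕₚ.<⇒≤ x<n) (left-Desc ℓ x s d)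
left-Desc (inLR ∷ ℓ) n (x ∷ s) (x<n , d) = x<n , left-Desc ℓ x s d

#left : List Step → ℕ
#left []         = zero
#left (inL ∷ ℓ)  = suc (#left ℓ)
#left (inR ∷ ℓ)  = #left ℓ
#left (inLR ∷ ℓ) = suc (#left ℓ)

-- A right-only element that falls into a gap of the left part refutes a tight gap and cuts a free
-- gap into two free ones; any other step carries the flag over unchanged.
tight-pull : ∀ ℓ ts n s → length ts ≡ suc (#left ℓ) → length s ≡ length ℓ → Desc n s →
  tight ts n (left ℓ s) ≡ tight-maybe (pull ℓ ts) n s
tight-pull []         ts           n []      l e d = refl
tight-pull (inL ∷ ℓ)  (t ∷ ts)     n (x ∷ s) l e (x<n , d) =
  trans (cong ((t ⇒ᵇ (n ≡ᵇ suc x)) ∧_) (tight-pull ℓ ts x s (ℕₚ.suc-injective l) (ℕₚ.suc-injective e) d))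
        (sym (tight-pull-∷ t (pull ℓ ts) n x s))
tight-pull (inLR ∷ ℓ) (t ∷ ts)     n (x ∷ s) l e (x<n , d) =
  trans (cong ((t ⇒ᵇ (n ≡ᵇ suc x)) ∧_) (tight-pull ℓ ts x s (ℕₚ.suc-injective l) (ℕₚ.suc-injective e) d))
        (sym (tight-pull-∷ t (pull ℓ ts) n x s))
tight-pull (inR ∷ ℓ)  (false ∷ ts) n (x ∷ s) l e (x<n , d) =
  trans (tight-free ts n x (left ℓ s))
    (trans (tight-pull ℓ (false ∷ ts) x s l (ℕₚ.suc-injective e) d)
           (sym (tight-pull-∷ false (pull ℓ (false ∷ ts)) n x s)))
tight-pull (inR ∷ ℓ)  (true ∷ ts)  n (x ∷ s) l e (x<n , d) = gap (left ℓ s) (left-Desc ℓ x s d)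
  where
  -- The right-only element `x` itself occupies the gap below `n`, whether or not a left element
  -- follows.
  gap : ∀ s → Desc x s → tight (true ∷ ts) n s ≡ false
  gap []      _         = ≡ᵇ-false (≢-sym (ℕₚ.<⇒≢ (ℕₚ.≤-<-trans z≤n x<n)))
  gap (y ∷ s) (y<x , _) rewrite ≡ᵇ-false (≢-sym (ℕₚ.<⇒≢ (ℕₚ.≤-<-trans y<x x<n))) = refl

map-just⁻ : ∀ {A B : Set} {f : A → B} m {y} → Maybe.map f m ≡ just y → ∃ λ x → m ≡ just x × f x ≡ y
map-just⁻ (just x) refl = x , refl , refl

#tight-∷ : ∀ t {us vs} → #tight us ≡ #tight vs → #tight (t ∷ us) ≡ #tight (t ∷ vs)
#tight-∷ true  = cong suc
#tight-∷ false = id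

-- A right-only element adds one free flag, so the list grows to the gaps of the merged sequence
-- while the number of tight flags is preserved.
pull-just : ∀ ℓ ts {us} → length ts ≡ suc (#left ℓ) → pull ℓ ts ≡ just us →
  length us ≡ suc (length ℓ) × #tight us ≡ #tight ts
pull-just []         ts           l refl = l , refl
pull-just (inL ∷ ℓ)  (t ∷ ts)     l e with us , e′ , refl ← map-just⁻ (pull ℓ ts) e
  with p , q ← pull-just ℓ ts (ℕₚ.suc-injective l) e′ = cong suc p , #tight-∷ t q
pull-just (inLR ∷ ℓ)  (t ∷ ts)     l e with us , e′ , refl ← map-just⁻ (pull ℓ ts) e
  with p , q ← pull-just ℓ ts (ℕₚ.suc-injective l) e′ = cong suc p , #tight-∷ t q
pull-just (inR ∷ ℓ)  (false ∷ ts) l e with us , e′ , refl ← map-just⁻ (pull ℓ (false ∷ ts)) e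
  with p , q ← pull-just ℓ (false ∷ ts) l e′ = cong suc p , q

-- Labellings

-- A list `s` is read as the injective naming i ↦ `app s i` of the abstract vertices 0, 1, ... by
-- elements below `n`.
Labelling : ℕ → List ℕ → Set
Labelling n s = All (_< n) s × Unique s

Desc⇒< : ∀ n s → Desc n s → All (_< n) s
Desc⇒< n []      d         = []
Desc⇒< n (x ∷ s) (x<n , d) = x<n ∷ All.map (λ y<x → ℕₚ.<-trans y<x x<n) (Desc⇒< x s d)

Desc⇒Labelling : ∀ n s → Desc n s → Labelling n s
Desc⇒Labelling n s d = Desc⇒< n s d , unique n s d
  where
  unique : ∀ n s → Desc n s → Unique s
  unique n []      d         = []
  unique n (x ∷ s) (x<n , d) = All.map (λ y<x → ≢-sym (ℕₚ.<⇒≢ y<x)) (Desc⇒< x s d) ∷ unique x s d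

notInB-true : ∀ {x} L → All (x ≢_) L → notInB x L ≡ true
notInB-true []      []      = refl
notInB-true (y ∷ L) (p ∷ ps) rewrite ≡ᵇ-false p = notInB-true L ps

notInB-true⁻¹ : ∀ {x} L → notInB x L ≡ true → All (x ≢_) L
notInB-true⁻¹ []      e = []
notInB-true⁻¹ {x} (y ∷ L) e with p , q ← ∧-true⁻¹ {not (x ≡ᵇ y)} e =
  ≡ᵇ-false⁻¹ (not-true⁻¹ p) ∷ notInB-true⁻¹ L q

fresh : ℕ → List ℕ → List ℕ
fresh n L = filterB (λ x → notInB x L) (upTo n)

∑-fresh : ∀ {n} L (f : ℕ → ℤ) → Labelling n L → ∑ (fresh n L) f + ∑ L f ≡ ∑ (upTo n) f
∑-fresh {n} L f lab = trans (cong (_+ ∑ L f) (∑-filterB _ (upTo n) f)) (go L lab)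
  where
  open ≡-Reasoning
  go : ∀ L → Labelling n L → (∑[ x ∈ upTo n ] (𝟙 (notInB x L) * f x)) + ∑ L f ≡ ∑ (upTo n) f
  go []      _ = trans (ℤₚ.+-identityʳ _) (∑-cong (upTo n) (λ {x} _ → ℤₚ.*-identityˡ (f x)))
  go (y ∷ L) (y<n ∷ <n , y∉ ∷ uniq) = begin
    (∑[ x ∈ upTo n ] (𝟙 (not (x ≡ᵇ y) ∧ notInB x L) * f x)) + (f y + ∑ L f)
      ≡⟨ cong (_+ (f y + ∑ L f)) (∑-cong (upTo n) (λ {x} _ → expand x)) ⟩
    (∑[ x ∈ upTo n ] (𝟙 (notInB x L) * f x - 𝟙 (y ≡ᵇ x) * (𝟙 (notInB x L) * f x))) + (f y + ∑ L f)
      ≡⟨ cong (_+ (f y + ∑ L f)) (∑-- (upTo n) _ _) ⟩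
    ((∑[ x ∈ upTo n ] (𝟙 (notInB x L) * f x)) - (∑[ x ∈ upTo n ] (𝟙 (y ≡ᵇ x) * (𝟙 (notInB x L) * f x)))) + (f y + ∑ L f)
      ≡⟨ cong (λ z → ((∑[ x ∈ upTo n ] (𝟙 (notInB x L) * f x)) - z) + (f y + ∑ L f))
           (trans (∑-δ-< _ y<n) (trans (cong (λ b → 𝟙 b * f y) (notInB-true L y∉)) (ℤₚ.*-identityˡ (f y)))) ⟩
    ((∑[ x ∈ upTo n ] (𝟙 (notInB x L) * f x)) - f y) + (f y + ∑ L f)
      ≡⟨ cancel (∑[ x ∈ upTo n ] (𝟙 (notInB x L) * f x)) (f y) (∑ L f) ⟩
    (∑[ x ∈ upTo n ] (𝟙 (notInB x L) * f x)) + ∑ L f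
      ≡⟨ go L (<n , uniq) ⟩
    ∑ (upTo n) f ∎
    where
    cancel : ∀ a b c → (a - b) + (b + c) ≡ a + c
    cancel = solve-∀
    distr : ∀ d a b → (1ℤ - d) * a * b ≡ a * b - d * (a * b)
    distr = solve-∀
    expand : ∀ x → 𝟙 (not (x ≡ᵇ y) ∧ notInB x L) * f x ≡ 𝟙 (notInB x L) * f x - 𝟙 (y ≡ᵇ x) * (𝟙 (notInB x L) * f x)
    expand x rewrite 𝟙-∧ (not (x ≡ᵇ y)) (notInB x L) | 𝟙-not (x ≡ᵇ y) | ≡ᵇ-sym x y = distr (𝟙 (y ≡ᵇ x)) _ _

-- `L` holds the labels already chosen, the latest first. A sum over `inj` thus unfolds into nested
-- sums over lists such as `fresh n (b ∷ a ∷ [])`, the form in which copies of a graph are counted.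
inj : ℕ → ℕ → List ℕ → List (List ℕ)
inj n zero    L = [] ∷ []
inj n (suc k) L = concatMap (λ x → map (x ∷_) (inj n k (x ∷ L))) (fresh n L)

∑-inj : ∀ n k L (f : List ℕ → ℤ) →
  ∑ (inj n (suc k) L) f ≡ (∑[ x ∈ fresh n L ] ∑[ s ∈ inj n k (x ∷ L) ] f (x ∷ s))
∑-inj n k L f = trans (∑-concatMap _ (fresh n L) f)
  (∑-cong (fresh n L) (λ {x} _ → ∑-map (x ∷_) (inj n k (x ∷ L)) f))

∈-filterB⁻ : ∀ {A : Set} (p : A → Bool) xs {x} → x ∈ filterB p xs → x ∈ xs × p x ≡ true
∈-filterB⁻ p (y ∷ xs) x∈ with p y in eq
∈-filterB⁻ p (y ∷ xs) (here refl) | true  = here refl , eq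
∈-filterB⁻ p (y ∷ xs) (there x∈)  | true  = let a , b = ∈-filterB⁻ p xs x∈ in there a , b
∈-filterB⁻ p (y ∷ xs) x∈          | false = let a , b = ∈-filterB⁻ p xs x∈ in there a , b

∈-filterB⁺ : ∀ {A : Set} (p : A → Bool) {xs x} → x ∈ xs → p x ≡ true → x ∈ filterB p xs
∈-filterB⁺ p {y ∷ xs} (here refl) e rewrite e = here refl
∈-filterB⁺ p {y ∷ xs} (there x∈)  e with p y
... | true  = there (∈-filterB⁺ p x∈ e)
... | false = ∈-filterB⁺ p x∈ e

∈-fresh⁻ : ∀ {n} L {x} → x ∈ fresh n L → x < n × All (x ≢_) L
∈-fresh⁻ {n} L x∈ = let a , b = ∈-filterB⁻ _ (upTo n) x∈ in ∈-upTo⁻ a , notInB-true⁻¹ L b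

fresh-Labelling : ∀ {n} L {x} → Labelling n L → x ∈ fresh n L → Labelling n (x ∷ L)
fresh-Labelling L (<n , uniq) x∈ = let x<n , x∉ = ∈-fresh⁻ L x∈ in x<n ∷ <n , x∉ ∷ uniq

∈-concatMap⁻′ : ∀ {A B : Set} (f : A → List B) xs {y} → y ∈ concatMap f xs → ∃ λ x → x ∈ xs × y ∈ f x
∈-concatMap⁻′ f xs y∈ = find (∈-concatMap⁻ f {xs = xs} y∈)

∈-inj⁻ : ∀ n k L {s} → s ∈ inj n k L → length s ≡ k × Labelling n s × All (λ x → All (x ≢_) L) s
∈-inj⁻ n zero    L (here refl) = refl , ([] , []) , []
∈-inj⁻ n (suc k) L s∈ with x , x∈ , s∈₁ ← ∈-concatMap⁻′ (λ x → map (x ∷_) (inj n k (x ∷ L))) (fresh n L) s∈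
  with s , s∈₂ , refl ← ∈-map⁻ (x ∷_) s∈₁
  with l , (<n , uniq) , ∉ ← ∈-inj⁻ n k (x ∷ L) s∈₂
  with x<n , x∉ ← ∈-fresh⁻ L x∈ =
  cong suc l , (x<n ∷ <n , All.map (≢-sym ∘ All.head) ∉ ∷ uniq) , x∉ ∷ All.map All.tail ∉

private
  -- Over ℤ, because the recursion runs in n - length L, where truncated subtraction would call for
  -- a bound on the length of `L`.
  ffℤ : ℤ → ℕ → ℤ
  ffℤ x zero    = 1ℤ
  ffℤ x (suc k) = x * ffℤ (x - 1ℤ) k

  ffℤ-pos : ∀ n k → ffℤ (+ n) k ≡ + ff n k
  ffℤ-pos n       zero    = refl
  ffℤ-pos zero    (suc k) = ℤₚ.*-zeroˡ (ffℤ (0ℤ - 1ℤ) k)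
  ffℤ-pos (suc n) (suc k) = trans (cong (+ suc n *_) (ffℤ-pos n k)) (sym (ℤₚ.pos-* (suc n) (ff n k)))

  count-fresh : ∀ {n} L → Labelling n L → (∑[ _ ∈ fresh n L ] 1ℤ) ≡ + n - + length L
  count-fresh {n} L lab = begin
    (∑[ _ ∈ fresh n L ] 1ℤ)                                           ≡⟨ lem _ (+ length L) ⟩
    ((∑[ _ ∈ fresh n L ] 1ℤ) + + length L) - + length L                ≡⟨ cong (λ z → ((∑[ _ ∈ fresh n L ] 1ℤ) + z) - + length L) (sym (∑-length L)) ⟩
    ((∑[ _ ∈ fresh n L ] 1ℤ) + (∑[ _ ∈ L ] 1ℤ)) - + length L           ≡⟨ cong (_- + length L) (∑-fresh L (λ _ → 1ℤ) lab) ⟩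
    (∑[ _ ∈ upTo n ] 1ℤ) - + length L                                  ≡⟨ cong (_- + length L) (trans (∑-length (upTo n)) (cong +_ (Listₚ.length-upTo n))) ⟩
    + n - + length L                                                   ∎
    where
    open ≡-Reasoning
    lem : ∀ a b → a ≡ (a + b) - b
    lem = solve-∀

  count-inj′ : ∀ n k L → Labelling n L → (∑[ _ ∈ inj n k L ] 1ℤ) ≡ ffℤ (+ n - + length L) k
  count-inj′ n zero    L lab = refl
  count-inj′ n (suc k) L lab = begin
    (∑[ _ ∈ inj n (suc k) L ] 1ℤ)                                ≡⟨ ∑-inj n k L _ ⟩
    (∑[ x ∈ fresh n L ] ∑[ _ ∈ inj n k (x ∷ L) ] 1ℤ)              ≡⟨ ∑-cong (fresh n L) (λ {x} x∈ → trans (count-inj′ n k (x ∷ L) (fresh-Labelling L lab x∈)) (cong (λ z → ffℤ z k) (lem (+ n) (+ length L)))) ⟩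
    (∑[ x ∈ fresh n L ] ffℤ (d - 1ℤ) k)                           ≡⟨ ∑-cong (fresh n L) (λ _ → sym (ℤₚ.*-identityˡ _)) ⟩
    (∑[ x ∈ fresh n L ] (1ℤ * ffℤ (d - 1ℤ) k))                    ≡⟨ ∑-*ʳ (fresh n L) (λ _ → 1ℤ) _ ⟩
    (∑[ x ∈ fresh n L ] 1ℤ) * ffℤ (d - 1ℤ) k                      ≡⟨ cong (_* ffℤ (d - 1ℤ) k) (count-fresh L lab) ⟩
    d * ffℤ (d - 1ℤ) k                                            ∎
    where
    open ≡-Reasoning
    d = + n - + length L
    lem : ∀ a b → a - (1ℤ + b) ≡ (a - b) - 1ℤ
    lem = solve-∀

count-inj : ∀ n k → (∑[ _ ∈ inj n k [] ] 1ℤ) ≡ + ff n k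
count-inj n k = trans (count-inj′ n k [] ([] , [])) (trans (cong (λ z → ffℤ z k) (ℤₚ.+-identityʳ (+ n))) (ffℤ-pos n k))

-- Transpositions

swap : ℕ → ℕ → ℕ → ℕ
swap u v x with x ℕ.≟ u
... | yes _ = v
... | no _ with x ℕ.≟ v
...   | yes _ = u
...   | no _  = x

swap-left : ∀ u v → swap u v u ≡ v
swap-left u v with u ℕ.≟ u
... | yes _  = refl
... | no u≢u = ⊥-elim (u≢u refl)

swap-fix : ∀ {u v x} → x ≢ u → x ≢ v → swap u v x ≡ x
swap-fix {u} {v} {x} x≢u x≢v with x ℕ.≟ u
... | yes x≡u = ⊥-elim (x≢u x≡u)
... | no _ with x ℕ.≟ v
...   | yes x≡v = ⊥-elim (x≢v x≡v)
...   | no _    = refl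

swap-right : ∀ u v → swap u v v ≡ u
swap-right u v with v ℕ.≟ u
... | yes v≡u = v≡u
... | no _ with v ℕ.≟ v
...   | yes _  = refl
...   | no v≢v = ⊥-elim (v≢v refl)

swap-involutive : ∀ u v x → swap u v (swap u v x) ≡ x
swap-involutive u v x with x ℕ.≟ u
... | yes refl = swap-right u v
... | no x≢u with x ℕ.≟ v
...   | yes refl = swap-left u v
...   | no x≢v   = swap-fix x≢u x≢v

swap-< : ∀ {n u v} → u < n → v < n → ∀ {x} → x < n → swap u v x < n
swap-< {n} {u} {v} u<n v<n {x} x<n with x ℕ.≟ u
... | yes _ = v<n
... | no _ with x ℕ.≟ v
...   | yes _ = u<n
...   | no _  = x<n

swap-injective : ∀ u v {x y} → swap u v x ≡ swap u v y → x ≡ y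
swap-injective u v {x} {y} e = trans (sym (swap-involutive u v x)) (trans (cong (swap u v) e) (swap-involutive u v y))

swap-≡ᵇ : ∀ u v x y → (swap u v x ≡ᵇ y) ≡ (x ≡ᵇ swap u v y)
swap-≡ᵇ u v x y = Bool-ext {swap u v x ≡ᵇ y} {x ≡ᵇ swap u v y}
  (λ e → ≡ᵇ-true {x} (trans (sym (swap-involutive u v x)) (cong (swap u v) (≡ᵇ-true⁻¹ {swap u v x} e))))
  (λ e → ≡ᵇ-true {swap u v x} (trans (cong (swap u v) (≡ᵇ-true⁻¹ {x} e)) (swap-involutive u v y)))

swap-Labelling : ∀ {n u v} → u < n → v < n → ∀ {s} → Labelling n s → Labelling n (map (swap u v) s)
swap-Labelling {u = u} {v} u<n v<n (<n , uniq) =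
  Allₚ.map⁺ (All.map (swap-< u<n v<n) <n) , Uniqueₚ.map⁺ (swap-injective u v) uniq

-- Transpositions act transitively on the labellings of a given length: the
-- labels are corrected one after the other, and the swap that corrects a
-- label does not touch the ones before it.
swap-invariant⇒constant : ∀ {n k} (F : List ℕ → ℤ) →
  (∀ {u v} → u < n → v < n → ∀ {s} → length s ≡ k → Labelling n s → F (map (swap u v) s) ≡ F s) →
  ∀ {s t} → length s ≡ k → length t ≡ k → Labelling n s → Labelling n t → F s ≡ F t
swap-invariant⇒constant {n} {k} F inv {s} {t} ls lt labs labt = go [] s t (trans ls (sym lt)) ls labs labt
  where
  open ≡-Reasoning
  prefix-≢ : ∀ pre {y ys} → Unique (pre ++ y ∷ ys) → All (_≢ y) pre
  prefix-≢ []        u         = []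
  prefix-≢ (z ∷ pre) (z∉ ∷ u) = All.lookup z∉ (Mem∈ pre) ∷ prefix-≢ pre u
    where
    Mem∈ : ∀ pre {y ys} → y ∈ pre ++ y ∷ ys
    Mem∈ []        = here refl
    Mem∈ (_ ∷ pre) = there (Mem∈ pre)
  map-fix : ∀ x y pre → All (_≢ x) pre → All (_≢ y) pre → map (swap x y) pre ≡ pre
  map-fix x y []        []       []       = refl
  map-fix x y (z ∷ pre) (p ∷ ps) (q ∷ qs) = cong₂ _∷_ (swap-fix p q) (map-fix x y pre ps qs)
  go : ∀ pre s t → length s ≡ length t → length (pre ++ s) ≡ k →
    Labelling n (pre ++ s) → Labelling n (pre ++ t) → F (pre ++ s) ≡ F (pre ++ t)
  go pre []       []       l lk labs labt = refl
  go pre (x ∷ xs) (y ∷ ys) l lk labs labt = begin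
    F (pre ++ x ∷ xs)                   ≡⟨ sym (inv x<n y<n lk labs) ⟩
    F (map (swap x y) (pre ++ x ∷ xs))  ≡⟨ cong F swapped ⟩
    F ((pre ++ y ∷ []) ++ xs′)          ≡⟨ go (pre ++ y ∷ []) xs′ ys
                                             (trans (Listₚ.length-map (swap x y) xs) (ℕₚ.suc-injective l))
                                             (trans (cong length (sym swapped)) (trans (Listₚ.length-map (swap x y) (pre ++ x ∷ xs)) lk))
                                             (subst (Labelling n) swapped (swap-Labelling x<n y<n labs))
                                             (subst (Labelling n) (sym assoc) labt) ⟩
    F ((pre ++ y ∷ []) ++ ys)           ≡⟨ cong F assoc ⟩
    F (pre ++ y ∷ ys)                   ∎
    where
    xs′ = map (swap x y) xs
    x<n : x < n
    x<n = All.head (Allₚ.++⁻ʳ pre (proj₁ labs))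
    y<n : y < n
    y<n = All.head (Allₚ.++⁻ʳ pre (proj₁ labt))
    assoc : (pre ++ y ∷ []) ++ ys ≡ pre ++ y ∷ ys
    assoc = Listₚ.++-assoc pre (y ∷ []) ys
    swapped : map (swap x y) (pre ++ x ∷ xs) ≡ (pre ++ y ∷ []) ++ xs′
    swapped = begin
      map (swap x y) (pre ++ x ∷ xs)                   ≡⟨ Listₚ.map-++ (swap x y) pre (x ∷ xs) ⟩
      map (swap x y) pre ++ swap x y x ∷ xs′           ≡⟨ cong₂ (λ p z → p ++ z ∷ xs′)
                                                            (map-fix x y pre (prefix-≢ pre (proj₂ labs)) (prefix-≢ pre (proj₂ labt)))
                                                            (swap-left x y) ⟩
      pre ++ y ∷ xs′                                   ≡⟨ sym (Listₚ.++-assoc pre (y ∷ []) xs′) ⟩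
      (pre ++ y ∷ []) ++ xs′                           ∎

-- Inserting `δ (τ x) y` sums over the value y = τ x; after the two sums are exchanged, the same
-- condition is read as x = τ y. The list itself is never permuted.
∑-involution : ∀ {A : Set} (xs : List A) (δ : A → A → ℤ) (τ : A → A) →
  (∀ {x} → x ∈ xs → ∀ (g : A → ℤ) → (∑[ y ∈ xs ] (δ x y * g y)) ≡ g x) →
  (∀ {x} → x ∈ xs → τ x ∈ xs) →
  (∀ {x y} → x ∈ xs → y ∈ xs → δ (τ x) y ≡ δ (τ y) x) →
  ∀ f → ∑ xs (f ∘ τ) ≡ ∑ xs f
∑-involution xs δ τ select closed flip f = begin
  (∑[ x ∈ xs ] f (τ x))                        ≡⟨ ∑-cong xs (λ x∈ → sym (select (closed x∈) f)) ⟩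
  (∑[ x ∈ xs ] ∑[ y ∈ xs ] (δ (τ x) y * f y))  ≡⟨ ∑-swap xs xs _ ⟩
  (∑[ y ∈ xs ] ∑[ x ∈ xs ] (δ (τ x) y * f y))  ≡⟨ ∑-cong xs (λ {y} y∈ → ∑-cong xs (λ x∈ → cong (_* f y) (flip x∈ y∈))) ⟩
  (∑[ y ∈ xs ] ∑[ x ∈ xs ] (δ (τ y) x * f y))  ≡⟨ ∑-cong xs (λ {y} y∈ → select (closed y∈) (λ _ → f y)) ⟩
  (∑[ y ∈ xs ] f y)                            ∎
  where open ≡-Reasoning

∑-swap-upTo : ∀ {n u v} → u < n → v < n → ∀ (f : ℕ → ℤ) → (∑[ x ∈ upTo n ] f (swap u v x)) ≡ ∑ (upTo n) f
∑-swap-upTo {n} {u} {v} u<n v<n = ∑-involution (upTo n) (λ x y → 𝟙 (x ≡ᵇ y)) (swap u v)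
  (λ x∈ g → ∑-δ-< g (∈-upTo⁻ x∈))
  (λ x∈ → ∈-upTo⁺ (swap-< u<n v<n (∈-upTo⁻ x∈)))
  (λ {x} {y} _ _ → cong 𝟙 (trans (swap-≡ᵇ u v x y) (≡ᵇ-sym x (swap u v y))))

-- Permutations in one-line notation

record IsWord (n : ℕ) (π : List ℕ) : Set where
  field
    len   : length π ≡ n
    bound : All (_< n) π

  app-< : ∀ {i} → i < n → app π i < n
  app-< i<n = go π bound (subst (_ <_) (sym len) i<n)
    where
    go : ∀ π {i} → All (_< n) π → i < length π → app π i < n
    go (x ∷ π) {zero}  (p ∷ ps) _       = p
    go (x ∷ π) {suc i} (p ∷ ps) (s≤s q) = go π ps q

∈-words⁻ : ∀ n k {w} → w ∈ words n k → length w ≡ k × All (_< n) w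
∈-words⁻ n zero    (here refl) = refl , []
∈-words⁻ n (suc k) w∈ with w , w∈₁ , w∈₂ ← ∈-concatMap⁻′ (λ w → map (_∷ w) (upTo n)) (words n k) w∈
  with x , x∈ , refl ← ∈-map⁻ (_∷ w) w∈₂ =
  let l , b = ∈-words⁻ n k w∈₁ in cong suc l , ∈-upTo⁻ x∈ ∷ b

∈-words⁺ : ∀ n k {w} → length w ≡ k → All (_< n) w → w ∈ words n k
∈-words⁺ n zero    {[]}    l    b        = here refl
∈-words⁺ n (suc k) {x ∷ w} refl (p ∷ ps) =
  ∈-concatMap⁺ (λ w → map (_∷ w) (upTo n)) (Any.map (λ { refl → ∈-map⁺ (_∷ w) (∈-upTo⁺ p) }) (∈-words⁺ n k {w} refl ps))

∈-words⇒IsWord : ∀ {n w} → w ∈ words n n → IsWord n w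
∈-words⇒IsWord w∈ = let l , b = ∈-words⁻ _ _ w∈ in record { len = l ; bound = b }

eqListB-sound : ∀ xs ys → eqListB xs ys ≡ true → xs ≡ ys
eqListB-sound []       []       e = refl
eqListB-sound (x ∷ xs) (y ∷ ys) e = let p , q = ∧-true⁻¹ {x ≡ᵇ y} e in
  cong₂ _∷_ (≡ᵇ-true⁻¹ p) (eqListB-sound xs ys q)

eqListB-refl : ∀ xs → eqListB xs xs ≡ true
eqListB-refl []       = refl
eqListB-refl (x ∷ xs) = ∧-true (≡ᵇ-true {x} refl) (eqListB-refl xs)

-- The analogue of `∑-δ-<` for words: each word occurs exactly once in the list, expressed in the
-- form that `∑-involution` takes.
∑-words : ∀ n k {v} → length v ≡ k → All (_< n) v → ∀ (f : List ℕ → ℤ) →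
  (∑[ w ∈ words n k ] (𝟙 (eqListB v w) * f w)) ≡ f v
∑-words n zero    {[]}    l    b        f = trans (ℤₚ.+-identityʳ _) (ℤₚ.*-identityˡ (f []))
∑-words n (suc k) {y ∷ v} refl (p ∷ ps) f = begin
  (∑[ w ∈ words n (suc k) ] (𝟙 (eqListB (y ∷ v) w) * f w))
    ≡⟨ ∑-concatMap _ (words n k) _ ⟩
  (∑[ w ∈ words n k ] ∑[ u ∈ map (_∷ w) (upTo n) ] (𝟙 (eqListB (y ∷ v) u) * f u))
    ≡⟨ ∑-cong (words n k) (λ {w} _ → trans (∑-map (_∷ w) (upTo n) _) (inner w)) ⟩
  (∑[ w ∈ words n k ] (𝟙 (eqListB v w) * f (y ∷ w)))
    ≡⟨ ∑-words n k refl ps (λ w → f (y ∷ w)) ⟩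
  f (y ∷ v) ∎
  where
  open ≡-Reasoning
  rearrange : ∀ a b c → a * b * c ≡ a * (b * c)
  rearrange = solve-∀
  inner : ∀ w → (∑[ x ∈ upTo n ] (𝟙 ((y ≡ᵇ x) ∧ eqListB v w) * f (x ∷ w))) ≡ 𝟙 (eqListB v w) * f (y ∷ w)
  inner w = trans
    (∑-cong (upTo n) (λ {x} _ → trans (cong (_* f (x ∷ w)) (𝟙-∧ (y ≡ᵇ x) (eqListB v w))) (rearrange (𝟙 (y ≡ᵇ x)) _ _)))
    (∑-δ-< (λ x → 𝟙 (eqListB v w) * f (x ∷ w)) p)

Injective : ℕ → List ℕ → Set
Injective n π = ∀ {i j} → i < n → j < n → app π i ≡ app π j → i ≡ j

app-∉ : ∀ {x} π {j} → All (x ≢_) π → j < length π → x ≢ app π j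
app-∉ (y ∷ π) {zero}  (p ∷ ps) _       = p
app-∉ (y ∷ π) {suc j} (p ∷ ps) (s≤s q) = app-∉ π ps q

distinctB⇒Injective : ∀ π → distinctB π ≡ true → Injective (length π) π
distinctB⇒Injective (x ∷ π) e {zero}  {zero}  p       q       eq = refl
distinctB⇒Injective (x ∷ π) e {zero}  {suc j} p       (s≤s q) eq =
  ⊥-elim (app-∉ π (notInB-true⁻¹ π (proj₁ (∧-true⁻¹ {notInB x π} e))) q eq)
distinctB⇒Injective (x ∷ π) e {suc i} {zero}  (s≤s p) q       eq =
  ⊥-elim (app-∉ π (notInB-true⁻¹ π (proj₁ (∧-true⁻¹ {notInB x π} e))) p (sym eq))
distinctB⇒Injective (x ∷ π) e {suc i} {suc j} (s≤s p) (s≤s q) eq =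
  cong suc (distinctB⇒Injective π (proj₂ (∧-true⁻¹ {notInB x π} e)) p q eq)

Injective⇒distinctB : ∀ π → Injective (length π) π → distinctB π ≡ true
Injective⇒distinctB []      h = refl
Injective⇒distinctB (x ∷ π) h = ∧-true
  (notInB-true π (absent π (λ {j} j< e → ℕₚ.0≢1+n (h (s≤s z≤n) (s≤s j<) e))))
  (Injective⇒distinctB π (λ p q e → ℕₚ.suc-injective (h (s≤s p) (s≤s q) e)))
  where
  absent : ∀ π → (∀ {j} → j < length π → x ≢ app π j) → All (x ≢_) π
  absent []      h = []
  absent (y ∷ π) h = h {zero} (s≤s z≤n) ∷ absent π (λ p → h (s≤s p))

app-ext : ∀ π ρ → length π ≡ length ρ → (∀ i → i < length π → app π i ≡ app ρ i) → π ≡ ρ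
app-ext []      []      _ h = refl
app-ext (x ∷ π) (y ∷ ρ) l h = cong₂ _∷_ (h zero (s≤s z≤n)) (app-ext π ρ (ℕₚ.suc-injective l) (λ i p → h (suc i) (s≤s p)))

app-map : ∀ (f : ℕ → ℕ) π {i} → i < length π → app (map f π) i ≡ f (app π i)
app-map f (x ∷ π) {zero}  p       = refl
app-map f (x ∷ π) {suc i} (s≤s p) = app-map f π p

app-upTo : ∀ {n i} → i < n → app (upTo n) i ≡ i
app-upTo = go id
  where
  go : ∀ f {n i} → i < n → app (applyUpTo f n) i ≡ f i
  go f {suc n} {zero}  p       = refl
  go f {suc n} {suc i} (s≤s p) = go (f ∘ suc) p

-- The conjugate τ π τ in one-line notation, where the transposition τ is its own inverse.
conj : ℕ → ℕ → List ℕ → List ℕ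
conj u v π = map (λ x → swap u v (app π (swap u v x))) (upTo (length π))

module _ {n u v : ℕ} (u<n : u < n) (v<n : v < n) where
  private
    τ = swap u v
    τ-< : ∀ {x} → x < n → τ x < n
    τ-< = swap-< u<n v<n

  module _ {π} (w : IsWord n π) where
    open IsWord w

    conj-app : ∀ {x} → x < n → app (conj u v π) x ≡ τ (app π (τ x))
    conj-app {x} x<n rewrite len =
      trans (app-map _ (upTo n) (subst (x <_) (sym (Listₚ.length-upTo n)) x<n))
            (cong (λ z → τ (app π (τ z))) (app-upTo x<n))

    length-conj : length (conj u v π) ≡ n
    length-conj = trans (Listₚ.length-map _ (upTo (length π))) (trans (Listₚ.length-upTo (length π)) len)

    conj-IsWord : IsWord n (conj u v π)
    conj-IsWord = record
      { len   = length-conj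
      ; bound = Allₚ.map⁺ (All.tabulate (λ x∈ → τ-< (app-< (τ-< (subst (_ <_) len (∈-upTo⁻ x∈))))))
      }

    iter-< : ∀ k {i} → i < n → iter π k i < n
    iter-< zero    i<n = i<n
    iter-< (suc k) i<n = app-< (iter-< k i<n)

    iter-conj : ∀ k {i} → i < n → iter (conj u v π) k i ≡ τ (iter π k (τ i))
    iter-conj zero    i<n = sym (swap-involutive u v _)
    iter-conj (suc k) {i} i<n = begin
      app (conj u v π) (iter (conj u v π) k i)  ≡⟨ cong (app (conj u v π)) (iter-conj k i<n) ⟩
      app (conj u v π) (τ (iter π k (τ i)))     ≡⟨ conj-app (τ-< (iter-< k (τ-< i<n))) ⟩
      τ (app π (τ (τ (iter π k (τ i)))))        ≡⟨ cong (λ z → τ (app π z)) (swap-involutive u v _) ⟩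
      τ (app π (iter π k (τ i)))                ∎
      where open ≡-Reasoning

    orbitSearch-conj : ∀ f k {i} → i < n → orbitSearch (conj u v π) i k f ≡ orbitSearch π (τ i) k f
    orbitSearch-conj zero    k     i<n = refl
    orbitSearch-conj (suc f) k {i} i<n = cong₂ (λ b z → if b then k else z) same (orbitSearch-conj f (suc k) i<n)
      where
      same : (iter (conj u v π) k i ≡ᵇ i) ≡ (iter π k (τ i) ≡ᵇ τ i)
      same = trans (cong (_≡ᵇ i) (iter-conj k i<n)) (swap-≡ᵇ u v (iter π k (τ i)) i)

    private
      returns : ℕ → List ℕ → ℕ → ℕ
      returns m ρ k = countB (λ i → orbitSearch ρ i 1 m ≡ᵇ suc k) (upTo m)

    -- The transposition carries the points on cycles of a given length of the conjugate to those of
    -- `π`, so the numbers agree already before the division.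
    cyclesOfLen-conj : ∀ k → cyclesOfLen (conj u v π) k ≡ cyclesOfLen π k
    cyclesOfLen-conj k = cong (ℕD._/ suc k) (begin
      returns (length (conj u v π)) (conj u v π) k  ≡⟨ cong (λ m → returns m (conj u v π) k) length-conj ⟩
      returns n (conj u v π) k                      ≡⟨ ℤₚ.+-injective same ⟩
      returns n π k                                 ≡⟨ cong (λ m → returns m π k) (sym len) ⟩
      returns (length π) π k                        ∎)
      where
      open ≡-Reasoning
      same : + returns n (conj u v π) k ≡ + returns n π k
      same = begin
        + returns n (conj u v π) k
          ≡⟨ ∑-countB _ (upTo n) ⟩
        (∑[ i ∈ upTo n ] 𝟙 (orbitSearch (conj u v π) i 1 n ≡ᵇ suc k))
          ≡⟨ ∑-upTo-cong n (λ i i<n → cong (λ z → 𝟙 (z ≡ᵇ suc k)) (orbitSearch-conj n 1 i<n)) ⟩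
        (∑[ i ∈ upTo n ] 𝟙 (orbitSearch π (τ i) 1 n ≡ᵇ suc k))
          ≡⟨ ∑-swap-upTo u<n v<n _ ⟩
        (∑[ i ∈ upTo n ] 𝟙 (orbitSearch π i 1 n ≡ᵇ suc k))
          ≡⟨ sym (∑-countB _ (upTo n)) ⟩
        + returns n π k ∎

    cycleType-conj : cycleType (conj u v π) ≡ cycleType π
    cycleType-conj = trans
      (Listₚ.concatMap-cong (λ k → cong (λ c → replicate c (suc k)) (cyclesOfLen-conj k)) (downFrom (length (conj u v π))))
      (cong (concatMap (λ k → replicate (cyclesOfLen π k) (suc k)) ∘ downFrom) (trans length-conj (sym len)))

    conj-Injective : Injective n π → Injective n (conj u v π)
    conj-Injective h i<n j<n e = swap-injective u v (h (τ-< i<n) (τ-< j<n)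
      (swap-injective u v (trans (sym (conj-app i<n)) (trans e (conj-app j<n)))))

  conj-involutive : ∀ {π} → IsWord n π → conj u v (conj u v π) ≡ π
  conj-involutive {π} w = app-ext _ π (trans (length-conj w′) (sym len)) (λ i i< →
    let i<n = subst (i <_) (length-conj w′) i< in
    trans (conj-app w′ i<n) (trans (cong τ (conj-app w (τ-< i<n)))
      (trans (swap-involutive u v _) (cong (app π) (swap-involutive u v i)))))
    where
    w′ = conj-IsWord w
    open IsWord w

  distinctB-conj : ∀ {π} → IsWord n π → distinctB (conj u v π) ≡ distinctB π
  distinctB-conj {π} w = Bool-ext {distinctB (conj u v π)} {distinctB π}
    (λ e → subst (λ ρ → distinctB ρ ≡ true) (conj-involutive w) (forward (conj-IsWord w) e))
    (forward w)
    where
    forward : ∀ {ρ} → IsWord n ρ → distinctB ρ ≡ true → distinctB (conj u v ρ) ≡ true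
    forward {ρ} w e = Injective⇒distinctB (conj u v ρ) (subst (λ m → Injective m (conj u v ρ)) (sym (length-conj w))
      (conj-Injective w (subst (λ m → Injective m ρ) (IsWord.len w) (distinctB⇒Injective ρ e))))

  ∑-conj-words : ∀ (f : List ℕ → ℤ) → (∑[ π ∈ words n n ] f (conj u v π)) ≡ ∑ (words n n) f
  ∑-conj-words = ∑-involution (words n n) (λ π ρ → 𝟙 (eqListB π ρ)) (conj u v)
    (λ π∈ g → let l , b = ∈-words⁻ n n π∈ in ∑-words n n l b g)
    (λ π∈ → let w = conj-IsWord (∈-words⇒IsWord π∈) in ∈-words⁺ n n (IsWord.len w) (IsWord.bound w))
    (λ {π} {ρ} π∈ ρ∈ → cong 𝟙 (Bool-ext {eqListB (conj u v π) ρ} {eqListB (conj u v ρ) π} (flip π∈) (flip ρ∈)))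
    where
    flip : ∀ {π ρ} → π ∈ words n n → eqListB (conj u v π) ρ ≡ true → eqListB (conj u v ρ) π ≡ true
    flip {π} {ρ} π∈ e rewrite sym (eqListB-sound (conj u v π) ρ e) | conj-involutive (∈-words⇒IsWord π∈) = eqListB-refl π

-- conjClass λ′ is ofType n (parts λ′).
ofType : ℕ → List ℕ → List (List ℕ)
ofType n ps = filterB (λ π → eqListB (cycleType π) ps) (Sym n)

∑-ofType : ∀ n ps (f : List ℕ → ℤ) →
  ∑ (ofType n ps) f ≡ (∑[ π ∈ words n n ] (𝟙 (distinctB π) * (𝟙 (eqListB (cycleType π) ps) * f π)))
∑-ofType n ps f = trans (∑-filterB _ (Sym n) f) (∑-filterB _ (words n n) _)

-- The involution is applied to all words, with membership in the class as a factor of the summand;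
-- that factor is invariant because distinctness and cycle type are.
∑-conj : ∀ {n u v} → u < n → v < n → ∀ ps (f : List ℕ → ℤ) →
  (∑[ π ∈ ofType n ps ] f (conj u v π)) ≡ ∑ (ofType n ps) f
∑-conj {n} {u} {v} u<n v<n ps f = begin
  (∑[ π ∈ ofType n ps ] f (conj u v π))
    ≡⟨ ∑-ofType n ps _ ⟩
  (∑[ π ∈ words n n ] (𝟙 (distinctB π) * (𝟙 (eqListB (cycleType π) ps) * f (conj u v π))))
    ≡⟨ ∑-cong (words n n) (λ {π} π∈ → let w = ∈-words⇒IsWord π∈ in
         cong₂ (λ a t → 𝟙 a * (𝟙 (eqListB t ps) * f (conj u v π)))
           (sym (distinctB-conj u<n v<n w)) (sym (cycleType-conj u<n v<n w))) ⟩
  (∑[ π ∈ words n n ] g (conj u v π))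
    ≡⟨ ∑-conj-words u<n v<n g ⟩
  ∑ (words n n) g
    ≡⟨ sym (∑-ofType n ps f) ⟩
  ∑ (ofType n ps) f ∎
  where
  open ≡-Reasoning
  g = λ π → 𝟙 (distinctB π) * (𝟙 (eqListB (cycleType π) ps) * f π)

-- Directed graphs

Graph : Set
Graph = List (ℕ × ℕ)

respects : List ℕ → Graph → Bool
respects π []            = true
respects π ((i , j) ∷ E) = (app π i ≡ᵇ j) ∧ respects π E

relabel : (ℕ → ℕ) → Graph → Graph
relabel f = map (λ { (i , j) → f i , f j })

Below : ℕ → Graph → Set
Below k = All (λ { (i , j) → i < k × j < k })

respects-swap : ∀ {n u v} → u < n → v < n → ∀ {π} → IsWord n π → ∀ E → Below n E →
  respects π (relabel (swap u v) E) ≡ respects (conj u v π) E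
respects-swap u<n v<n w []            []                  = refl
respects-swap {u = u} {v} u<n v<n {π} w ((i , j) ∷ E) ((i<n , j<n) ∷ b) =
  cong₂ _∧_ same (respects-swap u<n v<n w E b)
  where
  same : (app π (swap u v i) ≡ᵇ swap u v j) ≡ (app (conj u v π) i ≡ᵇ j)
  same = sym (trans (cong (_≡ᵇ j) (conj-app u<n v<n w i<n)) (swap-≡ᵇ u v (app π (swap u v i)) j))

weight : ℕ → List ℕ → Graph → ℤ
weight n ps E = ∑[ π ∈ ofType n ps ] 𝟙 (respects π E)

∈-ofType⁻ : ∀ {n ps π} → π ∈ ofType n ps → IsWord n π × Injective n π × cycleType π ≡ ps
∈-ofType⁻ {n} {ps} {π} π∈ with p , q ← ∈-filterB⁻ _ (Sym n) π∈ with a , b ← ∈-filterB⁻ distinctB (words n n) p =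
  w , subst (λ m → Injective m π) (IsWord.len w) (distinctB⇒Injective π b) , eqListB-sound (cycleType π) ps q
  where w = ∈-words⇒IsWord a

weight-swap : ∀ {n u v} → u < n → v < n → ∀ ps E → Below n E →
  weight n ps (relabel (swap u v) E) ≡ weight n ps E
weight-swap {n} u<n v<n ps E b = trans
  (∑-cong (ofType n ps) (λ π∈ → cong 𝟙 (respects-swap u<n v<n (proj₁ (∈-ofType⁻ {n} {ps} π∈)) E b)))
  (∑-conj u<n v<n ps (λ π → 𝟙 (respects π E)))

app-All : ∀ {P : ℕ → Set} s {i} → All P s → i < length s → P (app s i)
app-All (x ∷ s) {zero}  (p ∷ ps) _       = p
app-All (x ∷ s) {suc i} (p ∷ ps) (s≤s q) = app-All s ps q

relabel-Below : ∀ {n} s E → Below (length s) E → All (_< n) s → Below n (relabel (app s) E)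
relabel-Below s []            []              b = []
relabel-Below s ((i , j) ∷ E) ((p , q) ∷ ps) b = (app-All s b p , app-All s b q) ∷ relabel-Below s E ps b

relabel-map : ∀ f s E → Below (length s) E → relabel (app (map f s)) E ≡ relabel f (relabel (app s) E)
relabel-map f s []            []             = refl
relabel-map f s ((i , j) ∷ E) ((p , q) ∷ ps) = cong₂ _∷_ (cong₂ _,_ (app-map f s p) (app-map f s q)) (relabel-map f s E ps)

weight-constant : ∀ {n k} ps E → Below k E → ∀ {s t} → length s ≡ k → length t ≡ k → Labelling n s → Labelling n t →
  weight n ps (relabel (app s) E) ≡ weight n ps (relabel (app t) E)
weight-constant {n} ps E below = swap-invariant⇒constant (λ s → weight n ps (relabel (app s) E))
  (λ { {u} {v} u<n v<n {s} refl (b , _) → trans (cong (weight n ps) (relabel-map (swap u v) s E below))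
       (weight-swap u<n v<n ps (relabel (app s) E) (relabel-Below s E below b)) })

∑-weight : ∀ n k ps E → Below k E → ∀ {s} → length s ≡ k → Labelling n s →
  (∑[ π ∈ ofType n ps ] ∑[ t ∈ inj n k [] ] 𝟙 (respects π (relabel (app t) E))) ≡
  + ff n k * weight n ps (relabel (app s) E)
∑-weight n k ps E below {s} l lab = begin
  (∑[ π ∈ ofType n ps ] ∑[ t ∈ inj n k [] ] 𝟙 (respects π (relabel (app t) E)))
    ≡⟨ ∑-swap (ofType n ps) (inj n k []) _ ⟩
  (∑[ t ∈ inj n k [] ] weight n ps (relabel (app t) E))
    ≡⟨ ∑-cong (inj n k []) (λ {t} t∈ → let lt , labt , _ = ∈-inj⁻ n k [] t∈ in
         trans (weight-constant ps E below lt l labt lab) (sym (ℤₚ.*-identityˡ _))) ⟩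
  (∑[ t ∈ inj n k [] ] (1ℤ * weight n ps (relabel (app s) E)))
    ≡⟨ ∑-*ʳ (inj n k []) (λ _ → 1ℤ) _ ⟩
  (∑[ t ∈ inj n k [] ] 1ℤ) * weight n ps (relabel (app s) E)
    ≡⟨ cong (_* weight n ps (relabel (app s) E)) (count-inj n k) ⟩
  + ff n k * weight n ps (relabel (app s) E) ∎
  where open ≡-Reasoning

-- Occurrences as pairs of decreasing sequences

∑-upTo-restrict : ∀ n c (f : ℕ → ℤ) → c ≤ n → ∑ (upTo c) f ≡ (∑[ x ∈ upTo n ] (𝟙 (x <ᵇ c) * f x))
∑-upTo-restrict n c f c≤n with r , refl ← ℕₚ.m≤n⇒∃[o]m+o≡n c≤n = go r
  where
  open ≡-Reasoning
  g = λ x → 𝟙 (x <ᵇ c) * f x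
  go : ∀ r → ∑ (upTo c) f ≡ ∑ (upTo (c ℕ.+ r)) g
  go zero rewrite ℕₚ.+-identityʳ c = ∑-upTo-cong c (λ x x<c →
    trans (sym (ℤₚ.*-identityˡ (f x))) (cong (λ b → 𝟙 b * f x) (sym (<ᵇ-true x<c))))
  go (suc r) rewrite ℕₚ.+-suc c r = begin
    ∑ (upTo c) f                                ≡⟨ go r ⟩
    ∑ (upTo (c ℕ.+ r)) g                        ≡⟨ sym (ℤₚ.+-identityʳ _) ⟩
    ∑ (upTo (c ℕ.+ r)) g + 0ℤ                   ≡⟨ cong (_+_ (∑ (upTo (c ℕ.+ r)) g)) (sym vanish) ⟩
    ∑ (upTo (c ℕ.+ r)) g + g (c ℕ.+ r)          ≡⟨ sym (∑-upTo-suc (c ℕ.+ r) g) ⟩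
    ∑ (upTo (suc (c ℕ.+ r))) g                  ∎
    where
    vanish : g (c ℕ.+ r) ≡ 0ℤ
    vanish rewrite <ᵇ-false (ℕₚ.≤⇒≯ (ℕₚ.m≤m+n c r)) = ℤₚ.*-zeroˡ (f (c ℕ.+ r))

∑-dec₃ : ∀ n (F : List ℕ → ℤ) → ∑ (dec 3 n) F ≡
  (∑[ a ∈ upTo n ] ∑[ b ∈ upTo n ] ∑[ c ∈ upTo n ] (𝟙 (a <ᵇ b) * (𝟙 (b <ᵇ c) * F (c ∷ b ∷ a ∷ []))))
∑-dec₃ n F = begin
  ∑ (dec 3 n) F
    ≡⟨ ∑-dec 2 n F ⟩
  (∑[ c ∈ upTo n ] ∑[ s ∈ dec 2 c ] F (c ∷ s))
    ≡⟨ ∑-upTo-cong n (λ c c<n → begin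
         (∑[ s ∈ dec 2 c ] F (c ∷ s))
           ≡⟨ ∑-dec 1 c _ ⟩
         (∑[ b ∈ upTo c ] ∑[ s ∈ dec 1 b ] F (c ∷ b ∷ s))
           ≡⟨ ∑-upTo-restrict n c _ (ℕₚ.<⇒≤ c<n) ⟩
         (∑[ b ∈ upTo n ] (𝟙 (b <ᵇ c) * (∑[ s ∈ dec 1 b ] F (c ∷ b ∷ s))))
           ≡⟨ ∑-upTo-cong n (λ b b<n → cong (𝟙 (b <ᵇ c) *_) (begin
                (∑[ s ∈ dec 1 b ] F (c ∷ b ∷ s))
                  ≡⟨ ∑-dec 0 b _ ⟩
                (∑[ a ∈ upTo b ] (F (c ∷ b ∷ a ∷ []) + 0ℤ))
                  ≡⟨ ∑-cong (upTo b) (λ _ → ℤₚ.+-identityʳ _) ⟩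
                (∑[ a ∈ upTo b ] F (c ∷ b ∷ a ∷ []))
                  ≡⟨ ∑-upTo-restrict n b _ (ℕₚ.<⇒≤ b<n) ⟩
                (∑[ a ∈ upTo n ] (𝟙 (a <ᵇ b) * F (c ∷ b ∷ a ∷ []))) ∎)) ⟩
         (∑[ b ∈ upTo n ] (𝟙 (b <ᵇ c) * (∑[ a ∈ upTo n ] (𝟙 (a <ᵇ b) * F (c ∷ b ∷ a ∷ [])))))
           ≡⟨ ∑-cong (upTo n) (λ {b} _ → trans (sym (∑-*ˡ (upTo n) (𝟙 (b <ᵇ c)) _))
                (∑-cong (upTo n) (λ {a} _ → comm (𝟙 (b <ᵇ c)) (𝟙 (a <ᵇ b)) (F (c ∷ b ∷ a ∷ []))))) ⟩
         (∑[ b ∈ upTo n ] ∑[ a ∈ upTo n ] G a b c)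
           ≡⟨ ∑-swap (upTo n) (upTo n) _ ⟩
         (∑[ a ∈ upTo n ] ∑[ b ∈ upTo n ] G a b c) ∎) ⟩
  (∑[ c ∈ upTo n ] ∑[ a ∈ upTo n ] ∑[ b ∈ upTo n ] G a b c)
    ≡⟨ ∑-swap (upTo n) (upTo n) _ ⟩
  (∑[ a ∈ upTo n ] ∑[ c ∈ upTo n ] ∑[ b ∈ upTo n ] G a b c)
    ≡⟨ ∑-cong (upTo n) (λ _ → ∑-swap (upTo n) (upTo n) _) ⟩
  (∑[ a ∈ upTo n ] ∑[ b ∈ upTo n ] ∑[ c ∈ upTo n ] G a b c) ∎
  where
  open ≡-Reasoning
  G : ℕ → ℕ → ℕ → ℤ
  G a b c = 𝟙 (a <ᵇ b) * (𝟙 (b <ᵇ c) * F (c ∷ b ∷ a ∷ []))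
  comm : ∀ x y z → x * (y * z) ≡ y * (x * z)
  comm = solve-∀

-- In the order of the gaps of c > b > a: `]` closes the gap above c, the two adjacencies close the
-- inner gaps, and `[` closes the gap below a.
flags : VPat → List Bool
flags (vp l _ g₁ _ g₂ _ r) = isSq r ∷ isAdj g₂ ∷ isAdj g₁ ∷ isSq l ∷ []
  where
  isSq : End → Bool
  isSq sq = true
  isSq rd = false
  isAdj : Gap → Bool
  isAdj adj  = true
  isAdj dash = false

tight-flags : ∀ l f₁ g₁ f₂ g₂ f₃ r n a b c →
  𝟙 (tight (flags (vp l f₁ g₁ f₂ g₂ f₃ r)) n (c ∷ b ∷ a ∷ [])) ≡
  𝟙 (gapOK g₁ a b) * (𝟙 (gapOK g₂ b c) * (𝟙 (leftOK l a) * 𝟙 (rightOK r n c)))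
tight-flags l f₁ g₁ f₂ g₂ f₃ r n a b c = begin
  𝟙 (tight (flags (vp l f₁ g₁ f₂ g₂ f₃ r)) n (c ∷ b ∷ a ∷ []))
    ≡⟨ cong 𝟙 (flip l g₁ g₂ r) ⟩
  𝟙 (R ∧ G₂ ∧ G₁ ∧ L)
    ≡⟨ trans (𝟙-∧ R _) (cong (𝟙 R *_) (trans (𝟙-∧ G₂ _) (cong (𝟙 G₂ *_) (𝟙-∧ G₁ L)))) ⟩
  𝟙 R * (𝟙 G₂ * (𝟙 G₁ * 𝟙 L))
    ≡⟨ comm (𝟙 R) (𝟙 G₂) (𝟙 G₁) (𝟙 L) ⟩
  𝟙 G₁ * (𝟙 G₂ * (𝟙 L * 𝟙 R)) ∎
  where
  open ≡-Reasoning
  G₁ = gapOK g₁ a b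
  G₂ = gapOK g₂ b c
  L  = leftOK l a
  R  = rightOK r n c
  comm : ∀ w x y z → w * (x * (y * z)) ≡ y * (x * (z * w))
  comm = solve-∀
  flip : ∀ l g₁ g₂ r → tight (flags (vp l f₁ g₁ f₂ g₂ f₃ r)) n (c ∷ b ∷ a ∷ []) ≡
    rightOK r n c ∧ gapOK g₂ b c ∧ gapOK g₁ a b ∧ leftOK l a
  -- Only the right end is tested with its two sides exchanged; the other conditions agree by
  -- computation.
  flip l g₁ g₂ sq = cong₂ _∧_ (≡ᵇ-sym n (suc c)) (flip₂ l g₁ g₂)
    where
    flip₂ : ∀ l g₁ g₂ → tight (drop 1 (flags (vp l f₁ g₁ f₂ g₂ f₃ rd))) c (b ∷ a ∷ []) ≡ gapOK g₂ b c ∧ gapOK g₁ a b ∧ leftOK l a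
    flip₂ sq adj  adj  = refl
    flip₂ sq adj  dash = refl
    flip₂ sq dash adj  = refl
    flip₂ sq dash dash = refl
    flip₂ rd adj  adj  = refl
    flip₂ rd adj  dash = refl
    flip₂ rd dash adj  = refl
    flip₂ rd dash dash = refl
  flip sq adj  adj  rd = refl
  flip sq adj  dash rd = refl
  flip sq dash adj  rd = refl
  flip sq dash dash rd = refl
  flip rd adj  adj  rd = refl
  flip rd adj  dash rd = refl
  flip rd dash adj  rd = refl
  flip rd dash dash rd = refl

-- The letters of a `VPat` may be any numbers; this singles out the six permutations.
data Order : ℕ → ℕ → ℕ → Set where
  o123 : Order 1 2 3
  o132 : Order 1 3 2
  o213 : Order 2 1 3
  o231 : Order 2 3 1
  o312 : Order 3 1 2
  o321 : Order 3 2 1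

private
  sameOrder⁻¹ : ∀ x y z f₁ f₂ f₃ → sameOrder x y z f₁ f₂ f₃ ≡ true →
    (((x <ᵇ y) ⇔ᵇ (f₁ <ᵇ f₂)) ≡ true × ((y <ᵇ x) ⇔ᵇ (f₂ <ᵇ f₁)) ≡ true) ×
    (((x <ᵇ z) ⇔ᵇ (f₁ <ᵇ f₃)) ≡ true × ((z <ᵇ x) ⇔ᵇ (f₃ <ᵇ f₁)) ≡ true) ×
    (((y <ᵇ z) ⇔ᵇ (f₂ <ᵇ f₃)) ≡ true × ((z <ᵇ y) ⇔ᵇ (f₃ <ᵇ f₂)) ≡ true)
  sameOrder⁻¹ x y z f₁ f₂ f₃ e =
    let p , e₁ = ∧-true⁻¹ {(x <ᵇ y) ⇔ᵇ (f₁ <ᵇ f₂)} e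
        q , e₂ = ∧-true⁻¹ {(y <ᵇ x) ⇔ᵇ (f₂ <ᵇ f₁)} e₁
        r , e₃ = ∧-true⁻¹ {(x <ᵇ z) ⇔ᵇ (f₁ <ᵇ f₃)} e₂
        s , e₄ = ∧-true⁻¹ {(z <ᵇ x) ⇔ᵇ (f₃ <ᵇ f₁)} e₃
        t , u  = ∧-true⁻¹ {(y <ᵇ z) ⇔ᵇ (f₂ <ᵇ f₃)} e₄
    in (p , q) , (r , s) , (t , u)

  ⇔ᵇ-true⁻¹ : ∀ a → a ⇔ᵇ true ≡ true → a ≡ true
  ⇔ᵇ-true⁻¹ true _ = refl

  sorted : ∀ {x y z} → (x <ᵇ y) ∧ (y <ᵇ z) ≡ true →
    ((x <ᵇ y) ≡ true × (y <ᵇ x) ≡ false) × ((x <ᵇ z) ≡ true × (z <ᵇ x) ≡ false) × ((y <ᵇ z) ≡ true × (z <ᵇ y) ≡ false)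
  sorted {x} {y} {z} e with p , q ← ∧-true⁻¹ {x <ᵇ y} e =
    let x<y = <ᵇ-true⁻¹ {x} {y} p ; y<z = <ᵇ-true⁻¹ {y} {z} q ; x<z = ℕₚ.<-trans x<y y<z in
    (p , <ᵇ-false (ℕₚ.<-asym x<y)) , (<ᵇ-true x<z , <ᵇ-false (ℕₚ.<-asym x<z)) , (q , <ᵇ-false (ℕₚ.<-asym y<z))

  module _ (x y z : ℕ) where
    same123 : sameOrder x y z 1 2 3 ≡ (x <ᵇ y) ∧ (y <ᵇ z)
    same123 = Bool-ext {sameOrder x y z 1 2 3} {(x <ᵇ y) ∧ (y <ᵇ z)}
      (λ e → let (p , _) , _ , (r , _) = sameOrder⁻¹ x y z 1 2 3 e in ∧-true (⇔ᵇ-true⁻¹ (x <ᵇ y) p) (⇔ᵇ-true⁻¹ (y <ᵇ z) r))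
      (λ e → let (a , b) , (c , d) , (f , g) = sorted {x} {y} {z} e in go a b c d f g)
      where
      go : (x <ᵇ y) ≡ true → (y <ᵇ x) ≡ false → (x <ᵇ z) ≡ true → (z <ᵇ x) ≡ false → (y <ᵇ z) ≡ true → (z <ᵇ y) ≡ false →
        sameOrder x y z 1 2 3 ≡ true
      go a b c d f g rewrite a | b | c | d | f | g = refl

    same132 : sameOrder x y z 1 3 2 ≡ (x <ᵇ z) ∧ (z <ᵇ y)
    same132 = Bool-ext {sameOrder x y z 1 3 2} {(x <ᵇ z) ∧ (z <ᵇ y)}
      (λ e → let _ , (q , _) , (_ , r) = sameOrder⁻¹ x y z 1 3 2 e in ∧-true (⇔ᵇ-true⁻¹ (x <ᵇ z) q) (⇔ᵇ-true⁻¹ (z <ᵇ y) r))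
      (λ e → let (a , b) , (c , d) , (f , g) = sorted {x} {z} {y} e in go a b c d f g)
      where
      go : (x <ᵇ z) ≡ true → (z <ᵇ x) ≡ false → (x <ᵇ y) ≡ true → (y <ᵇ x) ≡ false → (z <ᵇ y) ≡ true → (y <ᵇ z) ≡ false →
        sameOrder x y z 1 3 2 ≡ true
      go a b c d f g rewrite a | b | c | d | f | g = refl

    same213 : sameOrder x y z 2 1 3 ≡ (y <ᵇ x) ∧ (x <ᵇ z)
    same213 = Bool-ext {sameOrder x y z 2 1 3} {(y <ᵇ x) ∧ (x <ᵇ z)}
      (λ e → let (_ , p) , (q , _) , _ = sameOrder⁻¹ x y z 2 1 3 e in ∧-true (⇔ᵇ-true⁻¹ (y <ᵇ x) p) (⇔ᵇ-true⁻¹ (x <ᵇ z) q))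
      (λ e → let (a , b) , (c , d) , (f , g) = sorted {y} {x} {z} e in go a b c d f g)
      where
      go : (y <ᵇ x) ≡ true → (x <ᵇ y) ≡ false → (y <ᵇ z) ≡ true → (z <ᵇ y) ≡ false → (x <ᵇ z) ≡ true → (z <ᵇ x) ≡ false →
        sameOrder x y z 2 1 3 ≡ true
      go a b c d f g rewrite a | b | c | d | f | g = refl

    same231 : sameOrder x y z 2 3 1 ≡ (z <ᵇ x) ∧ (x <ᵇ y)
    same231 = Bool-ext {sameOrder x y z 2 3 1} {(z <ᵇ x) ∧ (x <ᵇ y)}
      (λ e → let (p , _) , (_ , q) , _ = sameOrder⁻¹ x y z 2 3 1 e in ∧-true (⇔ᵇ-true⁻¹ (z <ᵇ x) q) (⇔ᵇ-true⁻¹ (x <ᵇ y) p))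
      (λ e → let (a , b) , (c , d) , (f , g) = sorted {z} {x} {y} e in go a b c d f g)
      where
      go : (z <ᵇ x) ≡ true → (x <ᵇ z) ≡ false → (z <ᵇ y) ≡ true → (y <ᵇ z) ≡ false → (x <ᵇ y) ≡ true → (y <ᵇ x) ≡ false →
        sameOrder x y z 2 3 1 ≡ true
      go a b c d f g rewrite a | b | c | d | f | g = refl

    same312 : sameOrder x y z 3 1 2 ≡ (y <ᵇ z) ∧ (z <ᵇ x)
    same312 = Bool-ext {sameOrder x y z 3 1 2} {(y <ᵇ z) ∧ (z <ᵇ x)}
      (λ e → let _ , (_ , q) , (r , _) = sameOrder⁻¹ x y z 3 1 2 e in ∧-true (⇔ᵇ-true⁻¹ (y <ᵇ z) r) (⇔ᵇ-true⁻¹ (z <ᵇ x) q))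
      (λ e → let (a , b) , (c , d) , (f , g) = sorted {y} {z} {x} e in go a b c d f g)
      where
      go : (y <ᵇ z) ≡ true → (z <ᵇ y) ≡ false → (y <ᵇ x) ≡ true → (x <ᵇ y) ≡ false → (z <ᵇ x) ≡ true → (x <ᵇ z) ≡ false →
        sameOrder x y z 3 1 2 ≡ true
      go a b c d f g rewrite a | b | c | d | f | g = refl

    same321 : sameOrder x y z 3 2 1 ≡ (z <ᵇ y) ∧ (y <ᵇ x)
    same321 = Bool-ext {sameOrder x y z 3 2 1} {(z <ᵇ y) ∧ (y <ᵇ x)}
      (λ e → let (_ , p) , _ , (_ , r) = sameOrder⁻¹ x y z 3 2 1 e in ∧-true (⇔ᵇ-true⁻¹ (z <ᵇ y) r) (⇔ᵇ-true⁻¹ (y <ᵇ x) p))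
      (λ e → let (a , b) , (c , d) , (f , g) = sorted {z} {y} {x} e in go a b c d f g)
      where
      go : (z <ᵇ y) ≡ true → (y <ᵇ z) ≡ false → (z <ᵇ x) ≡ true → (x <ᵇ z) ≡ false → (y <ᵇ x) ≡ true → (x <ᵇ y) ≡ false →
        sameOrder x y z 3 2 1 ≡ true
      go a b c d f g rewrite a | b | c | d | f | g = refl

  -- The deltas admit only the list `z ∷ y ∷ x ∷ []`, which is decreasing exactly when x < y < z.
  select₃ : ∀ {n x y z} → x < n → y < n → z < n →
    (∑[ t ∈ dec 3 n ] (𝟙 (x ≡ᵇ app t 2) * (𝟙 (y ≡ᵇ app t 1) * 𝟙 (z ≡ᵇ app t 0)))) ≡ 𝟙 ((x <ᵇ y) ∧ (y <ᵇ z))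
  select₃ {n} {x} {y} {z} x<n y<n z<n = begin
    (∑[ t ∈ dec 3 n ] (𝟙 (x ≡ᵇ app t 2) * (𝟙 (y ≡ᵇ app t 1) * 𝟙 (z ≡ᵇ app t 0))))
      ≡⟨ ∑-dec₃ n _ ⟩
    (∑[ a ∈ upTo n ] ∑[ b ∈ upTo n ] ∑[ c ∈ upTo n ] (𝟙 (a <ᵇ b) * (𝟙 (b <ᵇ c) * (𝟙 (x ≡ᵇ a) * (𝟙 (y ≡ᵇ b) * 𝟙 (z ≡ᵇ c))))))
      ≡⟨ ∑-cong (upTo n) (λ {a} _ → begin
           (∑[ b ∈ upTo n ] ∑[ c ∈ upTo n ] (𝟙 (a <ᵇ b) * (𝟙 (b <ᵇ c) * (𝟙 (x ≡ᵇ a) * (𝟙 (y ≡ᵇ b) * 𝟙 (z ≡ᵇ c))))))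
             ≡⟨ ∑-cong (upTo n) (λ {b} _ → begin
                  (∑[ c ∈ upTo n ] (𝟙 (a <ᵇ b) * (𝟙 (b <ᵇ c) * (𝟙 (x ≡ᵇ a) * (𝟙 (y ≡ᵇ b) * 𝟙 (z ≡ᵇ c))))))
                    ≡⟨ ∑-cong (upTo n) (λ {c} _ → comm (𝟙 (a <ᵇ b)) (𝟙 (b <ᵇ c)) (𝟙 (x ≡ᵇ a)) (𝟙 (y ≡ᵇ b)) (𝟙 (z ≡ᵇ c))) ⟩
                  (∑[ c ∈ upTo n ] (𝟙 (z ≡ᵇ c) * (𝟙 (y ≡ᵇ b) * (𝟙 (x ≡ᵇ a) * (𝟙 (a <ᵇ b) * 𝟙 (b <ᵇ c))))))
                    ≡⟨ ∑-δ-< (λ c → 𝟙 (y ≡ᵇ b) * (𝟙 (x ≡ᵇ a) * (𝟙 (a <ᵇ b) * 𝟙 (b <ᵇ c)))) z<n ⟩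
                  𝟙 (y ≡ᵇ b) * (𝟙 (x ≡ᵇ a) * (𝟙 (a <ᵇ b) * 𝟙 (b <ᵇ z))) ∎) ⟩
           (∑[ b ∈ upTo n ] (𝟙 (y ≡ᵇ b) * (𝟙 (x ≡ᵇ a) * (𝟙 (a <ᵇ b) * 𝟙 (b <ᵇ z)))))
             ≡⟨ ∑-δ-< (λ b → 𝟙 (x ≡ᵇ a) * (𝟙 (a <ᵇ b) * 𝟙 (b <ᵇ z))) y<n ⟩
           𝟙 (x ≡ᵇ a) * (𝟙 (a <ᵇ y) * 𝟙 (y <ᵇ z)) ∎) ⟩
    (∑[ a ∈ upTo n ] (𝟙 (x ≡ᵇ a) * (𝟙 (a <ᵇ y) * 𝟙 (y <ᵇ z))))
      ≡⟨ ∑-δ-< (λ a → 𝟙 (a <ᵇ y) * 𝟙 (y <ᵇ z)) x<n ⟩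
    𝟙 (x <ᵇ y) * 𝟙 (y <ᵇ z)
      ≡⟨ sym (𝟙-∧ (x <ᵇ y) (y <ᵇ z)) ⟩
    𝟙 ((x <ᵇ y) ∧ (y <ᵇ z)) ∎
    where
    open ≡-Reasoning
    comm : ∀ p q x y z → p * (q * (x * (y * z))) ≡ z * (y * (x * (p * q)))
    comm = solve-∀

-- In a decreasing list of three values the letter f stands at index 3 - f. Summing over such lists
-- puts the values on the same footing as the positions, ready for `∑-merge`.
sameOrder-select : ∀ {n x y z f₁ f₂ f₃} → Order f₁ f₂ f₃ → x < n → y < n → z < n →
  𝟙 (sameOrder x y z f₁ f₂ f₃) ≡
  (∑[ t ∈ dec 3 n ] (𝟙 (x ≡ᵇ app t (3 ∸ f₁)) * (𝟙 (y ≡ᵇ app t (3 ∸ f₂)) * 𝟙 (z ≡ᵇ app t (3 ∸ f₃)))))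
sameOrder-select {n} {x} {y} {z} o x<n y<n z<n = go o
  where
  go : ∀ {f₁ f₂ f₃} → Order f₁ f₂ f₃ → 𝟙 (sameOrder x y z f₁ f₂ f₃) ≡
    (∑[ t ∈ dec 3 n ] (𝟙 (x ≡ᵇ app t (3 ∸ f₁)) * (𝟙 (y ≡ᵇ app t (3 ∸ f₂)) * 𝟙 (z ≡ᵇ app t (3 ∸ f₃)))))
  go o123 = trans (cong 𝟙 (same123 x y z)) (sym (select₃ x<n y<n z<n))
  go o132 = trans (cong 𝟙 (same132 x y z)) (trans (sym (select₃ x<n z<n y<n))
    (∑-cong (dec 3 n) (λ {t} _ → comm (𝟙 (x ≡ᵇ app t 2)) (𝟙 (z ≡ᵇ app t 1)) (𝟙 (y ≡ᵇ app t 0)))))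
    where
    comm : ∀ a b c → a * (b * c) ≡ a * (c * b)
    comm = solve-∀
  go o213 = trans (cong 𝟙 (same213 x y z)) (trans (sym (select₃ y<n x<n z<n))
    (∑-cong (dec 3 n) (λ {t} _ → comm (𝟙 (y ≡ᵇ app t 2)) (𝟙 (x ≡ᵇ app t 1)) (𝟙 (z ≡ᵇ app t 0)))))
    where
    comm : ∀ a b c → a * (b * c) ≡ b * (a * c)
    comm = solve-∀
  go o231 = trans (cong 𝟙 (same231 x y z)) (trans (sym (select₃ z<n x<n y<n))
    (∑-cong (dec 3 n) (λ {t} _ → comm (𝟙 (z ≡ᵇ app t 2)) (𝟙 (x ≡ᵇ app t 1)) (𝟙 (y ≡ᵇ app t 0)))))
    where
    comm : ∀ a b c → a * (b * c) ≡ b * (c * a)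
    comm = solve-∀
  go o312 = trans (cong 𝟙 (same312 x y z)) (trans (sym (select₃ y<n z<n x<n))
    (∑-cong (dec 3 n) (λ {t} _ → comm (𝟙 (y ≡ᵇ app t 2)) (𝟙 (z ≡ᵇ app t 1)) (𝟙 (x ≡ᵇ app t 0)))))
    where
    comm : ∀ a b c → a * (b * c) ≡ c * (a * b)
    comm = solve-∀
  go o321 = trans (cong 𝟙 (same321 x y z)) (trans (sym (select₃ z<n y<n x<n))
    (∑-cong (dec 3 n) (λ {t} _ → comm (𝟙 (z ≡ᵇ app t 2)) (𝟙 (y ≡ᵇ app t 1)) (𝟙 (x ≡ᵇ app t 0)))))
    where
    comm : ∀ a b c → a * (b * c) ≡ c * (b * a)
    comm = solve-∀

-- The graph of a partial permutation with positions s and values t (both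
-- decreasing, hence the reversed indices) in the relative order f₁ f₂ f₃.
edges : ℕ → ℕ → ℕ → List ℕ → List ℕ → Graph
edges f₁ f₂ f₃ s t = (app s 2 , app t (3 ∸ f₁)) ∷ (app s 1 , app t (3 ∸ f₂)) ∷ (app s 0 , app t (3 ∸ f₃)) ∷ []

𝟙-respects₃ : ∀ π a b c x y z →
  𝟙 (respects π ((a , x) ∷ (b , y) ∷ (c , z) ∷ [])) ≡ 𝟙 (app π a ≡ᵇ x) * (𝟙 (app π b ≡ᵇ y) * 𝟙 (app π c ≡ᵇ z))
𝟙-respects₃ π a b c x y z with app π a ≡ᵇ x | app π b ≡ᵇ y | app π c ≡ᵇ z
... | true  | true  | true  = refl
... | true  | true  | false = refl
... | true  | false | true  = refl
... | true  | false | false = refl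
... | false | true  | true  = refl
... | false | true  | false = refl
... | false | false | true  = refl
... | false | false | false = refl

pat-∑ : ∀ {n π} l f₁ g₁ f₂ g₂ f₃ r → Order f₁ f₂ f₃ → IsWord n π → let φ = vp l f₁ g₁ f₂ g₂ f₃ r in
  + pat φ π ≡ (∑[ s ∈ dec 3 n ] ∑[ t ∈ dec 3 n ] (𝟙 (tight (flags φ) n s) * 𝟙 (respects π (edges f₁ f₂ f₃ s t))))
pat-∑ {π = π} l f₁ g₁ f₂ g₂ f₃ r o w@record { len = refl } = begin
  + pat φ π
    ≡⟨ ∑-countB _ (triples n) ⟩
  (∑[ x ∈ triples n ] 𝟙 (occ x))
    ≡⟨ ∑-concatMap _ (upTo n) _ ⟩
  (∑[ a ∈ upTo n ] ∑[ x ∈ concatMap (λ b → map (λ c → a , b , c) (upTo n)) (upTo n) ] 𝟙 (occ x))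
    ≡⟨ ∑-cong (upTo n) (λ {a} _ → trans (∑-concatMap _ (upTo n) _)
         (∑-cong (upTo n) (λ {b} _ → ∑-map (λ c → a , b , c) (upTo n) _))) ⟩
  (∑[ a ∈ upTo n ] ∑[ b ∈ upTo n ] ∑[ c ∈ upTo n ] 𝟙 (isOcc φ π a b c))
    ≡⟨ ∑-cong (upTo n) (λ {a} a∈ → ∑-cong (upTo n) (λ {b} b∈ → ∑-cong (upTo n) (λ {c} c∈ → term a b c (∈-upTo⁻ a∈) (∈-upTo⁻ b∈) (∈-upTo⁻ c∈)))) ⟩
  (∑[ a ∈ upTo n ] ∑[ b ∈ upTo n ] ∑[ c ∈ upTo n ] (𝟙 (a <ᵇ b) * (𝟙 (b <ᵇ c) * F (c ∷ b ∷ a ∷ []))))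
    ≡⟨ sym (∑-dec₃ n F) ⟩
  ∑ (dec 3 n) F ∎
  where
  open ≡-Reasoning
  φ = vp l f₁ g₁ f₂ g₂ f₃ r
  n = length π
  occ : ℕ × ℕ × ℕ → Bool
  occ = λ { (a , b , c) → isOcc φ π a b c }
  F : List ℕ → ℤ
  F s = ∑[ t ∈ dec 3 n ] (𝟙 (tight (flags φ) n s) * 𝟙 (respects π (edges f₁ f₂ f₃ s t)))
  comm : ∀ a b c d e f g → a * (b * (c * (d * (e * (f * g))))) ≡ a * (b * ((c * (d * (e * f))) * g))
  comm = solve-∀
  term : ∀ a b c → a < n → b < n → c < n → 𝟙 (isOcc φ π a b c) ≡ 𝟙 (a <ᵇ b) * (𝟙 (b <ᵇ c) * F (c ∷ b ∷ a ∷ []))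
  term a b c a<n b<n c<n = begin
    𝟙 (isOcc φ π a b c)
      ≡⟨ trans (𝟙-∧ (a <ᵇ b) _) (cong (𝟙 (a <ᵇ b) *_) (trans (𝟙-∧ (b <ᵇ c) _) (cong (𝟙 (b <ᵇ c) *_)
          (trans (𝟙-∧ (gapOK g₁ a b) _) (cong (𝟙 (gapOK g₁ a b) *_) (trans (𝟙-∧ (gapOK g₂ b c) _) (cong (𝟙 (gapOK g₂ b c) *_)
          (trans (𝟙-∧ (leftOK l a) _) (cong (𝟙 (leftOK l a) *_) (𝟙-∧ (rightOK r n c) _))))))))))  ⟩
    𝟙 (a <ᵇ b) * (𝟙 (b <ᵇ c) * (𝟙 (gapOK g₁ a b) * (𝟙 (gapOK g₂ b c) * (𝟙 (leftOK l a) * (𝟙 (rightOK r n c) * same)))))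
      ≡⟨ comm (𝟙 (a <ᵇ b)) (𝟙 (b <ᵇ c)) (𝟙 (gapOK g₁ a b)) (𝟙 (gapOK g₂ b c)) (𝟙 (leftOK l a)) (𝟙 (rightOK r n c)) same ⟩
    𝟙 (a <ᵇ b) * (𝟙 (b <ᵇ c) * ((𝟙 (gapOK g₁ a b) * (𝟙 (gapOK g₂ b c) * (𝟙 (leftOK l a) * 𝟙 (rightOK r n c)))) * same))
      ≡⟨ cong (λ z → 𝟙 (a <ᵇ b) * (𝟙 (b <ᵇ c) * (z * same))) (sym (tight-flags l f₁ g₁ f₂ g₂ f₃ r n a b c)) ⟩
    𝟙 (a <ᵇ b) * (𝟙 (b <ᵇ c) * (𝟙 (tight (flags φ) n (c ∷ b ∷ a ∷ [])) * same))
      ≡⟨ cong (λ z → 𝟙 (a <ᵇ b) * (𝟙 (b <ᵇ c) * z)) (trans (cong (𝟙 (tight (flags φ) n (c ∷ b ∷ a ∷ [])) *_) (begin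
           same
             ≡⟨ sameOrder-select o (app-< a<n) (app-< b<n) (app-< c<n) ⟩
           (∑[ t ∈ dec 3 n ] (𝟙 (app π a ≡ᵇ app t (3 ∸ f₁)) * (𝟙 (app π b ≡ᵇ app t (3 ∸ f₂)) * 𝟙 (app π c ≡ᵇ app t (3 ∸ f₃)))))
             ≡⟨ ∑-cong (dec 3 n) (λ {t} _ → sym (𝟙-respects₃ π a b c (app t (3 ∸ f₁)) (app t (3 ∸ f₂)) (app t (3 ∸ f₃)))) ⟩
           (∑[ t ∈ dec 3 n ] 𝟙 (respects π (edges f₁ f₂ f₃ (c ∷ b ∷ a ∷ []) t))) ∎))
           (sym (∑-*ˡ (dec 3 n) (𝟙 (tight (flags φ) n (c ∷ b ∷ a ∷ [])))
             (λ t → 𝟙 (respects π (edges f₁ f₂ f₃ (c ∷ b ∷ a ∷ []) t)))))) ⟩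
    𝟙 (a <ᵇ b) * (𝟙 (b <ᵇ c) * F (c ∷ b ∷ a ∷ [])) ∎
    where
    open IsWord w
    same = 𝟙 (sameOrder (app π a) (app π b) (app π c) f₁ f₂ f₃)

∑-pat : ∀ n ps l f₁ g₁ f₂ g₂ f₃ r → Order f₁ f₂ f₃ → let φ = vp l f₁ g₁ f₂ g₂ f₃ r in
  (∑[ π ∈ ofType n ps ] (+ pat φ π)) ≡
  (∑[ ℓ ∈ paths 3 3 ] ∑[ s ∈ dec (length ℓ) n ]
    (𝟙 (tight (flags φ) n (left ℓ s)) * weight n ps (edges f₁ f₂ f₃ (left ℓ s) (right ℓ s))))
∑-pat n ps l f₁ g₁ f₂ g₂ f₃ r o = begin
  (∑[ π ∈ C ] (+ pat φ π))
    ≡⟨ ∑-cong C (λ π∈ → pat-∑ l f₁ g₁ f₂ g₂ f₃ r o (proj₁ (∈-ofType⁻ {n} {ps} π∈))) ⟩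
  (∑[ π ∈ C ] ∑[ s ∈ dec 3 n ] ∑[ t ∈ dec 3 n ] (𝟙 (tight (flags φ) n s) * 𝟙 (respects π (edges f₁ f₂ f₃ s t))))
    ≡⟨ ∑-swap C (dec 3 n) _ ⟩
  (∑[ s ∈ dec 3 n ] ∑[ π ∈ C ] ∑[ t ∈ dec 3 n ] (𝟙 (tight (flags φ) n s) * 𝟙 (respects π (edges f₁ f₂ f₃ s t))))
    ≡⟨ ∑-cong (dec 3 n) (λ {s} _ → trans (∑-swap C (dec 3 n) _)
         (∑-cong (dec 3 n) (λ {t} _ → ∑-*ˡ C (𝟙 (tight (flags φ) n s)) _))) ⟩
  (∑[ s ∈ dec 3 n ] ∑[ t ∈ dec 3 n ] (𝟙 (tight (flags φ) n s) * weight n ps (edges f₁ f₂ f₃ s t)))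
    ≡⟨ ∑-merge 3 3 n _ ⟩
  (∑[ ℓ ∈ paths 3 3 ] ∑[ s ∈ dec (length ℓ) n ]
    (𝟙 (tight (flags φ) n (left ℓ s)) * weight n ps (edges f₁ f₂ f₃ (left ℓ s) (right ℓ s)))) ∎
  where
  open ≡-Reasoning
  C = ofType n ps
  φ = vp l f₁ g₁ f₂ g₂ f₃ r

-- The shapes of graphs with three edges

-- e: a single edge, c₁ c₂ c₃: cycles, p₂ p₃: paths with two and three edges.
data Shape : Set where
  c₁c₁c₁ c₁c₂ c₃ c₁c₁e c₁p₂ c₂e p₃ c₁ee p₂e eee : Shape

size : Shape → ℕ
size c₁c₁c₁ = 3
size c₁c₂   = 3
size c₃     = 3
size c₁c₁e  = 4
size c₁p₂   = 4
size c₂e    = 4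
size p₃     = 4
size c₁ee   = 5
size p₂e    = 5
size eee    = 6

graph : Shape → Graph
graph c₁c₁c₁ = (0 , 0) ∷ (1 , 1) ∷ (2 , 2) ∷ []
graph c₁c₂   = (0 , 0) ∷ (1 , 2) ∷ (2 , 1) ∷ []
graph c₃     = (0 , 1) ∷ (1 , 2) ∷ (2 , 0) ∷ []
graph c₁c₁e  = (0 , 0) ∷ (1 , 1) ∷ (2 , 3) ∷ []
graph c₁p₂   = (0 , 0) ∷ (1 , 2) ∷ (2 , 3) ∷ []
graph c₂e    = (0 , 1) ∷ (1 , 0) ∷ (2 , 3) ∷ []
graph p₃     = (0 , 1) ∷ (1 , 2) ∷ (2 , 3) ∷ []
graph c₁ee   = (0 , 0) ∷ (1 , 2) ∷ (3 , 4) ∷ []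
graph p₂e    = (0 , 1) ∷ (1 , 2) ∷ (3 , 4) ∷ []
graph eee    = (0 , 1) ∷ (2 , 3) ∷ (4 , 5) ∷ []

-- These are labelled copies, so automorphisms count: three fixed points give six copies of
-- `c₁c₁c₁`.
copies : ℕ → List ℕ → Shape → ℤ
copies n π t = ∑[ s ∈ inj n (size t) [] ] 𝟙 (respects π (relabel (app s) (graph t)))

δ : ℕ → ℕ → ℤ
δ u v = 𝟙 (u ≡ᵇ v)

δ-refl : ∀ u → δ u u ≡ 1ℤ
δ-refl u = cong 𝟙 (≡ᵇ-true {u} refl)

δ-sym : ∀ u v → δ u v ≡ δ v u
δ-sym u v = cong 𝟙 (≡ᵇ-sym u v)

δ-≢ : ∀ {u v} → u ≢ v → δ u v ≡ 0ℤ
δ-≢ ne = cong 𝟙 (≡ᵇ-false ne)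

avoids : ℕ → List ℕ → ℤ
avoids u L = 𝟙 (notInB u L)

avoids-∷ : ∀ u l L → avoids u (l ∷ L) ≡ (1ℤ - δ u l) * avoids u L
avoids-∷ u l L = trans (𝟙-∧ (not (u ≡ᵇ l)) (notInB u L)) (cong (_* avoids u L) (𝟙-not (u ≡ᵇ l)))

avoids-1 : ∀ u a → avoids u (a ∷ []) ≡ 1ℤ - δ u a
avoids-1 u a = trans (avoids-∷ u a []) (ℤₚ.*-identityʳ _)

avoids-2 : ∀ u b a → avoids u (b ∷ a ∷ []) ≡ (1ℤ - δ u b) * (1ℤ - δ u a)
avoids-2 u b a = trans (avoids-∷ u b (a ∷ [])) (cong ((1ℤ - δ u b) *_) (avoids-1 u a))

avoids-3 : ∀ u c b a → avoids u (c ∷ b ∷ a ∷ []) ≡ (1ℤ - δ u c) * ((1ℤ - δ u b) * (1ℤ - δ u a))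
avoids-3 u c b a = trans (avoids-∷ u c (b ∷ a ∷ [])) (cong ((1ℤ - δ u c) *_) (avoids-2 u b a))

-- As the entries of `L` are distinct, at most one `δ u l` is nonzero, which turns the product of
-- the factors 1 - `δ u l` into a linear expression.
avoids-∑ : ∀ u L → Unique L → avoids u L ≡ 1ℤ - (∑[ l ∈ L ] δ u l)
avoids-∑ u []      _          = refl
avoids-∑ u (y ∷ L) (y∉ ∷ uniq) = begin
  avoids u (y ∷ L)                               ≡⟨ avoids-∷ u y L ⟩
  (1ℤ - δ u y) * avoids u L                      ≡⟨ distr (δ u y) (avoids u L) ⟩
  avoids u L - δ u y * avoids u L                ≡⟨ cong₂ _-_ (avoids-∑ u L uniq)
                                                      (trans (𝟙-guard (u ≡ᵇ y) (λ e → cong 𝟙 (notInB-true L (subst (λ z → All (z ≢_) L) (sym (≡ᵇ-true⁻¹ e)) y∉))))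
                                                             (ℤₚ.*-identityʳ (δ u y))) ⟩
  (1ℤ - (∑[ l ∈ L ] δ u l)) - δ u y              ≡⟨ lem (δ u y) _ ⟩
  1ℤ - (δ u y + (∑[ l ∈ L ] δ u l))              ∎
  where
  open ≡-Reasoning
  distr : ∀ d a → (1ℤ - d) * a ≡ a - d * a
  distr = solve-∀
  lem : ∀ d s → (1ℤ - s) - d ≡ 1ℤ - (d + s)
  lem = solve-∀

avoids-∈ : ∀ {u} L → u ∈ L → avoids u L ≡ 0ℤ
avoids-∈ {u} (y ∷ L) (here refl) = trans (avoids-∷ u y L) (trans (cong (λ z → (1ℤ - z) * avoids u L) (δ-refl u)) (ℤₚ.*-zeroˡ (avoids u L)))
avoids-∈ {u} (y ∷ L) (there u∈)  = trans (avoids-∷ u y L) (trans (cong ((1ℤ - δ u y) *_) (avoids-∈ L u∈)) (ℤₚ.*-zeroʳ (1ℤ - δ u y)))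

∑-fresh-δ : ∀ {n u} L (f : ℕ → ℤ) → u < n → (∑[ x ∈ fresh n L ] (δ u x * f x)) ≡ avoids u L * f u
∑-fresh-δ {n} {u} L f u<n = begin
  (∑[ x ∈ fresh n L ] (δ u x * f x))                  ≡⟨ ∑-filterB _ (upTo n) _ ⟩
  (∑[ x ∈ upTo n ] (avoids x L * (δ u x * f x)))      ≡⟨ ∑-cong (upTo n) (λ {x} _ → comm (avoids x L) (δ u x) (f x)) ⟩
  (∑[ x ∈ upTo n ] (δ u x * (avoids x L * f x)))      ≡⟨ ∑-δ-< (λ x → avoids x L * f x) u<n ⟩
  avoids u L * f u                                    ∎
  where
  open ≡-Reasoning
  comm : ∀ a b c → a * (b * c) ≡ b * (a * c)
  comm = solve-∀

∑-fresh-- : ∀ {n} L (f : ℕ → ℤ) → Labelling n L → ∑ (fresh n L) f ≡ ∑ (upTo n) f - ∑ L f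
∑-fresh-- {n} L f lab = trans (lem (∑ (fresh n L) f) (∑ L f)) (cong (_- ∑ L f) (∑-fresh L f lab))
  where
  lem : ∀ a b → a ≡ (a + b) - b
  lem = solve-∀

-- Copies of the ten shapes in a single permutation

module Copies (n : ℕ) (π : List ℕ) (w : IsWord n π) (injective : Injective n π) where
  open IsWord w
  open ≡-Reasoning

  P : ℕ → ℕ
  P = app π

  private
    P< : ∀ {x} → x < n → P x < n
    P< = app-<

    N : ℤ
    N = + n

  -- Fixed points of π, π² and π³ are plain deltas, unlike cycle lengths, and they still determine
  -- the latter: F₂ - F₁ points lie on 2-cycles and F₃ - F₁ on 3-cycles.
  fix₁ fix₂ fix₃ : ℕ → ℤ
  fix₁ x = δ (P x) x
  fix₂ x = δ (P (P x)) x
  fix₃ x = δ (P (P (P x))) x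

  F₁ F₂ F₃ : ℤ
  F₁ = ∑ (upTo n) fix₁
  F₂ = ∑ (upTo n) fix₂
  F₃ = ∑ (upTo n) fix₃

  δ-P : ∀ {x y} → x < n → y < n → δ (P x) (P y) ≡ δ x y
  δ-P {x} {y} x<n y<n = cong 𝟙 (Bool-ext {P x ≡ᵇ P y} {x ≡ᵇ y}
    (λ e → ≡ᵇ-true (injective x<n y<n (≡ᵇ-true⁻¹ {P x} e))) (λ e → ≡ᵇ-true (cong P (≡ᵇ-true⁻¹ {x} e))))

  fix₁₂ : ∀ x → fix₁ x * fix₂ x ≡ fix₁ x
  fix₁₂ x = trans (𝟙-guard (P x ≡ᵇ x) (λ e → let p = ≡ᵇ-true⁻¹ {P x} e in cong 𝟙 (≡ᵇ-true {P (P x)} (trans (cong P p) p)))) (ℤₚ.*-identityʳ _)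

  fix₁₃ : ∀ x → fix₁ x * fix₃ x ≡ fix₁ x
  fix₁₃ x = trans (𝟙-guard (P x ≡ᵇ x) (λ e → let p = ≡ᵇ-true⁻¹ {P x} e in
    cong 𝟙 (≡ᵇ-true {P (P (P x))} (trans (cong P (trans (cong P p) p)) p)))) (ℤₚ.*-identityʳ _)

  fix₂₃ : ∀ x → fix₂ x * fix₃ x ≡ fix₁ x
  fix₂₃ x = trans (𝟙-guard (P (P x) ≡ᵇ x) (λ e → cong (λ z → δ (P z) x) (≡ᵇ-true⁻¹ {P (P x)} e)))
    (trans (ℤₚ.*-comm (fix₂ x) (fix₁ x)) (fix₁₂ x))

  ∑-1 : (∑[ _ ∈ upTo n ] 1ℤ) ≡ N
  ∑-1 = trans (∑-length (upTo n)) (cong +_ (Listₚ.length-upTo n))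

  image : List ℕ
  image = map P (upTo n)

  private
    image-Labelling : Labelling n image
    image-Labelling = Allₚ.map⁺ (All.tabulate (λ x∈ → P< (∈-upTo⁻ x∈))) , unique (upTo n) (All.tabulate ∈-upTo⁻) (Uniqueₚ.upTo⁺ n)
      where
      unique : ∀ xs → All (_< n) xs → Unique xs → Unique (map P xs)
      unique []       _        _        = []
      unique (x ∷ xs) (p ∷ ps) (u ∷ us) = Allₚ.map⁺ (All.zipWith (λ { (q , ne) e → ne (injective p q e) }) (ps , u)) ∷ unique xs ps us

    fresh-image : fresh n image ≡ []
    fresh-image = empty (fresh n image) (ℤₚ.+-injective (begin
      + length (fresh n image)                          ≡⟨ sym (∑-length (fresh n image)) ⟩
      (∑[ _ ∈ fresh n image ] 1ℤ)                       ≡⟨ ∑-fresh-- image _ image-Labelling ⟩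
      (∑[ _ ∈ upTo n ] 1ℤ) - (∑[ _ ∈ image ] 1ℤ)        ≡⟨ cong (_-_ (∑[ _ ∈ upTo n ] 1ℤ)) (∑-map P (upTo n) _) ⟩
      (∑[ _ ∈ upTo n ] 1ℤ) - (∑[ _ ∈ upTo n ] 1ℤ)       ≡⟨ ℤₚ.+-inverseʳ (∑[ _ ∈ upTo n ] 1ℤ) ⟩
      0ℤ                                                ∎))
      where
      empty : ∀ (xs : List ℕ) → length xs ≡ 0 → xs ≡ []
      empty [] _ = refl

  -- Surjectivity from injectivity: the image consists of `n` distinct values below `n`, so no value
  -- is left fresh for it.
  ∑-preimage : ∀ {y} → y < n → (∑[ x ∈ upTo n ] δ (P x) y) ≡ 1ℤ
  ∑-preimage {y} y<n = begin
    (∑[ x ∈ upTo n ] δ (P x) y)                         ≡⟨ ∑-cong (upTo n) (λ {x} _ → δ-sym (P x) y) ⟩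
    (∑[ x ∈ upTo n ] δ y (P x))                         ≡⟨ sym (∑-map P (upTo n) (δ y)) ⟩
    ∑ image (δ y)                                       ≡⟨ sym (ℤₚ.+-identityˡ _) ⟩
    0ℤ + ∑ image (δ y)                                  ≡⟨ cong (λ xs → ∑ xs (δ y) + ∑ image (δ y)) (sym fresh-image) ⟩
    ∑ (fresh n image) (δ y) + ∑ image (δ y)             ≡⟨ ∑-fresh image (δ y) image-Labelling ⟩
    (∑[ x ∈ upTo n ] δ y x)                             ≡⟨ ∑-cong (upTo n) (λ _ → sym (ℤₚ.*-identityʳ _)) ⟩
    (∑[ x ∈ upTo n ] (δ y x * 1ℤ))                      ≡⟨ ∑-δ-< (λ _ → 1ℤ) y<n ⟩
    1ℤ                                                  ∎

  -- A sum over the non-loop edges a → x of `π` that are disjoint from `L`. The target `x` is summed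
  -- rather than set to `P a`, since sums over `inj` arrive in this form.
  edgeΣ : List ℕ → (ℕ → ℕ → ℤ) → ℤ
  edgeΣ L g = ∑[ a ∈ fresh n L ] ∑[ x ∈ fresh n (a ∷ L) ] (δ (P a) x * g a x)

  loopΣ : List ℕ → (ℕ → ℤ) → ℤ
  loopΣ L g = ∑[ a ∈ fresh n L ] (fix₁ a * g a)

  edgeΣ-fresh : ∀ L g → edgeΣ L g ≡ (∑[ a ∈ fresh n L ] (avoids (P a) (a ∷ L) * g a (P a)))
  edgeΣ-fresh L g = ∑-cong (fresh n L) (λ {a} a∈ → ∑-fresh-δ (a ∷ L) (g a) (P< (proj₁ (∈-fresh⁻ L a∈))))

  -- An edge disjoint from L: of the n - F₁ edges, discard those that start
  -- or end in L, and restore those that do both.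
  edgeΣ-1 : ∀ L → Labelling n L → edgeΣ L (λ _ _ → 1ℤ) ≡
    N - F₁ - + length L - + length L + ∑ L fix₁ + (∑[ c ∈ L ] ∑[ l ∈ L ] δ (P c) l)
  edgeΣ-1 L lab@(<n , uniq) = begin
    edgeΣ L (λ _ _ → 1ℤ)
      ≡⟨ edgeΣ-fresh L _ ⟩
    (∑[ c ∈ fresh n L ] (avoids (P c) (c ∷ L) * 1ℤ))
      ≡⟨ ∑-cong (fresh n L) (λ {c} _ → trans (ℤₚ.*-identityʳ _) (avoids-∷ (P c) c L)) ⟩
    (∑[ c ∈ fresh n L ] h c)
      ≡⟨ ∑-fresh-- L h lab ⟩
    ∑ (upTo n) h - ∑ L h
      ≡⟨ cong₂ _-_ outside inside ⟩
    (N - F₁ - + length L + ∑ L fix₁) - (+ length L - (∑[ c ∈ L ] ∑[ l ∈ L ] δ (P c) l))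
      ≡⟨ lem N F₁ (+ length L) (∑ L fix₁) _ ⟩
    N - F₁ - + length L - + length L + ∑ L fix₁ + (∑[ c ∈ L ] ∑[ l ∈ L ] δ (P c) l) ∎
    where
    lem : ∀ n f l k s → (n - f - l + k) - (l - s) ≡ n - f - l - l + k + s
    lem = solve-∀
    h : ℕ → ℤ
    h c = (1ℤ - fix₁ c) * avoids (P c) L
    expand : ∀ f s → (1ℤ - f) * (1ℤ - s) ≡ ((1ℤ - f) - s) + f * s
    expand = solve-∀
    -- A loop at `c` ends in `L` exactly when `c` itself lies in `L`.
    both : ∀ c → fix₁ c * (∑[ l ∈ L ] δ (P c) l) ≡ (∑[ l ∈ L ] (δ l c * fix₁ c))
    both c = trans (sym (∑-*ˡ L (fix₁ c) _)) (∑-cong L (λ {l} _ →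
      trans (𝟙-guard (P c ≡ᵇ c) (λ e → trans (cong (λ z → δ z l) (≡ᵇ-true⁻¹ {P c} e)) (δ-sym c l))) (ℤₚ.*-comm (fix₁ c) (δ l c))))
    outside : ∑ (upTo n) h ≡ N - F₁ - + length L + ∑ L fix₁
    outside = begin
      ∑ (upTo n) h
        ≡⟨ ∑-cong (upTo n) (λ {c} _ → trans (cong ((1ℤ - fix₁ c) *_) (avoids-∑ (P c) L uniq)) (trans (expand (fix₁ c) (∑[ l ∈ L ] δ (P c) l))
             (cong (_+_ ((1ℤ - fix₁ c) - (∑[ l ∈ L ] δ (P c) l))) (both c)))) ⟩
      (∑[ c ∈ upTo n ] (((1ℤ - fix₁ c) - (∑[ l ∈ L ] δ (P c) l)) + (∑[ l ∈ L ] (δ l c * fix₁ c))))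
        ≡⟨ trans (∑-+ (upTo n) _ _) (cong₂ _+_ (trans (∑-- (upTo n) _ _) (cong₂ _-_ (trans (∑-- (upTo n) _ _) (cong (_- F₁) ∑-1)) refl)) refl) ⟩
      ((N - F₁) - (∑[ c ∈ upTo n ] ∑[ l ∈ L ] δ (P c) l)) + (∑[ c ∈ upTo n ] ∑[ l ∈ L ] (δ l c * fix₁ c))
        ≡⟨ cong₂ (λ x y → ((N - F₁) - x) + y) ends loops ⟩
      N - F₁ - + length L + ∑ L fix₁ ∎
      where
      ends : (∑[ c ∈ upTo n ] ∑[ l ∈ L ] δ (P c) l) ≡ + length L
      ends = begin
        (∑[ c ∈ upTo n ] ∑[ l ∈ L ] δ (P c) l)  ≡⟨ ∑-swap (upTo n) L _ ⟩
        (∑[ l ∈ L ] ∑[ c ∈ upTo n ] δ (P c) l)  ≡⟨ ∑-cong L (λ l∈ → ∑-preimage (All.lookup <n l∈)) ⟩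
        (∑[ _ ∈ L ] 1ℤ)                         ≡⟨ ∑-length L ⟩
        + length L                              ∎
      loops : (∑[ c ∈ upTo n ] ∑[ l ∈ L ] (δ l c * fix₁ c)) ≡ ∑ L fix₁
      loops = begin
        (∑[ c ∈ upTo n ] ∑[ l ∈ L ] (δ l c * fix₁ c))  ≡⟨ ∑-swap (upTo n) L _ ⟩
        (∑[ l ∈ L ] ∑[ c ∈ upTo n ] (δ l c * fix₁ c))  ≡⟨ ∑-cong L (λ l∈ → ∑-δ-< fix₁ (All.lookup <n l∈)) ⟩
        ∑ L fix₁                                       ∎
    inside : ∑ L h ≡ + length L - (∑[ c ∈ L ] ∑[ l ∈ L ] δ (P c) l)
    inside = begin
      ∑ L h
        ≡⟨ ∑-cong L (λ {c} c∈ → trans (distr (fix₁ c) (avoids (P c) L)) (trans (cong (_-_ (avoids (P c) L))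
             (trans (𝟙-guard (P c ≡ᵇ c) (λ e → trans (cong (λ z → avoids z L) (≡ᵇ-true⁻¹ {P c} e)) (avoids-∈ L c∈))) (ℤₚ.*-zeroʳ (fix₁ c))))
             (trans (ℤₚ.+-identityʳ _) (avoids-∑ (P c) L uniq)))) ⟩
      (∑[ c ∈ L ] (1ℤ - (∑[ l ∈ L ] δ (P c) l)))
        ≡⟨ trans (∑-- L _ _) (cong (λ z → z - (∑[ c ∈ L ] ∑[ l ∈ L ] δ (P c) l)) (∑-length L)) ⟩
      + length L - (∑[ c ∈ L ] ∑[ l ∈ L ] δ (P c) l) ∎
      where
      distr : ∀ f a → (1ℤ - f) * a ≡ a - f * a
      distr = solve-∀

  loopΣ-1 : ∀ L → Labelling n L → loopΣ L (λ _ → 1ℤ) ≡ F₁ - ∑ L fix₁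
  loopΣ-1 L lab = trans (∑-cong (fresh n L) (λ _ → ℤₚ.*-identityʳ _)) (∑-fresh-- L fix₁ lab)

  ∑-fresh-[] : ∀ (f : ℕ → ℤ) → ∑ (fresh n []) f ≡ ∑ (upTo n) f
  ∑-fresh-[] f = trans (∑-filterB _ (upTo n) f) (∑-cong (upTo n) (λ {x} _ → ℤₚ.*-identityˡ (f x)))

  edgeΣ-[] : ∀ g → edgeΣ [] g ≡ (∑[ a ∈ upTo n ] ((1ℤ - fix₁ a) * g a (P a)))
  edgeΣ-[] g = trans (edgeΣ-fresh [] g) (trans (∑-fresh-[] _)
    (∑-cong (upTo n) (λ {a} _ → cong (_* g a (P a)) (avoids-1 (P a) a))))

  -- The possible values of fix₁ x, fix₂ x, fix₃ x, by the length of the cycle of x.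
  data Cycle : ℤ → ℤ → ℤ → Set where
    one   : Cycle 1ℤ 1ℤ 1ℤ
    two   : Cycle 0ℤ 1ℤ 0ℤ
    three : Cycle 0ℤ 0ℤ 1ℤ
    long  : Cycle 0ℤ 0ℤ 0ℤ

  -- Of the eight combinations of three bits, the product relations `fix₁₂`, `fix₁₃` and `fix₂₃`
  -- exclude four.
  cycle : ∀ x → Cycle (fix₁ x) (fix₂ x) (fix₃ x)
  cycle x = go (fix₁₂ x) (fix₁₃ x) (fix₂₃ x)
    where
    go : ∀ {a b c} → 𝟙 a * 𝟙 b ≡ 𝟙 a → 𝟙 a * 𝟙 c ≡ 𝟙 a → 𝟙 b * 𝟙 c ≡ 𝟙 a → Cycle (𝟙 a) (𝟙 b) (𝟙 c)
    go {true}  {true}  {true}  _ _ _ = one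
    go {false} {true}  {false} _ _ _ = two
    go {false} {false} {true}  _ _ _ = three
    go {false} {false} {false} _ _ _ = long

  nonfixed-guard : ∀ a {x y} → (P a ≢ a → x ≡ y) → (1ℤ - fix₁ a) * x ≡ (1ℤ - fix₁ a) * y
  nonfixed-guard a h with P a ≡ᵇ a in eq
  ... | true  = refl
  ... | false = cong (1ℤ *_) (h (≡ᵇ-false⁻¹ eq))

  avoids-guard : ∀ u L {x y} → (All (u ≢_) L → x ≡ y) → avoids u L * x ≡ avoids u L * y
  avoids-guard u L h = 𝟙-guard (notInB u L) (λ e → h (notInB-true⁻¹ L e))

  private
    ≢-P : ∀ {x y} → x < n → y < n → x ≢ y → P x ≢ P y
    ≢-P x<n y<n ne e = ne (injective x<n y<n e)

  -- Three edges touch a → P a: itself, the one into `a` and the one out of `P a`. The last two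
  -- coincide when `a` lies on a 2-cycle, whence the correction `fix₂ a`.
  edgeΣ-edge : ∀ {a} → a < n → P a ≢ a → edgeΣ (P a ∷ a ∷ []) (λ _ _ → 1ℤ) ≡ N - F₁ - + 3 + fix₂ a
  edgeΣ-edge {a} a<n ne = trans (edgeΣ-1 (P a ∷ a ∷ []) (P< a<n ∷ a<n ∷ [] , (ne ∷ []) ∷ [] ∷ []))
    (trans (inside (δ-≢ (≢-P (P< a<n) a<n ne)) (δ-≢ ne) (δ-refl (P a))) (arith N F₁ (fix₂ a)))
    where
    inside : δ (P (P a)) (P a) ≡ 0ℤ → fix₁ a ≡ 0ℤ → δ (P a) (P a) ≡ 1ℤ →
      N - F₁ - + 2 - + 2 + ∑ (P a ∷ a ∷ []) fix₁ + (∑[ c ∈ P a ∷ a ∷ [] ] ∑[ l ∈ P a ∷ a ∷ [] ] δ (P c) l) ≡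
      N - F₁ - + 2 - + 2 + (0ℤ + (0ℤ + 0ℤ)) + ((0ℤ + (fix₂ a + 0ℤ)) + ((1ℤ + (0ℤ + 0ℤ)) + 0ℤ))
    inside p q r rewrite p | q | r = refl
    arith : ∀ n f t → n - f - + 2 - + 2 + (0ℤ + (0ℤ + 0ℤ)) + ((0ℤ + (t + 0ℤ)) + ((1ℤ + (0ℤ + 0ℤ)) + 0ℤ)) ≡ n - f - + 3 + t
    arith = solve-∀

  -- The edges that touch the path are its own two, the one into `a` and the one out of `P (P a)`;
  -- the last two coincide on a 3-cycle.
  edgeΣ-path : ∀ {a} → a < n → P a ≢ a → P (P a) ≢ a →
    edgeΣ (P (P a) ∷ P a ∷ a ∷ []) (λ _ _ → 1ℤ) ≡ N - F₁ - + 4 + fix₃ a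
  edgeΣ-path {a} a<n ne₁ ne₂ =
    trans (edgeΣ-1 L (P< x<n ∷ x<n ∷ a<n ∷ [] , (ne₃ ∷ ne₂ ∷ []) ∷ (ne₁ ∷ []) ∷ [] ∷ []))
      (trans (inside (δ-≢ (≢-P (P< x<n) x<n ne₃)) (δ-≢ (≢-P (P< x<n) a<n ne₂)) (δ-≢ ne₃) (δ-≢ ne₂) (δ-refl (P (P a)))
        (δ-≢ (≢-P a<n x<n (≢-sym ne₁))) (δ-refl (P a)) (δ-≢ ne₁)) (arith N F₁ (fix₃ a)))
    where
    L = P (P a) ∷ P a ∷ a ∷ []
    x<n = P< a<n
    ne₃ = ≢-P x<n a<n ne₁
    inside : δ (P (P (P a))) (P (P a)) ≡ 0ℤ → δ (P (P (P a))) (P a) ≡ 0ℤ → δ (P (P a)) (P a) ≡ 0ℤ → fix₂ a ≡ 0ℤ →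
      δ (P (P a)) (P (P a)) ≡ 1ℤ → δ (P a) (P (P a)) ≡ 0ℤ → δ (P a) (P a) ≡ 1ℤ → fix₁ a ≡ 0ℤ →
      N - F₁ - + 3 - + 3 + ∑ L fix₁ + (∑[ c ∈ L ] ∑[ l ∈ L ] δ (P c) l) ≡
      N - F₁ - + 3 - + 3 + 0ℤ + ((0ℤ + (0ℤ + (fix₃ a + 0ℤ))) + ((1ℤ + (0ℤ + (0ℤ + 0ℤ))) + ((0ℤ + (1ℤ + (0ℤ + 0ℤ))) + 0ℤ)))
    inside p q r s t u v w rewrite p | q | r | s | t | u | v | w = refl
    arith : ∀ n f t → n - f - + 3 - + 3 + 0ℤ + ((0ℤ + (0ℤ + (t + 0ℤ))) + ((1ℤ + (0ℤ + (0ℤ + 0ℤ))) + ((0ℤ + (1ℤ + (0ℤ + 0ℤ))) + 0ℤ)))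
      ≡ n - f - + 4 + t
    arith = solve-∀

  -- Fixed points meet no non-loop edge, so all of these remain.
  edgeΣ-loop-loop : ∀ {a b} → a < n → b < n → P a ≡ a → P b ≡ b → b ≢ a → edgeΣ (b ∷ a ∷ []) (λ _ _ → 1ℤ) ≡ N - F₁
  edgeΣ-loop-loop {a} {b} a<n b<n Pa Pb ne = trans (edgeΣ-1 (b ∷ a ∷ []) (b<n ∷ a<n ∷ [] , (ne ∷ []) ∷ [] ∷ []))
    (trans inside (arith N F₁))
    where
    inside : N - F₁ - + 2 - + 2 + ∑ (b ∷ a ∷ []) fix₁ + (∑[ c ∈ b ∷ a ∷ [] ] ∑[ l ∈ b ∷ a ∷ [] ] δ (P c) l) ≡
      N - F₁ - + 2 - + 2 + + 2 + + 2
    inside rewrite Pa | Pb | δ-≢ ne | δ-≢ (≢-sym ne) | δ-refl a | δ-refl b = refl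
    arith : ∀ n f → n - f - + 2 - + 2 + + 2 + + 2 ≡ n - f
    arith = solve-∀

  edgeΣ-loop-edge : ∀ {a b} → a < n → b < n → P a ≡ a → P b ≢ b → b ≢ a →
    edgeΣ (P b ∷ b ∷ a ∷ []) (λ _ _ → 1ℤ) ≡ N - F₁ - + 3 + fix₂ b
  edgeΣ-loop-edge {a} {b} a<n b<n Pa ne ne′ =
    trans (edgeΣ-1 L (P< b<n ∷ b<n ∷ a<n ∷ [] , (ne ∷ Pb≢a ∷ []) ∷ (ne′ ∷ []) ∷ [] ∷ []))
      (trans (inside (δ-≢ (≢-P (P< b<n) b<n ne)) (δ-≢ ne) (δ-≢ (subst (P (P b) ≢_) Pa (≢-P (P< b<n) a<n Pb≢a)))
         (δ-refl (P b)) (δ-≢ Pb≢a) (δ-≢ (≢-sym Pb≢a)) (δ-≢ (≢-sym ne′)) (δ-refl a)) (arith N F₁ (fix₂ b)))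
    where
    L = P b ∷ b ∷ a ∷ []
    Pb≢a : P b ≢ a
    Pb≢a = subst (P b ≢_) Pa (≢-P b<n a<n ne′)
    inside : δ (P (P b)) (P b) ≡ 0ℤ → fix₁ b ≡ 0ℤ → δ (P (P b)) a ≡ 0ℤ → δ (P b) (P b) ≡ 1ℤ → δ (P b) a ≡ 0ℤ →
      δ a (P b) ≡ 0ℤ → δ a b ≡ 0ℤ → δ a a ≡ 1ℤ →
      N - F₁ - + 3 - + 3 + ∑ L fix₁ + (∑[ c ∈ L ] ∑[ l ∈ L ] δ (P c) l) ≡
      N - F₁ - + 3 - + 3 + 1ℤ + ((0ℤ + (fix₂ b + (0ℤ + 0ℤ))) + ((1ℤ + (0ℤ + (0ℤ + 0ℤ))) + ((0ℤ + (0ℤ + (1ℤ + 0ℤ))) + 0ℤ)))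
    inside p q r s t u v w rewrite Pa | p | q | r | s | t | u | v | w = refl
    arith : ∀ n f t → n - f - + 3 - + 3 + 1ℤ + ((0ℤ + (t + (0ℤ + 0ℤ))) + ((1ℤ + (0ℤ + (0ℤ + 0ℤ))) + ((0ℤ + (0ℤ + (1ℤ + 0ℤ))) + 0ℤ)))
      ≡ n - f - + 3 + t
    arith = solve-∀

  -- Each of the two edges excludes itself, its predecessor and its successor, six in all. A 2-cycle
  -- identifies the two neighbours of one edge, and an edge from `P a` to `b`, or from `P b` to `a`,
  -- is the successor of one and the predecessor of the other.
  edgeΣ-edge-edge : ∀ {a b} → a < n → b < n → P a ≢ a → All (b ≢_) (P a ∷ a ∷ []) → All (P b ≢_) (b ∷ P a ∷ a ∷ []) →
    edgeΣ (P b ∷ b ∷ P a ∷ a ∷ []) (λ _ _ → 1ℤ) ≡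
    N - F₁ - + 6 + fix₂ a + fix₂ b + δ (P (P a)) b + δ (P (P b)) a
  edgeΣ-edge-edge {a} {b} a<n b<n ne b∉@(b≢Pa ∷ b≢a ∷ []) Pb∉@(Pb≢b ∷ Pb≢Pa ∷ Pb≢a ∷ []) =
    trans (edgeΣ-1 L (P< b<n ∷ b<n ∷ P< a<n ∷ a<n ∷ [] , Pb∉ ∷ b∉ ∷ (ne ∷ []) ∷ [] ∷ []))
      (trans (inside
          (δ-≢ (≢-P (P< b<n) b<n Pb≢b)) (δ-≢ (≢-P (P< b<n) a<n Pb≢a))
          (δ-refl (P b)) (δ-≢ Pb≢b) (δ-≢ Pb≢Pa) (δ-≢ Pb≢a)
          (δ-≢ (≢-P (P< a<n) b<n (≢-sym b≢Pa))) (δ-≢ (≢-P (P< a<n) a<n ne))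
          (δ-≢ (≢-sym Pb≢Pa)) (δ-≢ (≢-sym b≢Pa)) (δ-refl (P a)) (δ-≢ ne))
        (arith N F₁ (fix₂ a) (fix₂ b) (δ (P (P a)) b) (δ (P (P b)) a)))
    where
    L = P b ∷ b ∷ P a ∷ a ∷ []
    inside : δ (P (P b)) (P b) ≡ 0ℤ → δ (P (P b)) (P a) ≡ 0ℤ →
      δ (P b) (P b) ≡ 1ℤ → fix₁ b ≡ 0ℤ → δ (P b) (P a) ≡ 0ℤ → δ (P b) a ≡ 0ℤ →
      δ (P (P a)) (P b) ≡ 0ℤ → δ (P (P a)) (P a) ≡ 0ℤ →
      δ (P a) (P b) ≡ 0ℤ → δ (P a) b ≡ 0ℤ → δ (P a) (P a) ≡ 1ℤ → fix₁ a ≡ 0ℤ →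
      N - F₁ - + 4 - + 4 + ∑ L fix₁ + (∑[ c ∈ L ] ∑[ l ∈ L ] δ (P c) l) ≡
      N - F₁ - + 4 - + 4 + 0ℤ +
        ((0ℤ + (fix₂ b + (0ℤ + (δ (P (P b)) a + 0ℤ)))) + ((1ℤ + (0ℤ + (0ℤ + (0ℤ + 0ℤ)))) +
        ((0ℤ + (δ (P (P a)) b + (0ℤ + (fix₂ a + 0ℤ)))) + ((0ℤ + (0ℤ + (1ℤ + (0ℤ + 0ℤ)))) + 0ℤ))))
    inside p₁ p₂ q₁ q₂ q₃ q₄ r₁ r₂ s₁ s₂ s₃ s₄
      rewrite p₁ | p₂ | q₁ | q₂ | q₃ | q₄ | r₁ | r₂ | s₁ | s₂ | s₃ | s₄ = refl
    arith : ∀ n f t u v w → n - f - + 4 - + 4 + 0ℤ +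
        ((0ℤ + (u + (0ℤ + (w + 0ℤ)))) + ((1ℤ + (0ℤ + (0ℤ + (0ℤ + 0ℤ)))) +
        ((0ℤ + (v + (0ℤ + (t + 0ℤ)))) + ((0ℤ + (0ℤ + (1ℤ + (0ℤ + 0ℤ)))) + 0ℤ))))
      ≡ n - f - + 6 + t + u + v + w
    arith = solve-∀

  -- A fixed point a is automatically avoided by edges.
  edgeΣ-loop : ∀ {a} → a < n → P a ≡ a → ∀ g → edgeΣ (a ∷ []) g ≡ (∑[ b ∈ upTo n ] ((1ℤ - fix₁ b) * g b (P b)))
  edgeΣ-loop {a} a<n Pa g = trans (edgeΣ-fresh (a ∷ []) g) (trans (∑-filterB _ (upTo n) _)
    (∑-upTo-cong n (λ b b<n → trans (sym (ℤₚ.*-assoc (avoids b (a ∷ [])) (avoids (P b) (b ∷ a ∷ [])) (g b (P b))))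
      (cong (_* g b (P b)) (begin
        avoids b (a ∷ []) * avoids (P b) (b ∷ a ∷ [])
          ≡⟨ cong₂ _*_ (avoids-1 b a) (avoids-2 (P b) b a) ⟩
        (1ℤ - δ b a) * ((1ℤ - fix₁ b) * (1ℤ - δ (P b) a))
          ≡⟨ cong (λ z → (1ℤ - δ b a) * ((1ℤ - fix₁ b) * (1ℤ - z))) (trans (cong (δ (P b)) (sym Pa)) (δ-P b<n a<n)) ⟩
        (1ℤ - δ b a) * ((1ℤ - fix₁ b) * (1ℤ - δ b a))
          ≡⟨ absorb b ⟩
        1ℤ - fix₁ b ∎)))))
    where
    absorb : ∀ b → (1ℤ - δ b a) * ((1ℤ - fix₁ b) * (1ℤ - δ b a)) ≡ 1ℤ - fix₁ b
    absorb b with b ≡ᵇ a in eq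
    ... | false = trans (ℤₚ.*-identityˡ _) (ℤₚ.*-identityʳ _)
    ... | true rewrite ≡ᵇ-true⁻¹ {b} eq | Pa | δ-refl a = refl

  loopΣ-[] : ∀ g c → (∀ {a} → a < n → P a ≡ a → g a ≡ c) → loopΣ [] g ≡ F₁ * c
  loopΣ-[] g c h = trans (∑-fresh-[] _) (trans
    (∑-upTo-cong n (λ a a<n → 𝟙-guard (P a ≡ᵇ a) (λ e → h a<n (≡ᵇ-true⁻¹ e)))) (∑-*ʳ (upTo n) fix₁ c))

  loopΣ-loop : ∀ {a} g c → a < n → P a ≡ a → (∀ {b} → b < n → P b ≡ b → b ≢ a → g b ≡ c) → loopΣ (a ∷ []) g ≡ (F₁ - 1ℤ) * c
  loopΣ-loop {a} g c a<n Pa h = begin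
    loopΣ (a ∷ []) g
      ≡⟨ ∑-cong (fresh n (a ∷ [])) (λ {b} b∈ → let b<n , b∉ = ∈-fresh⁻ (a ∷ []) b∈ in
           𝟙-guard (P b ≡ᵇ b) (λ e → h b<n (≡ᵇ-true⁻¹ e) (All.head b∉))) ⟩
    (∑[ b ∈ fresh n (a ∷ []) ] (fix₁ b * c))
      ≡⟨ ∑-*ʳ (fresh n (a ∷ [])) fix₁ c ⟩
    ∑ (fresh n (a ∷ [])) fix₁ * c
      ≡⟨ cong (_* c) (∑-fresh-- (a ∷ []) fix₁ (a<n ∷ [] , [] ∷ [])) ⟩
    (F₁ - (fix₁ a + 0ℤ)) * c
      ≡⟨ cong (λ z → (F₁ - (δ z a + 0ℤ)) * c) Pa ⟩
    (F₁ - (δ a a + 0ℤ)) * c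
      ≡⟨ cong (λ z → (F₁ - (z + 0ℤ)) * c) (δ-refl a) ⟩
    (F₁ - 1ℤ) * c ∎

  extΣ : List ℕ → ℕ → (ℕ → ℤ) → ℤ
  extΣ L u g = ∑[ y ∈ fresh n L ] (δ (P u) y * g y)

  extΣ-fresh : ∀ L {u} g → u < n → extΣ L u g ≡ avoids (P u) L * g (P u)
  extΣ-fresh L g u<n = ∑-fresh-δ L g (P< u<n)

  private
    -- The number of ordered pairs of disjoint non-loop edges, as `KΣ-1` confirms.
    EE : ℤ
    EE = (N - F₁) * (N - F₁ - + 3) + (F₂ - F₁)

    -- A summand that depends only on the case of `Cycle` takes four values, so it is interpolated
    -- by 1, `fix₁`, `fix₂` and `fix₃` and then summed term by term.
    ∑-nonfixed : ∀ (h : ℕ → ℤ) (α β γ ε : ℤ) → (∀ a → h a ≡ α + β * fix₁ a + γ * fix₂ a + ε * fix₃ a) →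
      ∑ (upTo n) h ≡ α * N + β * F₁ + γ * F₂ + ε * F₃
    ∑-nonfixed h α β γ ε e = begin
      ∑ (upTo n) h
        ≡⟨ ∑-cong (upTo n) (λ {a} _ → trans (e a) (cong (λ z → z + β * fix₁ a + γ * fix₂ a + ε * fix₃ a) (sym (ℤₚ.*-identityʳ α)))) ⟩
      (∑[ a ∈ upTo n ] (α * 1ℤ + β * fix₁ a + γ * fix₂ a + ε * fix₃ a))
        ≡⟨ trans (∑-+ (upTo n) _ _) (cong₂ _+_ (trans (∑-+ (upTo n) _ _) (cong₂ _+_ (trans (∑-+ (upTo n) _ _)
             (cong₂ _+_ (trans (∑-*ˡ (upTo n) α _) (cong (α *_) ∑-1)) (∑-*ˡ (upTo n) β fix₁)))
             (∑-*ˡ (upTo n) γ fix₂))) (∑-*ˡ (upTo n) ε fix₃)) ⟩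
      α * N + β * F₁ + γ * F₂ + ε * F₃ ∎

  ∑-edges : (∑[ a ∈ upTo n ] ((1ℤ - fix₁ a) * (N - F₁ - + 3 + fix₂ a))) ≡ EE
  -- With k = N - F₁ - 3 the summand is 0, k + 1, k, k in the four cases of `Cycle`; this determines
  -- the coefficients k, -k - 1, 1, 0.
  ∑-edges = trans (∑-nonfixed _ (N - F₁ - + 3) (- (N - F₁ - + 3) - 1ℤ) 1ℤ 0ℤ (λ a → lem (N - F₁ - + 3) (cycle a))) (arith N F₁ F₂ F₃)
    where
    lem : ∀ k {x y z} → Cycle x y z → (1ℤ - x) * (k + y) ≡ k + (- k - 1ℤ) * x + 1ℤ * y + 0ℤ * z
    lem k one   = l k where
      l : ∀ k → (1ℤ - 1ℤ) * (k + 1ℤ) ≡ k + (- k - 1ℤ) * 1ℤ + 1ℤ * 1ℤ + 0ℤ * 1ℤ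
      l = solve-∀
    lem k two   = l k where
      l : ∀ k → (1ℤ - 0ℤ) * (k + 1ℤ) ≡ k + (- k - 1ℤ) * 0ℤ + 1ℤ * 1ℤ + 0ℤ * 0ℤ
      l = solve-∀
    lem k three = l k where
      l : ∀ k → (1ℤ - 0ℤ) * (k + 0ℤ) ≡ k + (- k - 1ℤ) * 0ℤ + 1ℤ * 0ℤ + 0ℤ * 1ℤ
      l = solve-∀
    lem k long  = l k where
      l : ∀ k → (1ℤ - 0ℤ) * (k + 0ℤ) ≡ k + (- k - 1ℤ) * 0ℤ + 1ℤ * 0ℤ + 0ℤ * 0ℤ
      l = solve-∀
    arith : ∀ n f g h → (n - f - + 3) * n + (- (n - f - + 3) - 1ℤ) * f + 1ℤ * g + 0ℤ * h ≡ (n - f) * (n - f - + 3) + (g - f)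
    arith = solve-∀

  private
    step : ∀ k L (f : List ℕ → ℤ) {g : ℕ → ℤ} → (∀ {x} → x ∈ fresh n L → (∑[ s ∈ inj n k (x ∷ L) ] f (x ∷ s)) ≡ g x) →
      ∑ (inj n (suc k) L) f ≡ ∑ (fresh n L) g
    step k L f h = trans (∑-inj n k L f) (∑-cong (fresh n L) h)

    -- The added `0ℤ` is what remains of the sum over the one-element list `inj n 0 L`.
    rsp : ∀ a b c x y z → 𝟙 (respects π ((a , x) ∷ (b , y) ∷ (c , z) ∷ [])) + 0ℤ ≡ δ (P a) x * (δ (P b) y * δ (P c) z)
    rsp a b c x y z = trans (ℤₚ.+-identityʳ _) (𝟙-respects₃ π a b c x y z)

    pull-edge : ∀ c L g → (∑[ a ∈ fresh n L ] ∑[ x ∈ fresh n (a ∷ L) ] (c * (δ (P a) x * g a x))) ≡ c * edgeΣ L g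
    pull-edge c L g = trans (∑-cong (fresh n L) (λ {a} _ → ∑-*ˡ (fresh n (a ∷ L)) c _)) (∑-*ˡ (fresh n L) c _)

    pull-ext : ∀ c L u g → (∑[ y ∈ fresh n L ] (c * (δ (P u) y * g y))) ≡ c * extΣ L u g
    pull-ext c L u g = ∑-*ˡ (fresh n L) c _

    pull-loop : ∀ c L g → (∑[ a ∈ fresh n L ] (c * (fix₁ a * g a))) ≡ c * loopΣ L g
    pull-loop c L g = ∑-*ˡ (fresh n L) c _

    tail₁ : ∀ a b c → a * (b * c) ≡ (a * b) * (c * 1ℤ)
    tail₁ = solve-∀

    found : Shape → List ℕ → ℤ
    found t s = 𝟙 (respects π (relabel (app s) (graph t)))

  copies-c₁c₁c₁ : copies n π c₁c₁c₁ ≡ F₁ * ((F₁ - 1ℤ) * (F₁ - + 2))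
  copies-c₁c₁c₁ = trans
    (step 2 [] (found c₁c₁c₁) (λ {a} _ → trans (step 1 (a ∷ []) _ (λ {b} _ → trans (step 0 (b ∷ a ∷ []) _ (λ {c} _ →
       trans (rsp a b c a b c) (tail₁ (fix₁ a) (fix₁ b) (fix₁ c))))
       (trans (pull-loop (fix₁ a * fix₁ b) (b ∷ a ∷ []) (λ _ → 1ℤ)) (ℤₚ.*-assoc (fix₁ a) (fix₁ b) _))))
       (pull-loop (fix₁ a) (a ∷ []) (λ b → loopΣ (b ∷ a ∷ []) (λ _ → 1ℤ)))))
    (loopΣ-[] (λ a → loopΣ (a ∷ []) (λ b → loopΣ (b ∷ a ∷ []) (λ _ → 1ℤ))) _ (λ {a} a<n Pa →
       loopΣ-loop (λ b → loopΣ (b ∷ a ∷ []) (λ _ → 1ℤ)) _ a<n Pa (λ {b} b<n Pb ne →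
         trans (loopΣ-1 (b ∷ a ∷ []) (b<n ∷ a<n ∷ [] , (ne ∷ []) ∷ [] ∷ []))
           (cong₂ (λ x y → F₁ - (x + (y + 0ℤ))) (cong 𝟙 (≡ᵇ-true Pb)) (cong 𝟙 (≡ᵇ-true Pa))))))

  copies-c₁c₁e : copies n π c₁c₁e ≡ F₁ * ((F₁ - 1ℤ) * (N - F₁))
  copies-c₁c₁e = trans
    (step 3 [] (found c₁c₁e) (λ {a} _ → trans (step 2 (a ∷ []) _ (λ {b} _ → trans (step 1 (b ∷ a ∷ []) _ (λ {c} _ →
       step 0 (c ∷ b ∷ a ∷ []) _ (λ {z} _ → trans (rsp a b c a b z) (tail₁ (fix₁ a) (fix₁ b) (δ (P c) z)))))
       (trans (pull-edge (fix₁ a * fix₁ b) (b ∷ a ∷ []) (λ _ _ → 1ℤ)) (ℤₚ.*-assoc (fix₁ a) (fix₁ b) _))))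
       (pull-loop (fix₁ a) (a ∷ []) (λ b → edgeΣ (b ∷ a ∷ []) (λ _ _ → 1ℤ)))))
    (loopΣ-[] (λ a → loopΣ (a ∷ []) (λ b → edgeΣ (b ∷ a ∷ []) (λ _ _ → 1ℤ))) _ (λ {a} a<n Pa →
       loopΣ-loop (λ b → edgeΣ (b ∷ a ∷ []) (λ _ _ → 1ℤ)) _ a<n Pa (λ b<n Pb ne → edgeΣ-loop-loop a<n b<n Pa Pb ne)))

  copies-c₁c₂ : copies n π c₁c₂ ≡ F₁ * (F₂ - F₁)
  copies-c₁c₂ = trans
    (step 2 [] (found c₁c₂) (λ {a} _ → trans (step 1 (a ∷ []) _ (λ {b} _ → step 0 (b ∷ a ∷ []) _ (λ {c} _ → rsp a b c a c b)))
       (pull-edge (fix₁ a) (a ∷ []) (λ b c → δ (P c) b))))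
    (loopΣ-[] (λ a → edgeΣ (a ∷ []) (λ b c → δ (P c) b)) _ (λ a<n Pa →
       trans (edgeΣ-loop a<n Pa _) (trans (∑-cong (upTo n) (λ {b} _ → lem (cycle b))) (∑-- (upTo n) fix₂ fix₁))))
    where
    lem : ∀ {x y z} → Cycle x y z → (1ℤ - x) * y ≡ y - x
    lem one   = refl
    lem two   = refl
    lem three = refl
    lem long  = refl

  -- A path with two edges is determined by its start, which may be any point not fixed by π², and a
  -- fixed point never lies on it.
  copies-c₁p₂ : copies n π c₁p₂ ≡ F₁ * (N - F₂)
  copies-c₁p₂ = trans
    (step 3 [] (found c₁p₂) (λ {a} _ → trans (step 2 (a ∷ []) _ (λ {b} _ → step 1 (b ∷ a ∷ []) _ (λ {x} _ → trans
       (step 0 (x ∷ b ∷ a ∷ []) _ (λ {y} _ → trans (rsp a b x a x y) (tail₁ (fix₁ a) (δ (P b) x) (δ (P x) y))))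
       (trans (pull-ext (fix₁ a * δ (P b) x) (x ∷ b ∷ a ∷ []) x (λ _ → 1ℤ)) (ℤₚ.*-assoc (fix₁ a) (δ (P b) x) _)))))
       (pull-edge (fix₁ a) (a ∷ []) (λ b x → extΣ (x ∷ b ∷ a ∷ []) x (λ _ → 1ℤ)))))
    (loopΣ-[] (λ a → edgeΣ (a ∷ []) (λ b x → extΣ (x ∷ b ∷ a ∷ []) x (λ _ → 1ℤ))) _ (λ {a} a<n Pa →
       trans (edgeΣ-loop a<n Pa _) (trans (∑-upTo-cong n (λ b b<n → trans
         (cong ((1ℤ - fix₁ b) *_) (extΣ-fresh (P b ∷ b ∷ a ∷ []) (λ _ → 1ℤ) (P< b<n))) (inner a<n Pa b<n)))
         (trans (∑-- (upTo n) _ fix₂) (cong (_- F₂) ∑-1)))))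
    where
    lem : ∀ {x y z} → Cycle x y z → (1ℤ - x) * ((1ℤ - x) * ((1ℤ - y) * (1ℤ - 0ℤ)) * 1ℤ) ≡ 1ℤ - y
    lem one   = refl
    lem two   = refl
    lem three = refl
    lem long  = refl
    inner : ∀ {a b} → a < n → P a ≡ a → b < n →
      (1ℤ - fix₁ b) * (avoids (P (P b)) (P b ∷ b ∷ a ∷ []) * 1ℤ) ≡ 1ℤ - fix₂ b
    inner {a} {b} a<n Pa b<n = trans (nonfixed-guard b (λ ne → cong (_* 1ℤ) (begin
      avoids (P (P b)) (P b ∷ b ∷ a ∷ [])
        ≡⟨ avoids-3 (P (P b)) (P b) b a ⟩
      (1ℤ - δ (P (P b)) (P b)) * ((1ℤ - fix₂ b) * (1ℤ - δ (P (P b)) a))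
        ≡⟨ cong₂ (λ u v → (1ℤ - u) * ((1ℤ - fix₂ b) * (1ℤ - v))) (δ-P (P< b<n) b<n) (δ-≢ (λ e → ne (trans (Pb≡a e) (sym (b≡a e))))) ⟩
      (1ℤ - fix₁ b) * ((1ℤ - fix₂ b) * (1ℤ - 0ℤ)) ∎)))
      (lem (cycle b))
      where
      Pb≡a : P (P b) ≡ a → P b ≡ a
      Pb≡a e = injective (P< b<n) a<n (trans e (sym Pa))
      b≡a : P (P b) ≡ a → b ≡ a
      b≡a e = injective b<n a<n (trans (Pb≡a e) (sym Pa))

  copies-c₁ee : copies n π c₁ee ≡ F₁ * EE
  copies-c₁ee = trans
    (step 4 [] (found c₁ee) (λ {a} _ → trans (step 3 (a ∷ []) _ (λ {b} _ → step 2 (b ∷ a ∷ []) _ (λ {x} _ → trans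
       (step 1 (x ∷ b ∷ a ∷ []) _ (λ {c} _ → step 0 (c ∷ x ∷ b ∷ a ∷ []) _ (λ {z} _ →
         trans (rsp a b c a x z) (tail₁ (fix₁ a) (δ (P b) x) (δ (P c) z)))))
       (trans (pull-edge (fix₁ a * δ (P b) x) (x ∷ b ∷ a ∷ []) (λ _ _ → 1ℤ)) (ℤₚ.*-assoc (fix₁ a) (δ (P b) x) _)))))
       (pull-edge (fix₁ a) (a ∷ []) (λ b x → edgeΣ (x ∷ b ∷ a ∷ []) (λ _ _ → 1ℤ)))))
    (loopΣ-[] (λ a → edgeΣ (a ∷ []) (λ b x → edgeΣ (x ∷ b ∷ a ∷ []) (λ _ _ → 1ℤ))) _ (λ {a} a<n Pa →
       trans (edgeΣ-loop a<n Pa _) (trans (∑-upTo-cong n (λ b b<n → nonfixed-guard b (λ ne →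
         edgeΣ-loop-edge a<n b<n Pa ne (λ { refl → ne Pa })))) ∑-edges)))

  copies-c₃ : copies n π c₃ ≡ F₃ - F₁
  copies-c₃ = trans
    (step 2 [] (found c₃) (λ {a} _ → step 1 (a ∷ []) _ (λ {x} _ → trans
       (step 0 (x ∷ a ∷ []) _ (λ {y} _ → rsp a x y x y a)) (pull-ext (δ (P a) x) (x ∷ a ∷ []) x (λ y → δ (P y) a)))))
    (trans (edgeΣ-[] (λ a x → extΣ (x ∷ a ∷ []) x (λ y → δ (P y) a)))
      (trans (∑-upTo-cong n (λ a a<n → begin
        (1ℤ - fix₁ a) * extΣ (P a ∷ a ∷ []) (P a) (λ y → δ (P y) a)
          ≡⟨ cong ((1ℤ - fix₁ a) *_) (trans (extΣ-fresh (P a ∷ a ∷ []) (λ y → δ (P y) a) (P< a<n)) (cong (_* fix₃ a)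
               (trans (avoids-2 (P (P a)) (P a) a) (cong (λ z → (1ℤ - z) * (1ℤ - fix₂ a)) (δ-P (P< a<n) a<n))))) ⟩
        (1ℤ - fix₁ a) * ((1ℤ - fix₁ a) * (1ℤ - fix₂ a) * fix₃ a)
          ≡⟨ lem (cycle a) ⟩
        fix₃ a - fix₁ a ∎))
      (∑-- (upTo n) fix₃ fix₁)))
    where
    lem : ∀ {x y z} → Cycle x y z → (1ℤ - x) * ((1ℤ - x) * (1ℤ - y) * z) ≡ z - x
    lem one   = refl
    lem two   = refl
    lem three = refl
    lem long  = refl

  ∑-c₂e : (∑[ a ∈ upTo n ] ((1ℤ - fix₁ a) * (fix₂ a * (N - F₁ - + 3 + fix₂ a)))) ≡ (F₂ - F₁) * (N - F₁ - + 2)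
  ∑-c₂e = trans (∑-cong (upTo n) (λ {a} _ → lem (N - F₁ - + 3) (cycle a)))
    (trans (∑-*ʳ (upTo n) _ _) (cong₂ _*_ (∑-- (upTo n) fix₂ fix₁) (arith N F₁)))
    where
    lem : ∀ k {x y z} → Cycle x y z → (1ℤ - x) * (y * (k + y)) ≡ (y - x) * (k + 1ℤ)
    lem k one   = trans (ℤₚ.*-zeroˡ (1ℤ * (k + 1ℤ))) (sym (ℤₚ.*-zeroˡ (k + 1ℤ)))
    lem k two   = trans (ℤₚ.*-identityˡ (1ℤ * (k + 1ℤ))) refl
    lem k three = trans (ℤₚ.*-identityˡ (0ℤ * (k + 0ℤ))) (trans (ℤₚ.*-zeroˡ (k + 0ℤ)) (sym (ℤₚ.*-zeroˡ (k + 1ℤ))))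
    lem k long  = trans (ℤₚ.*-identityˡ (0ℤ * (k + 0ℤ))) (trans (ℤₚ.*-zeroˡ (k + 0ℤ)) (sym (ℤₚ.*-zeroˡ (k + 1ℤ))))
    arith : ∀ n f → n - f - + 3 + 1ℤ ≡ n - f - + 2
    arith = solve-∀

  -- The edges disjoint from a 2-cycle are all non-loop edges except its own two.
  copies-c₂e : copies n π c₂e ≡ (F₂ - F₁) * (N - F₁ - + 2)
  copies-c₂e = trans
    (step 3 [] (found c₂e) (λ {a} _ → step 2 (a ∷ []) _ (λ {x} _ → trans
       (step 1 (x ∷ a ∷ []) _ (λ {c} _ → step 0 (c ∷ x ∷ a ∷ []) _ (λ {z} _ →
         trans (rsp a x c x a z) (tail₁ (δ (P a) x) (δ (P x) a) (δ (P c) z)))))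
       (trans (pull-edge (δ (P a) x * δ (P x) a) (x ∷ a ∷ []) (λ _ _ → 1ℤ)) (ℤₚ.*-assoc (δ (P a) x) (δ (P x) a) _)))))
    (trans (edgeΣ-[] (λ a x → δ (P x) a * edgeΣ (x ∷ a ∷ []) (λ _ _ → 1ℤ)))
      (trans (∑-upTo-cong n (λ a a<n → nonfixed-guard a (λ ne → cong (fix₂ a *_) (edgeΣ-edge a<n ne)))) ∑-c₂e))

  -- The summand is the indicator that the cycle of `a` has length at least four, that is, that a
  -- path with three edges starts at `a`.
  ∑-p₃ : (∑[ a ∈ upTo n ] (1ℤ - fix₂ a - fix₃ a + fix₁ a)) ≡ N - F₂ - F₃ + F₁
  ∑-p₃ = trans (∑-+ (upTo n) _ fix₁) (cong (_+ F₁) (trans (∑-- (upTo n) _ fix₃) (cong (_- F₃)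
    (trans (∑-- (upTo n) _ fix₂) (cong (_- F₂) ∑-1)))))

  private
    avoids-path : ∀ {a} → a < n → avoids (P (P a)) (P a ∷ a ∷ []) ≡ (1ℤ - fix₁ a) * (1ℤ - fix₂ a)
    avoids-path {a} a<n = trans (avoids-2 (P (P a)) (P a) a) (cong (λ z → (1ℤ - z) * (1ℤ - fix₂ a)) (δ-P (P< a<n) a<n))

  copies-p₃ : copies n π p₃ ≡ N - F₂ - F₃ + F₁
  copies-p₃ = trans
    (step 3 [] (found p₃) (λ {a} _ → step 2 (a ∷ []) _ (λ {x} _ → trans
       (step 1 (x ∷ a ∷ []) _ (λ {y} _ → trans (step 0 (y ∷ x ∷ a ∷ []) _ (λ {z} _ →
         trans (rsp a x y x y z) (tail₁ (δ (P a) x) (δ (P x) y) (δ (P y) z))))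
         (trans (pull-ext (δ (P a) x * δ (P x) y) (y ∷ x ∷ a ∷ []) y (λ _ → 1ℤ)) (ℤₚ.*-assoc (δ (P a) x) (δ (P x) y) _))))
       (pull-ext (δ (P a) x) (x ∷ a ∷ []) x (λ y → extΣ (y ∷ x ∷ a ∷ []) y (λ _ → 1ℤ))))))
    (trans (edgeΣ-[] (λ a x → extΣ (x ∷ a ∷ []) x (λ y → extΣ (y ∷ x ∷ a ∷ []) y (λ _ → 1ℤ))))
      (trans (∑-upTo-cong n (λ a a<n → trans (cong ((1ℤ - fix₁ a) *_) (begin
        extΣ (P a ∷ a ∷ []) (P a) (λ y → extΣ (y ∷ P a ∷ a ∷ []) y (λ _ → 1ℤ))
          ≡⟨ extΣ-fresh (P a ∷ a ∷ []) (λ y → extΣ (y ∷ P a ∷ a ∷ []) y (λ _ → 1ℤ)) (P< a<n) ⟩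
        avoids (P (P a)) (P a ∷ a ∷ []) * extΣ (P (P a) ∷ P a ∷ a ∷ []) (P (P a)) (λ _ → 1ℤ)
          ≡⟨ cong₂ _*_ (avoids-path a<n) (extΣ-fresh (P (P a) ∷ P a ∷ a ∷ []) (λ _ → 1ℤ) (P< (P< a<n))) ⟩
        (1ℤ - fix₁ a) * (1ℤ - fix₂ a) * (avoids (P (P (P a))) (P (P a) ∷ P a ∷ a ∷ []) * 1ℤ)
          ≡⟨ cong (λ z → (1ℤ - fix₁ a) * (1ℤ - fix₂ a) * (z * 1ℤ)) (trans (avoids-3 (P (P (P a))) (P (P a)) (P a) a)
               (cong₂ (λ u v → (1ℤ - u) * ((1ℤ - v) * (1ℤ - fix₃ a)))
                 (trans (δ-P (P< (P< a<n)) (P< a<n)) (δ-P (P< a<n) a<n)) (δ-P (P< (P< a<n)) a<n))) ⟩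
        (1ℤ - fix₁ a) * (1ℤ - fix₂ a) * ((1ℤ - fix₁ a) * ((1ℤ - fix₂ a) * (1ℤ - fix₃ a)) * 1ℤ) ∎)) (lem (cycle a))))
      ∑-p₃))
    where
    lem : ∀ {x y z} → Cycle x y z →
      (1ℤ - x) * ((1ℤ - x) * (1ℤ - y) * ((1ℤ - x) * ((1ℤ - y) * (1ℤ - z)) * 1ℤ)) ≡ 1ℤ - y - z + x
    lem one   = refl
    lem two   = refl
    lem three = refl
    lem long  = refl

  copies-p₂e : copies n π p₂e ≡ (N - F₂) * (N - F₁ - + 4) + (F₃ - F₁)
  copies-p₂e = trans
    (step 4 [] (found p₂e) (λ {a} _ → step 3 (a ∷ []) _ (λ {x} _ → trans
       (step 2 (x ∷ a ∷ []) _ (λ {y} _ → trans (step 1 (y ∷ x ∷ a ∷ []) _ (λ {c} _ → step 0 (c ∷ y ∷ x ∷ a ∷ []) _ (λ {z} _ →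
         trans (rsp a x c x y z) (tail₁ (δ (P a) x) (δ (P x) y) (δ (P c) z)))))
         (trans (pull-edge (δ (P a) x * δ (P x) y) (y ∷ x ∷ a ∷ []) (λ _ _ → 1ℤ)) (ℤₚ.*-assoc (δ (P a) x) (δ (P x) y) _))))
       (pull-ext (δ (P a) x) (x ∷ a ∷ []) x (λ y → edgeΣ (y ∷ x ∷ a ∷ []) (λ _ _ → 1ℤ))))))
    (trans (edgeΣ-[] (λ a x → extΣ (x ∷ a ∷ []) x (λ y → edgeΣ (y ∷ x ∷ a ∷ []) (λ _ _ → 1ℤ))))
      (trans (∑-upTo-cong n (λ a a<n → nonfixed-guard a (λ ne → begin
        extΣ (P a ∷ a ∷ []) (P a) (λ y → edgeΣ (y ∷ P a ∷ a ∷ []) (λ _ _ → 1ℤ))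
          ≡⟨ extΣ-fresh (P a ∷ a ∷ []) (λ y → edgeΣ (y ∷ P a ∷ a ∷ []) (λ _ _ → 1ℤ)) (P< a<n) ⟩
        avoids (P (P a)) (P a ∷ a ∷ []) * edgeΣ (P (P a) ∷ P a ∷ a ∷ []) (λ _ _ → 1ℤ)
          ≡⟨ avoids-guard (P (P a)) (P a ∷ a ∷ []) (λ { (_ ∷ ne₂ ∷ []) → edgeΣ-path a<n ne ne₂ }) ⟩
        avoids (P (P a)) (P a ∷ a ∷ []) * (N - F₁ - + 4 + fix₃ a)
          ≡⟨ cong (_* (N - F₁ - + 4 + fix₃ a)) (avoids-path a<n) ⟩
        (1ℤ - fix₁ a) * (1ℤ - fix₂ a) * (N - F₁ - + 4 + fix₃ a) ∎)))
      -- In the four cases of `Cycle` the summand is 0, 0, K + 1, K; this determines the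
      -- coefficients K, -1, -K, 1.
      (trans (∑-nonfixed _ K (- 1ℤ) (- K) 1ℤ (λ a → lem K (cycle a))) (arith N F₁ F₂ F₃))))
    where
    K = N - F₁ - + 4
    lem : ∀ k {x y z} → Cycle x y z → (1ℤ - x) * ((1ℤ - x) * (1ℤ - y) * (k + z)) ≡ k + - 1ℤ * x + - k * y + 1ℤ * z
    lem k one   = l k where
      l : ∀ k → 0ℤ * (0ℤ * (k + 1ℤ)) ≡ k + - 1ℤ * 1ℤ + - k * 1ℤ + 1ℤ * 1ℤ
      l = solve-∀
    lem k two   = l k where
      l : ∀ k → 1ℤ * (0ℤ * (k + 0ℤ)) ≡ k + - 1ℤ * 0ℤ + - k * 1ℤ + 1ℤ * 0ℤ
      l = solve-∀
    lem k three = l k where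
      l : ∀ k → 1ℤ * (1ℤ * (k + 1ℤ)) ≡ k + - 1ℤ * 0ℤ + - k * 0ℤ + 1ℤ * 1ℤ
      l = solve-∀
    lem k long  = l k where
      l : ∀ k → 1ℤ * (1ℤ * (k + 0ℤ)) ≡ k + - 1ℤ * 0ℤ + - k * 0ℤ + 1ℤ * 0ℤ
      l = solve-∀
    arith : ∀ n f g h → (n - f - + 4) * n + - 1ℤ * f + - (n - f - + 4) * g + 1ℤ * h ≡ (n - g) * (n - f - + 4) + (h - f)
    arith = solve-∀

  -- K a b = 1 when a → P a and b → P b are disjoint edges.
  private
    K : ℕ → ℕ → ℤ
    K a b = (1ℤ - fix₁ a) * (avoids b (P a ∷ a ∷ []) * avoids (P b) (b ∷ P a ∷ a ∷ []))

    K-expand : ∀ {a b} → a < n → b < n → K a b ≡ (1ℤ - fix₁ a) *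
      ((1ℤ - δ (P a) b) * (1ℤ - δ a b) * ((1ℤ - fix₁ b) * ((1ℤ - δ a b) * (1ℤ - δ (P b) a))))
    K-expand {a} {b} a<n b<n = cong ((1ℤ - fix₁ a) *_) (cong₂ _*_
      (trans (avoids-2 b (P a) a) (cong₂ (λ u v → (1ℤ - u) * (1ℤ - v)) (δ-sym b (P a)) (δ-sym b a)))
      (trans (avoids-3 (P b) b (P a) a) (cong (λ u → (1ℤ - fix₁ b) * ((1ℤ - u) * (1ℤ - δ (P b) a)))
        (trans (δ-P b<n a<n) (δ-sym b a)))))

    -- The corrections in `edgeΣ-edge-edge` come in mirrored pairs; exchanging the two edges leaves
    -- one sum of each pair to evaluate.
    K-sym : ∀ {a b} → a < n → b < n → K a b ≡ K b a
    K-sym {a} {b} a<n b<n = trans (K-expand a<n b<n) (trans (trans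
      (comm (fix₁ a) (δ (P a) b) (δ a b) (fix₁ b) (δ (P b) a))
      (cong (λ z → (1ℤ - fix₁ b) * ((1ℤ - δ (P b) a) * (1ℤ - z) * ((1ℤ - fix₁ a) * ((1ℤ - z) * (1ℤ - δ (P a) b))))) (δ-sym a b)))
      (sym (K-expand b<n a<n)))
      where
      comm : ∀ a x d b y → (1ℤ - a) * ((1ℤ - x) * (1ℤ - d) * ((1ℤ - b) * ((1ℤ - d) * (1ℤ - y)))) ≡
        (1ℤ - b) * ((1ℤ - y) * (1ℤ - d) * ((1ℤ - a) * ((1ℤ - d) * (1ℤ - x))))
      comm = solve-∀

    KΣ : (ℕ → ℕ → ℤ) → ℤ
    KΣ h = ∑[ a ∈ upTo n ] ∑[ b ∈ upTo n ] (K a b * h a b)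

    KΣ-flip : ∀ h → KΣ (λ a b → h b a) ≡ KΣ h
    KΣ-flip h = trans (∑-swap (upTo n) (upTo n) _) (∑-upTo-cong n (λ b b<n → ∑-upTo-cong n (λ a a<n → cong (_* h b a) (K-sym a<n b<n))))

    KΣ-edgeΣ : ∀ h → edgeΣ [] (λ a x → edgeΣ (x ∷ a ∷ []) (λ b y → h a b)) ≡ KΣ h
    KΣ-edgeΣ h = trans (edgeΣ-[] (λ a x → edgeΣ (x ∷ a ∷ []) (λ b y → h a b))) (∑-cong (upTo n) (λ {a} _ → begin
      (1ℤ - fix₁ a) * edgeΣ (P a ∷ a ∷ []) (λ b y → h a b)
        ≡⟨ cong ((1ℤ - fix₁ a) *_) (trans (edgeΣ-fresh (P a ∷ a ∷ []) (λ b y → h a b)) (∑-filterB _ (upTo n) _)) ⟩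
      (1ℤ - fix₁ a) * (∑[ b ∈ upTo n ] (avoids b (P a ∷ a ∷ []) * (avoids (P b) (b ∷ P a ∷ a ∷ []) * h a b)))
        ≡⟨ sym (∑-*ˡ (upTo n) (1ℤ - fix₁ a) _) ⟩
      (∑[ b ∈ upTo n ] ((1ℤ - fix₁ a) * (avoids b (P a ∷ a ∷ []) * (avoids (P b) (b ∷ P a ∷ a ∷ []) * h a b))))
        ≡⟨ ∑-cong (upTo n) (λ {b} _ → assoc (1ℤ - fix₁ a) (avoids b (P a ∷ a ∷ [])) (avoids (P b) (b ∷ P a ∷ a ∷ [])) (h a b)) ⟩
      (∑[ b ∈ upTo n ] (K a b * h a b)) ∎))
      where
      assoc : ∀ a b c d → a * (b * (c * d)) ≡ (a * (b * c)) * d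
      assoc = solve-∀

    KΣ-first : ∀ (h : ℕ → ℤ) → KΣ (λ a _ → h a) ≡ (∑[ a ∈ upTo n ] ((1ℤ - fix₁ a) * (h a * (N - F₁ - + 3 + fix₂ a))))
    KΣ-first h = trans (sym (KΣ-edgeΣ (λ a _ → h a))) (trans (edgeΣ-[] (λ a x → edgeΣ (x ∷ a ∷ []) (λ _ _ → h a)))
      (∑-upTo-cong n (λ a a<n → nonfixed-guard a (λ ne → trans (scale a) (cong (h a *_) (edgeΣ-edge a<n ne))))))
      where
      comm : ∀ d c → d * c ≡ c * (d * 1ℤ)
      comm = solve-∀
      scale : ∀ a → edgeΣ (P a ∷ a ∷ []) (λ _ _ → h a) ≡ h a * edgeΣ (P a ∷ a ∷ []) (λ _ _ → 1ℤ)
      scale a = trans (∑-cong (fresh n (P a ∷ a ∷ [])) (λ {b} _ → ∑-cong (fresh n (b ∷ P a ∷ a ∷ [])) (λ {y} _ → comm (δ (P b) y) (h a))))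
        (pull-edge (h a) (P a ∷ a ∷ []) (λ _ _ → 1ℤ))

    KΣ-1 : KΣ (λ _ _ → 1ℤ) ≡ EE
    KΣ-1 = trans (KΣ-first (λ _ → 1ℤ)) (trans (∑-cong (upTo n) (λ {a} _ → cong ((1ℤ - fix₁ a) *_) (ℤₚ.*-identityˡ _))) ∑-edges)

    KΣ-2 : KΣ (λ a _ → fix₂ a) ≡ (F₂ - F₁) * (N - F₁ - + 2)
    KΣ-2 = trans (KΣ-first fix₂) ∑-c₂e

    -- The second edge starts where the path a → P a → P (P a) ends, so these pairs are the first
    -- and last edges of the paths with three edges.
    KΣ-3 : KΣ (λ a b → δ (P (P a)) b) ≡ N - F₂ - F₃ + F₁
    KΣ-3 = trans (∑-upTo-cong n (λ a a<n → begin
      (∑[ b ∈ upTo n ] (K a b * δ (P (P a)) b))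
        ≡⟨ ∑-cong (upTo n) (λ {b} _ → ℤₚ.*-comm (K a b) (δ (P (P a)) b)) ⟩
      (∑[ b ∈ upTo n ] (δ (P (P a)) b * K a b))
        ≡⟨ ∑-δ-< (K a) (P< (P< a<n)) ⟩
      K a (P (P a))
        ≡⟨ K-expand a<n (P< (P< a<n)) ⟩
      (1ℤ - fix₁ a) * ((1ℤ - δ (P a) (P (P a))) * (1ℤ - δ a (P (P a))) *
        ((1ℤ - fix₁ (P (P a))) * ((1ℤ - δ a (P (P a))) * (1ℤ - fix₃ a))))
        ≡⟨ same (fix₃ a) (trans (δ-sym (P a) (P (P a))) (δ-P (P< a<n) a<n)) (δ-sym a (P (P a)))
             (trans (δ-P (P< (P< a<n)) (P< a<n)) (δ-P (P< a<n) a<n)) ⟩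
      (1ℤ - fix₁ a) * ((1ℤ - fix₁ a) * (1ℤ - fix₂ a) * ((1ℤ - fix₁ a) * ((1ℤ - fix₂ a) * (1ℤ - fix₃ a))))
        ≡⟨ lem (cycle a) ⟩
      1ℤ - fix₂ a - fix₃ a + fix₁ a ∎)) ∑-p₃
      where
      same : ∀ h {f g u v w} → u ≡ f → v ≡ g → w ≡ f →
        (1ℤ - f) * ((1ℤ - u) * (1ℤ - v) * ((1ℤ - w) * ((1ℤ - v) * (1ℤ - h)))) ≡
        (1ℤ - f) * ((1ℤ - f) * (1ℤ - g) * ((1ℤ - f) * ((1ℤ - g) * (1ℤ - h))))
      same h refl refl refl = refl
      lem : ∀ {x y z} → Cycle x y z →
        (1ℤ - x) * ((1ℤ - x) * (1ℤ - y) * ((1ℤ - x) * ((1ℤ - y) * (1ℤ - z)))) ≡ 1ℤ - y - z + x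
      lem one   = refl
      lem two   = refl
      lem three = refl
      lem long  = refl

  -- The third edge is counted by `edgeΣ-edge-edge`, whose terms are summed over the ordered pairs
  -- of disjoint edges. The mirrored corrections account for the two factors 2.
  copies-eee : copies n π eee ≡ (N - F₁ - + 6) * EE + + 2 * ((F₂ - F₁) * (N - F₁ - + 2)) + + 2 * (N - F₂ - F₃ + F₁)
  copies-eee = begin
    copies n π eee
      ≡⟨ step 5 [] (found eee) (λ {a} _ → step 4 (a ∷ []) _ (λ {x} _ → trans
           (step 3 (x ∷ a ∷ []) _ (λ {b} _ → step 2 (b ∷ x ∷ a ∷ []) _ (λ {y} _ → trans
             (step 1 (y ∷ b ∷ x ∷ a ∷ []) _ (λ {c} _ → step 0 (c ∷ y ∷ b ∷ x ∷ a ∷ []) _ (λ {z} _ →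
               trans (rsp a b c x y z) (tail₁ (δ (P a) x) (δ (P b) y) (δ (P c) z)))))
             (trans (pull-edge (δ (P a) x * δ (P b) y) (y ∷ b ∷ x ∷ a ∷ []) (λ _ _ → 1ℤ)) (ℤₚ.*-assoc (δ (P a) x) (δ (P b) y) _)))))
           (pull-edge (δ (P a) x) (x ∷ a ∷ []) (λ b y → edgeΣ (y ∷ b ∷ x ∷ a ∷ []) (λ _ _ → 1ℤ))))) ⟩
    edgeΣ [] (λ a x → edgeΣ (x ∷ a ∷ []) (λ b y → edgeΣ (y ∷ b ∷ x ∷ a ∷ []) (λ _ _ → 1ℤ)))
      ≡⟨ trans (edgeΣ-[] _) (trans (∑-upTo-cong n (λ a a<n → nonfixed-guard a (λ ne → trans (edgeΣ-fresh (P a ∷ a ∷ []) _)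
           (trans (∑-cong (fresh n (P a ∷ a ∷ [])) (λ {b} b∈ → let b<n , b∉ = ∈-fresh⁻ (P a ∷ a ∷ []) b∈ in
             avoids-guard (P b) (b ∷ P a ∷ a ∷ []) (λ Pb∉ → edgeΣ-edge-edge a<n b<n ne b∉ Pb∉)))
             (sym (edgeΣ-fresh (P a ∷ a ∷ []) (λ b y → X a b))))))) (sym (edgeΣ-[] (λ a x → edgeΣ (x ∷ a ∷ []) (λ b y → X a b))))) ⟩
    edgeΣ [] (λ a x → edgeΣ (x ∷ a ∷ []) (λ b y → X a b))
      ≡⟨ KΣ-edgeΣ X ⟩
    KΣ X
      ≡⟨ trans (∑-cong (upTo n) (λ {a} _ → trans (∑-cong (upTo n) (λ {b} _ →
           distr (K a b) (N - F₁ - + 6) (fix₂ a) (fix₂ b) (δ (P (P a)) b) (δ (P (P b)) a)))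
           (sums₅ (upTo n) _ _ _ _ _))) (sums₅ (upTo n) _ _ _ _ _) ⟩
    (∑[ a ∈ upTo n ] ∑[ b ∈ upTo n ] ((N - F₁ - + 6) * (K a b * 1ℤ))) + KΣ (λ a b → fix₂ a) + KΣ (λ a b → fix₂ b) +
      KΣ (λ a b → δ (P (P a)) b) + KΣ (λ a b → δ (P (P b)) a)
      ≡⟨ cong₂ _+_ (cong₂ _+_ (cong₂ _+_ (cong₂ _+_
           (trans (trans (∑-cong (upTo n) (λ _ → ∑-*ˡ (upTo n) (N - F₁ - + 6) _)) (∑-*ˡ (upTo n) (N - F₁ - + 6) _)) (cong ((N - F₁ - + 6) *_) KΣ-1))
           KΣ-2) (trans (KΣ-flip (λ a b → fix₂ a)) KΣ-2)) KΣ-3) (trans (KΣ-flip (λ a b → δ (P (P a)) b)) KΣ-3) ⟩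
    (N - F₁ - + 6) * EE + (F₂ - F₁) * (N - F₁ - + 2) + (F₂ - F₁) * (N - F₁ - + 2) + (N - F₂ - F₃ + F₁) + (N - F₂ - F₃ + F₁)
      ≡⟨ collect ((N - F₁ - + 6) * EE) ((F₂ - F₁) * (N - F₁ - + 2)) (N - F₂ - F₃ + F₁) ⟩
    (N - F₁ - + 6) * EE + + 2 * ((F₂ - F₁) * (N - F₁ - + 2)) + + 2 * (N - F₂ - F₃ + F₁) ∎
    where
    X : ℕ → ℕ → ℤ
    X a b = N - F₁ - + 6 + fix₂ a + fix₂ b + δ (P (P a)) b + δ (P (P b)) a
    distr : ∀ k m s t u v → k * (m + s + t + u + v) ≡ m * (k * 1ℤ) + k * s + k * t + k * u + k * v
    distr = solve-∀
    collect : ∀ x y z → x + y + y + z + z ≡ x + + 2 * y + + 2 * z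
    collect = solve-∀
    sums₅ : ∀ (xs : List ℕ) (f g h i j : ℕ → ℤ) → (∑[ x ∈ xs ] (f x + g x + h x + i x + j x)) ≡ ∑ xs f + ∑ xs g + ∑ xs h + ∑ xs i + ∑ xs j
    sums₅ xs f g h i j = trans (∑-+ xs _ j) (cong (_+ ∑ xs j) (trans (∑-+ xs _ i) (cong (_+ ∑ xs i)
      (trans (∑-+ xs _ h) (cong (_+ ∑ xs h) (∑-+ xs f g))))))

-- From the cycle type to the numbers of fixed points

∑-downFrom : ∀ n (f : ℕ → ℤ) → ∑ (downFrom n) f ≡ ∑ (upTo n) f
∑-downFrom zero    f = refl
∑-downFrom (suc n) f = trans (cong (_+_ (f n)) (∑-downFrom n f))
  (trans (ℤₚ.+-comm (f n) _) (sym (∑-upTo-suc n f)))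

∑-replicate : ∀ {A : Set} m (x : A) f → ∑ (replicate m x) f ≡ + m * f x
∑-replicate m x f = trans (∑-cong (replicate m x) (λ y∈ → cong f (replicate⁻ m y∈)))
  (trans (∑-const (replicate m x) (f x)) (cong (λ l → + l * f x) (Listₚ.length-replicate m)))
  where
  replicate⁻ : ∀ m {x y} → y ∈ replicate m x → y ≡ x
  replicate⁻ (suc m) (here e)   = e
  replicate⁻ (suc m) (there y∈) = replicate⁻ m y∈

-- `cycleType` with the numbers of cycles abstracted: `cycleType π` unfolds to this at `length π`
-- and `cyclesOfLen π`.
fromMultiplicities : ℕ → (ℕ → ℕ) → List ℕ
fromMultiplicities n c = concatMap (λ k → replicate (c k) (suc k)) (downFrom n)

∑-fromMultiplicities : ∀ n c f → ∑ (fromMultiplicities n c) f ≡ (∑[ k ∈ upTo n ] (+ c k * f (suc k)))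
∑-fromMultiplicities n c f = trans (∑-concatMap _ (downFrom n) f)
  (trans (∑-cong (downFrom n) (λ {k} _ → ∑-replicate (c k) (suc k) f)) (∑-downFrom n _))

countB-fromMultiplicities : ∀ n c {k} → k < n → countB (_≡ᵇ suc k) (fromMultiplicities n c) ≡ c k
countB-fromMultiplicities n c {k} k<n = ℤₚ.+-injective (begin
  + countB (_≡ᵇ suc k) (fromMultiplicities n c)
    ≡⟨ ∑-countB _ (fromMultiplicities n c) ⟩
  (∑[ x ∈ fromMultiplicities n c ] 𝟙 (x ≡ᵇ suc k))
    ≡⟨ ∑-fromMultiplicities n c _ ⟩
  (∑[ j ∈ upTo n ] (+ c j * 𝟙 (j ≡ᵇ k)))
    ≡⟨ ∑-cong (upTo n) (λ {j} _ → trans (ℤₚ.*-comm (+ c j) _) (cong (λ b → 𝟙 b * + c j) (≡ᵇ-sym j k))) ⟩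
  (∑[ j ∈ upTo n ] (𝟙 (k ≡ᵇ j) * + c j))
    ≡⟨ ∑-δ-< (λ j → + c j) k<n ⟩
  + c k ∎)
  where open ≡-Reasoning

∑-id : ∀ xs → (∑[ x ∈ xs ] (+ x)) ≡ + sum xs
∑-id []       = refl
∑-id (x ∷ xs) = trans (cong (_+_ (+ x)) (∑-id xs)) (sym (ℤₚ.pos-+ x (sum xs)))

∑-mono : ∀ {A : Set} (xs : List A) {f g : A → ℤ} → (∀ {x} → x ∈ xs → f x ≤ℤ g x) → ∑ xs f ≤ℤ ∑ xs g
∑-mono []       h = ℤₚ.≤-refl
∑-mono (x ∷ xs) h = ℤₚ.+-mono-≤ (h (here refl)) (∑-mono xs (h ∘ there))

+-cancelʳ-≤ : ∀ k {i j} → i + k ≤ℤ j + k → i ≤ℤ j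
+-cancelʳ-≤ k {i} {j} le = subst₂ _≤ℤ_ (lem i k) (lem j k) (ℤₚ.+-monoˡ-≤ (- k) le)
  where
  lem : ∀ i k → i + k + - k ≡ i
  lem = solve-∀

-- Meant for rounding errors: if no term exceeds its bound and the totals leave no slack, every term
-- attains its bound.
∑-squeeze : ∀ {A : Set} (xs : List A) {f g : A → ℤ} → (∀ {x} → x ∈ xs → f x ≤ℤ g x) → ∑ xs g ≤ℤ ∑ xs f →
  ∀ {x} → x ∈ xs → f x ≡ g x
∑-squeeze (y ∷ xs) {f} {g} h le x∈ = pick x∈
  where
  fy≤gy = h (here refl)
  rest≤ = ∑-mono xs (h ∘ there)
  gy≤fy : g y ≤ℤ f y
  gy≤fy = +-cancelʳ-≤ (∑ xs f) (ℤₚ.≤-trans (ℤₚ.+-monoʳ-≤ (g y) rest≤) le)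
  rest≥ : ∑ xs g ≤ℤ ∑ xs f
  rest≥ = +-cancelʳ-≤ (f y) (subst₂ _≤ℤ_ (ℤₚ.+-comm (f y) (∑ xs g)) (ℤₚ.+-comm (f y) (∑ xs f)) (ℤₚ.≤-trans (ℤₚ.+-monoˡ-≤ (∑ xs g) fy≤gy) le))
  pick : ∀ {x} → x ∈ y ∷ xs → f x ≡ g x
  pick (here refl) = ℤₚ.≤-antisym fy≤gy gy≤fy
  pick (there x∈)  = ∑-squeeze xs (h ∘ there) rest≥ x∈

cyclePoints : List ℕ → ℕ → ℕ
cyclePoints π k = countB (λ i → cycleLen π i ≡ᵇ suc k) (upTo (length π))

-- The roundings down in cyclesOfLen are exact because ps adds up to n.
cyclePoints-mult : ∀ {n ps π} → sum ps ≡ n → length π ≡ n → cycleType π ≡ ps → ∀ {k} → k < n →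
  + cyclePoints π k ≡ + countB (_≡ᵇ suc k) ps * + suc k
cyclePoints-mult {π = π} total refl refl {k} k<n = begin
  + cyclePoints π k                                       ≡⟨ sym (∑-squeeze (upTo n) below above (∈-upTo⁺ k<n)) ⟩
  + (cyclesOfLen π k) * + suc k                           ≡⟨ cong (λ c → + c * + suc k) (sym (countB-fromMultiplicities n (cyclesOfLen π) k<n)) ⟩
  + countB (_≡ᵇ suc k) (cycleType π) * + suc k            ∎
  where
  open ≡-Reasoning
  n = length π
  below : ∀ {j} → j ∈ upTo n → + (cyclesOfLen π j) * + suc j ≤ℤ + cyclePoints π j
  below {j} _ = subst (_≤ℤ + cyclePoints π j) (ℤₚ.pos-* (cyclesOfLen π j) (suc j)) (+≤+ (ℕD.m/n*n≤m (cyclePoints π j) (suc j)))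
  at-most-one : ∀ u → (∑[ j ∈ upTo n ] 𝟙 (u ≡ᵇ suc j)) ≤ℤ 1ℤ
  at-most-one zero    = subst (_≤ℤ 1ℤ) (sym (∑-zero (upTo n) (λ _ → refl))) (+≤+ z≤n)
  at-most-one (suc v) = subst (_≤ℤ 1ℤ) (sym (trans (∑-cong (upTo n) (λ _ → sym (ℤₚ.*-identityʳ _))) (trans (∑-δ n v (λ _ → 1ℤ)) (ℤₚ.*-identityʳ _))))
    (𝟙≤1 (v <ᵇ n))
    where
    𝟙≤1 : ∀ b → 𝟙 b ≤ℤ 1ℤ
    𝟙≤1 true  = ℤₚ.≤-refl
    𝟙≤1 false = +≤+ z≤n
  -- Every point has a single cycle length, so at most `n` points are counted; and `n` is the sum of
  -- the parts, which is the sum of the rounded numbers of cycles times their lengths.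
  above : (∑[ j ∈ upTo n ] (+ cyclePoints π j)) ≤ℤ (∑[ j ∈ upTo n ] (+ (cyclesOfLen π j) * + suc j))
  above = subst₂ _≤ℤ_
    (sym (trans (∑-cong (upTo n) (λ {j} _ → ∑-countB (λ i → cycleLen π i ≡ᵇ suc j) (upTo n))) (∑-swap (upTo n) (upTo n) _)))
    (trans (∑-length (upTo n)) (trans (cong +_ (trans (Listₚ.length-upTo n) (sym total)))
      (trans (sym (∑-id (cycleType π))) (∑-fromMultiplicities n (cyclesOfLen π) (λ x → + x)))))
    (∑-mono (upTo n) (λ {i} _ → at-most-one (cycleLen π i)))

orbitSearch-≥ : ∀ π i k f → k ≤ orbitSearch π i k f
orbitSearch-≥ π i k zero = ℕₚ.≤-refl
orbitSearch-≥ π i k (suc f) with iter π k i ≡ᵇ i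
... | true  = ℕₚ.≤-refl
... | false = ℕₚ.≤-trans (ℕₚ.n≤1+n k) (orbitSearch-≥ π i (suc k) f)

module _ {n ps π} (w : IsWord n π) (injective : Injective n π) (3≤n : 3 ≤ n) (total : sum ps ≡ n) (type : cycleType π ≡ ps) where
  open Copies n π w injective
  open IsWord w
  open ≡-Reasoning

  private
    -- As n is at least 3, the search tests π, π² and π³ at `i` before anything else; if all three
    -- fail, its result is at least 4.
    short-cycles : ∀ i → 𝟙 (cycleLen π i ≡ᵇ 1) ≡ fix₁ i × 𝟙 (cycleLen π i ≡ᵇ 2) ≡ fix₂ i - fix₁ i × 𝟙 (cycleLen π i ≡ᵇ 3) ≡ fix₃ i - fix₁ i
    short-cycles i rewrite len with m , refl ← ℕₚ.m≤n⇒∃[o]m+o≡n 3≤n = go (cycle i)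
      where
      rest = orbitSearch π i 4 m
      large : 4 ≤ rest
      large = orbitSearch-≥ π i 4 m
      not-small : ∀ k → k < 4 → (rest ≡ᵇ k) ≡ false
      not-small k k<4 = ≡ᵇ-false (≢-sym (ℕₚ.<⇒≢ (ℕₚ.<-≤-trans k<4 large)))
      by-cases : ∀ a b c → Cycle (𝟙 a) (𝟙 b) (𝟙 c) → let l = if a then 1 else (if b then 2 else (if c then 3 else rest)) in
        𝟙 (l ≡ᵇ 1) ≡ 𝟙 a × 𝟙 (l ≡ᵇ 2) ≡ 𝟙 b - 𝟙 a × 𝟙 (l ≡ᵇ 3) ≡ 𝟙 c - 𝟙 a
      by-cases true  true  true  _ = refl , refl , refl
      by-cases false true  false _ = refl , refl , refl
      by-cases false false true  _ = refl , refl , refl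
      by-cases false false false _ rewrite not-small 1 (s≤s (s≤s z≤n)) | not-small 2 (s≤s (s≤s (s≤s z≤n))) | not-small 3 ℕₚ.≤-refl = refl , refl , refl
      go : Cycle (fix₁ i) (fix₂ i) (fix₃ i) → _
      go = by-cases (P i ≡ᵇ i) (P (P i) ≡ᵇ i) (P (P (P i)) ≡ᵇ i)

    points : ∀ k → k < n → (∑[ i ∈ upTo n ] 𝟙 (cycleLen π i ≡ᵇ suc k)) ≡ + countB (_≡ᵇ suc k) ps * + suc k
    points k k<n = trans (cong (λ m → ∑[ i ∈ upTo m ] 𝟙 (cycleLen π i ≡ᵇ suc k)) (sym len))
      (trans (sym (∑-countB _ (upTo (length π)))) (cyclePoints-mult {ps = ps} {π} total len type k<n))

  F₁-mult : F₁ ≡ + countB (_≡ᵇ 1) ps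
  F₁-mult = trans (∑-cong (upTo n) (λ {i} _ → sym (proj₁ (short-cycles i))))
    (trans (points 0 (ℕₚ.≤-trans (s≤s z≤n) 3≤n)) (ℤₚ.*-identityʳ _))

  F₂-mult : F₂ - F₁ ≡ + countB (_≡ᵇ 2) ps * + 2
  F₂-mult = trans (sym (∑-- (upTo n) fix₂ fix₁)) (trans (∑-cong (upTo n) (λ {i} _ → sym (proj₁ (proj₂ (short-cycles i)))))
    (points 1 (ℕₚ.≤-trans (s≤s (s≤s z≤n)) 3≤n)))

  F₃-mult : F₃ - F₁ ≡ + countB (_≡ᵇ 3) ps * + 3
  F₃-mult = trans (sym (∑-- (upTo n) fix₃ fix₁)) (trans (∑-cong (upTo n) (λ {i} _ → sym (proj₂ (proj₂ (short-cycles i)))))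
    (points 2 3≤n))

-- A permutation of every cycle type

∑-upTo-+ : ∀ m k (f : ℕ → ℤ) → ∑ (upTo (m ℕ.+ k)) f ≡ ∑ (upTo m) f + (∑[ j ∈ upTo k ] f (m ℕ.+ j))
∑-upTo-+ m zero    f rewrite ℕₚ.+-identityʳ m = sym (ℤₚ.+-identityʳ _)
∑-upTo-+ m (suc k) f rewrite ℕₚ.+-suc m k = begin
  ∑ (upTo (suc (m ℕ.+ k))) f                                            ≡⟨ ∑-upTo-suc (m ℕ.+ k) f ⟩
  ∑ (upTo (m ℕ.+ k)) f + f (m ℕ.+ k)                                    ≡⟨ cong (_+ f (m ℕ.+ k)) (∑-upTo-+ m k f) ⟩
  ∑ (upTo m) f + (∑[ j ∈ upTo k ] f (m ℕ.+ j)) + f (m ℕ.+ k)            ≡⟨ ℤₚ.+-assoc (∑ (upTo m) f) _ _ ⟩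
  ∑ (upTo m) f + ((∑[ j ∈ upTo k ] f (m ℕ.+ j)) + f (m ℕ.+ k))          ≡⟨ cong (_+_ (∑ (upTo m) f)) (sym (∑-upTo-suc k (λ j → f (m ℕ.+ j)))) ⟩
  ∑ (upTo m) f + (∑[ j ∈ upTo (suc k) ] f (m ℕ.+ j))                    ∎
  where open ≡-Reasoning

app-++ˡ : ∀ xs ys {i} → i < length xs → app (xs ++ ys) i ≡ app xs i
app-++ˡ (x ∷ xs) ys {zero}  p       = refl
app-++ˡ (x ∷ xs) ys {suc i} (s≤s p) = app-++ˡ xs ys p

app-++ʳ : ∀ xs ys j → app (xs ++ ys) (length xs ℕ.+ j) ≡ app ys j
app-++ʳ []       ys j = refl
app-++ʳ (x ∷ xs) ys j = app-++ʳ xs ys j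

orbitSearch-first : ∀ {π i} f k K → (∀ j → k ≤ j → j < K → iter π j i ≢ i) → iter π K i ≡ i → k ≤ K → K ≤ k ℕ.+ f →
  orbitSearch π i k f ≡ K
-- Out of fuel the search returns `k`, and the bounds then force `k` to be `K`.
orbitSearch-first zero    k K before at k≤K K≤ = ℕₚ.≤-antisym k≤K (subst (K ≤_) (ℕₚ.+-identityʳ k) K≤)
orbitSearch-first {π} {i} (suc f) k K before at k≤K K≤ with iter π k i ≡ᵇ i in eq
... | true  with ℕₚ.m≤n⇒m<n∨m≡n k≤K
...   | inj₁ k<K = ⊥-elim (before k ℕₚ.≤-refl k<K (≡ᵇ-true⁻¹ eq))
...   | inj₂ k≡K = k≡K
orbitSearch-first {π} {i} (suc f) k K before at k≤K K≤ | false =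
  orbitSearch-first f (suc k) K (λ j k<j → before j (ℕₚ.<⇒≤ k<j)) at (ℕₚ.≤∧≢⇒< k≤K k≢K) (subst (K ≤_) (ℕₚ.+-suc k f) K≤)
  where
  k≢K : k ≢ K
  k≢K refl = ≡ᵇ-false⁻¹ eq at

-- The cycle m → m + 1 → ⋯ → m + l → m, as the values at m, …, m + l.
cycleWord : ℕ → ℕ → List ℕ
cycleWord m l = map (λ j → suc (m ℕ.+ j)) (upTo l) ++ m ∷ []

private
  length-shift : ∀ m l → length (map (λ j → suc (m ℕ.+ j)) (upTo l)) ≡ l
  length-shift m l = trans (Listₚ.length-map _ (upTo l)) (Listₚ.length-upTo l)

length-cycleWord : ∀ m l → length (cycleWord m l) ≡ suc l
length-cycleWord m l = trans (Listₚ.length-++ (map (λ j → suc (m ℕ.+ j)) (upTo l)))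
  (trans (cong (ℕ._+ 1) (length-shift m l)) (ℕₚ.+-comm l 1))

app-cycleWord : ∀ m l {j} → j < l → app (cycleWord m l) j ≡ suc (m ℕ.+ j)
app-cycleWord m l {j} j<l = trans (app-++ˡ (map (λ j → suc (m ℕ.+ j)) (upTo l)) (m ∷ []) (subst (j <_) (sym (length-shift m l)) j<l))
  (trans (app-map (λ j → suc (m ℕ.+ j)) (upTo l) (subst (j <_) (sym (Listₚ.length-upTo l)) j<l)) (cong (λ z → suc (m ℕ.+ z)) (app-upTo j<l)))

app-cycleWord-end : ∀ m l → app (cycleWord m l) l ≡ m
app-cycleWord-end m l = trans (cong (app (cycleWord m l)) (sym (trans (ℕₚ.+-identityʳ _) (length-shift m l))))
  (app-++ʳ (map (λ j → suc (m ℕ.+ j)) (upTo l)) (m ∷ []) 0)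

cycleWord-range : ∀ m l → All (λ x → m ≤ x × x < m ℕ.+ suc l) (cycleWord m l)
cycleWord-range m l = Allₚ.++⁺ (Allₚ.map⁺ (All.tabulate (λ {j} j∈ →
    ℕₚ.m≤n⇒m≤1+n (ℕₚ.m≤m+n m j) , subst (suc (m ℕ.+ j) <_) (sym (ℕₚ.+-suc m l)) (s≤s (ℕₚ.+-monoʳ-< m (∈-upTo⁻ j∈))))))
  ((ℕₚ.≤-refl , ℕₚ.m<m+n m (s≤s z≤n)) ∷ [])

cycleWord-Unique : ∀ m l → Unique (cycleWord m l)
cycleWord-Unique m l = Uniqueₚ.++⁺ (Uniqueₚ.map⁺ (λ e → ℕₚ.+-cancelˡ-≡ m _ _ (ℕₚ.suc-injective e)) (Uniqueₚ.upTo⁺ l))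
  ([] ∷ []) disjoint
  where
  disjoint : ∀ {x} → ¬ (x ∈ map (λ j → suc (m ℕ.+ j)) (upTo l) × x ∈ m ∷ [])
  disjoint (x∈ , here refl) with j , _ , e ← ∈-map⁻ (λ j → suc (m ℕ.+ j)) x∈ = ℕₚ.m≢1+m+n m e

-- The cycle of the head is placed on new points above the permutation of the tail, so the orbits
-- already built are left untouched.
cycles : List ℕ → List ℕ
cycles []           = []
cycles (zero  ∷ ls) = cycles ls
cycles (suc l ∷ ls) = cycles ls ++ cycleWord (length (cycles ls)) l

length-cycles : ∀ ls → length (cycles ls) ≡ sum ls
length-cycles []           = refl
length-cycles (zero ∷ ls)  = length-cycles ls
length-cycles (suc l ∷ ls) = trans (Listₚ.length-++ (cycles ls))
  (trans (cong₂ ℕ._+_ (length-cycles ls) (length-cycleWord _ l)) (ℕₚ.+-comm (sum ls) (suc l)))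

cycles-Labelling : ∀ ls → Labelling (length (cycles ls)) (cycles ls)
cycles-Labelling []           = [] , []
cycles-Labelling (zero ∷ ls)  = cycles-Labelling ls
cycles-Labelling (suc l ∷ ls) with b , u ← cycles-Labelling ls =
  Allₚ.++⁺ (All.map (λ x< → ℕₚ.<-≤-trans x< (subst (m ≤_) (sym len) (ℕₚ.m≤m+n m (suc l)))) b)
           (All.map (λ { (_ , x<) → subst (_ <_) (sym len) x< }) (cycleWord-range m l)) ,
  Uniqueₚ.++⁺ u (cycleWord-Unique m l) (λ { (x∈ , x∈′) → ℕₚ.<⇒≱ (All.lookup b x∈) (proj₁ (All.lookup (cycleWord-range m l) x∈′)) })
  where
  m = length (cycles ls)
  len : length (cycles ls ++ cycleWord m l) ≡ m ℕ.+ suc l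
  len = trans (Listₚ.length-++ (cycles ls)) (cong (m ℕ.+_) (length-cycleWord m l))

module _ (π : List ℕ) (bound : All (_< length π) π) (l : ℕ) where
  private
    m = length π
    ρ = π ++ cycleWord m l

    iter-<′ : ∀ k {i} → i < m → iter π k i < m
    iter-<′ zero    i<m = i<m
    iter-<′ (suc k) i<m = app-All π bound (iter-<′ k i<m)

    iter-old : ∀ k {i} → i < m → iter ρ k i ≡ iter π k i
    iter-old zero    i<m = refl
    iter-old (suc k) i<m = trans (cong (app ρ) (iter-old k i<m)) (app-++ˡ π _ (iter-<′ k i<m))

    ρ-step : ∀ {j} → j < l → app ρ (m ℕ.+ j) ≡ m ℕ.+ suc j
    ρ-step {j} j<l = trans (app-++ʳ π _ j) (trans (app-cycleWord m l j<l) (sym (ℕₚ.+-suc m j)))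

    ρ-end : app ρ (m ℕ.+ l) ≡ m
    ρ-end = trans (app-++ʳ π _ l) (app-cycleWord-end m l)

    iter-up : ∀ k j → j ℕ.+ k ≤ l → iter ρ k (m ℕ.+ j) ≡ m ℕ.+ (j ℕ.+ k)
    iter-up zero    j le = cong (m ℕ.+_) (sym (ℕₚ.+-identityʳ j))
    iter-up (suc k) j le rewrite ℕₚ.+-suc j k = trans (cong (app ρ) (iter-up k j (ℕₚ.<⇒≤ le))) (ρ-step le)

    -- From m + j, d steps climb to the top m + l, one more falls to m, and t further steps climb to
    -- m + t.
    iter-wrap : ∀ t j d → j ℕ.+ d ≡ l → t ≤ l → iter ρ (suc d ℕ.+ t) (m ℕ.+ j) ≡ m ℕ.+ t
    iter-wrap zero    j d refl t≤l rewrite ℕₚ.+-identityʳ d =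
      trans (cong (app ρ) (iter-up d j ℕₚ.≤-refl)) (trans ρ-end (sym (ℕₚ.+-identityʳ m)))
    iter-wrap (suc t) j d e t<l rewrite ℕₚ.+-suc d t =
      trans (cong (app ρ) (iter-wrap t j d e (ℕₚ.<⇒≤ t<l))) (ρ-step t<l)

  orbitSearch-old : ∀ f k {i} → i < m → orbitSearch ρ i k f ≡ orbitSearch π i k f
  orbitSearch-old zero    k     i<m = refl
  orbitSearch-old (suc f) k {i} i<m = cong₂ (λ z r → if z ≡ᵇ i then k else r) (iter-old k i<m) (orbitSearch-old f (suc k) i<m)

  orbitSearch-new : ∀ f {j} → j ≤ l → suc l ≤ f → orbitSearch ρ (m ℕ.+ j) 1 f ≡ suc l
  orbitSearch-new f {j} j≤l l<f with d , e ← ℕₚ.m≤n⇒∃[o]m+o≡n j≤l =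
    orbitSearch-first f 1 (suc l) early return (s≤s z≤n) (ℕₚ.m≤n⇒m≤1+n l<f)
    where
    return : iter ρ (suc l) (m ℕ.+ j) ≡ m ℕ.+ j
    return = subst (λ z → iter ρ (suc z) (m ℕ.+ j) ≡ m ℕ.+ j) (trans (ℕₚ.+-comm d j) e) (iter-wrap j j d e j≤l)
    d<k : ∀ {k} → l < j ℕ.+ k → suc d ≤ k
    d<k {k} lt = ℕₚ.+-cancelˡ-≤ j _ _ (subst (_≤ j ℕ.+ k) (trans (cong suc (sym e)) (sym (ℕₚ.+-suc j d))) lt)
    -- Before the return, the orbit is either still climbing and above m + j, or it has wrapped
    -- around and is below m + j.
    early : ∀ k → 1 ≤ k → k < suc l → iter ρ k (m ℕ.+ j) ≢ m ℕ.+ j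
    early k 1≤k k≤l eq with j ℕ.+ k ℕ.≤? l
    ... | yes le = ℕₚ.m≢1+m+n j (ℕₚ.+-cancelˡ-≡ m _ _ (trans (sym eq) (trans (iter-up k j le) (cong (m ℕ.+_) (j+k 1≤k)))))
      where
      j+k : ∀ {k} → 1 ≤ k → j ℕ.+ k ≡ suc (j ℕ.+ (k ∸ 1))
      j+k (s≤s _) = ℕₚ.+-suc j _
    ... | no ≰ with t , e′ ← ℕₚ.m≤n⇒∃[o]m+o≡n (d<k {k} (ℕₚ.≰⇒> ≰)) =
      ℕₚ.<⇒≢ t<j (ℕₚ.+-cancelˡ-≡ m _ _ (trans (sym (subst (λ z → iter ρ z (m ℕ.+ j) ≡ m ℕ.+ t) e′ (iter-wrap t j d e (ℕₚ.≤-trans (ℕₚ.<⇒≤ t<j) j≤l)))) eq))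
      where
      t<j : t < j
      t<j = ℕₚ.+-cancelˡ-< (suc d) _ _ (subst₂ _<_ (sym e′) (cong suc (trans (sym e) (ℕₚ.+-comm j d))) k≤l)

-- The fuel `f` is independent of `ls` because the induction passes to the tail, while the search
-- keeps the length of the whole permutation as its fuel.
count-cycles : ∀ ls f k → sum ls ≤ f →
  (∑[ i ∈ upTo (length (cycles ls)) ] 𝟙 (orbitSearch (cycles ls) i 1 f ≡ᵇ suc k)) ≡ + countB (_≡ᵇ suc k) ls * + suc k
count-cycles []           f k le = sym (ℤₚ.*-zeroˡ (+ suc k))
count-cycles (zero ∷ ls)  f k le = count-cycles ls f k le
count-cycles (suc l ∷ ls) f k le = begin
  (∑[ i ∈ upTo (length ρ) ] g i)
    ≡⟨ cong (λ z → ∑ (upTo z) g) (trans (Listₚ.length-++ π) (cong (m ℕ.+_) (length-cycleWord m l))) ⟩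
  (∑[ i ∈ upTo (m ℕ.+ suc l) ] g i)
    ≡⟨ ∑-upTo-+ m (suc l) g ⟩
  ∑ (upTo m) g + (∑[ j ∈ upTo (suc l) ] g (m ℕ.+ j))
    ≡⟨ cong₂ _+_
        (trans (∑-upTo-cong m (λ i i<m → cong (λ z → 𝟙 (z ≡ᵇ suc k)) (orbitSearch-old π bound l f 1 i<m)))
               (count-cycles ls f k (ℕₚ.≤-trans (ℕₚ.m≤n+m (sum ls) (suc l)) le)))
        (trans (∑-upTo-cong (suc l) (λ j j< → cong (λ z → 𝟙 (z ≡ᵇ suc k))
                 (orbitSearch-new π bound l f (ℕₚ.≤-pred j<) (ℕₚ.≤-trans (ℕₚ.m≤m+n (suc l) (sum ls)) le))))
               (trans (∑-const (upTo (suc l)) (𝟙 (l ≡ᵇ k))) (cong (λ z → + z * 𝟙 (l ≡ᵇ k)) (Listₚ.length-upTo (suc l))))) ⟩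
  + countB (_≡ᵇ suc k) ls * + suc k + + suc l * 𝟙 (l ≡ᵇ k)
    ≡⟨ cong (_+_ (+ countB (_≡ᵇ suc k) ls * + suc k)) (trans (ℤₚ.*-comm (+ suc l) _)
        (trans (𝟙-guard (l ≡ᵇ k) (λ e → cong (λ z → + suc z) (≡ᵇ-true⁻¹ e))) refl)) ⟩
  + countB (_≡ᵇ suc k) ls * + suc k + 𝟙 (l ≡ᵇ k) * + suc k
    ≡⟨ lem (+ countB (_≡ᵇ suc k) ls) (𝟙 (l ≡ᵇ k)) (+ suc k) ⟩
  (𝟙 (l ≡ᵇ k) + + countB (_≡ᵇ suc k) ls) * + suc k
    ≡⟨ cong (_* + suc k) (sym (trans (∑-countB (_≡ᵇ suc k) (suc l ∷ ls)) (cong (_+_ (𝟙 (l ≡ᵇ k))) (sym (∑-countB (_≡ᵇ suc k) ls))))) ⟩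
  + countB (_≡ᵇ suc k) (suc l ∷ ls) * + suc k ∎
  where
  open ≡-Reasoning
  π = cycles ls
  m = length π
  ρ = cycles (suc l ∷ ls)
  bound = proj₁ (cycles-Labelling ls)
  g = λ i → 𝟙 (orbitSearch ρ i 1 f ≡ᵇ suc k)
  lem : ∀ a b c → a * c + b * c ≡ (b + a) * c
  lem = solve-∀

≤-sum : ∀ xs → All (_≤ sum xs) xs
≤-sum []       = []
≤-sum (x ∷ xs) = ℕₚ.m≤m+n x (sum xs) ∷ All.map (λ le → ℕₚ.≤-trans le (ℕₚ.m≤n+m (sum xs) x)) (≤-sum xs)

fromMultiplicities-cong : ∀ n {c d} → (∀ k → k < n → c k ≡ d k) → fromMultiplicities n c ≡ fromMultiplicities n d
fromMultiplicities-cong zero    h = refl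
fromMultiplicities-cong (suc n) h = cong₂ _++_ (cong (λ m → replicate m (suc n)) (h n (ℕₚ.n<1+n n)))
  (fromMultiplicities-cong n (λ k k<n → h k (ℕₚ.m<n⇒m<1+n k<n)))

-- The largest admissible part n + 1 is either the head of the decreasing list or absent from it. In
-- the first case one copy is removed, in the second the bound is lowered.
fromMultiplicities-parts : ∀ n ps → Linked ℕ._≥_ ps → All (1 ≤_) ps → All (_≤ n) ps →
  fromMultiplicities n (λ k → countB (_≡ᵇ suc k) ps) ≡ ps
fromMultiplicities-parts zero    []       _   _         _         = refl
fromMultiplicities-parts zero    (p ∷ ps) dec (1≤p ∷ _) (p≤0 ∷ _) = ⊥-elim (ℕₚ.<⇒≱ 1≤p p≤0)
fromMultiplicities-parts (suc n) ps       dec pos       le        = go ps dec pos le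
  where
  open ≡-Reasoning
  smaller = fromMultiplicities-parts n
  countB-yes : ∀ {q : ℕ → Bool} {x xs} → q x ≡ true → countB q (x ∷ xs) ≡ suc (countB q xs)
  countB-yes e rewrite e = refl
  countB-no : ∀ {q : ℕ → Bool} {x xs} → q x ≡ false → countB q (x ∷ xs) ≡ countB q xs
  countB-no e rewrite e = refl
  go : ∀ ps → Linked ℕ._≥_ ps → All (1 ≤_) ps → All (_≤ suc n) ps →
    fromMultiplicities (suc n) (λ k → countB (_≡ᵇ suc k) ps) ≡ ps
  go []       dec pos le        = smaller [] dec pos []
  go (p ∷ ps) dec pos (p≤ ∷ le) with ℕₚ.m≤n⇒m<n∨m≡n p≤
  ... | inj₁ (s≤s p≤n) = trans (cong (λ c → replicate c (suc n) ++ fromMultiplicities n (λ k → countB (_≡ᵇ suc k) (p ∷ ps))) none)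
    (smaller (p ∷ ps) dec pos small)
    where
    small : All (_≤ n) (p ∷ ps)
    small = All.map (λ p≥x → ℕₚ.≤-trans p≥x p≤n) (Linked⇒All (λ i≥j j≥k → ℕₚ.≤-trans j≥k i≥j) ℕₚ.≤-refl dec)
    none : countB (_≡ᵇ suc n) (p ∷ ps) ≡ 0
    none = ℤₚ.+-injective (trans (∑-countB (_≡ᵇ suc n) (p ∷ ps)) (∑-zero (p ∷ ps) (λ {x} x∈ →
      cong 𝟙 (≡ᵇ-false (ℕₚ.<⇒≢ (s≤s (All.lookup small x∈)))))))
  ... | inj₂ refl = begin
    replicate (countB (_≡ᵇ suc n) (suc n ∷ ps)) (suc n) ++ fromMultiplicities n (λ k → countB (_≡ᵇ suc k) (suc n ∷ ps))
      ≡⟨ cong₂ (λ c xs → replicate c (suc n) ++ xs) (countB-yes {_≡ᵇ suc n} {suc n} {ps} (≡ᵇ-true {suc n} refl))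
           (fromMultiplicities-cong n (λ k k<n → countB-no {_≡ᵇ suc k} {suc n} {ps} (≡ᵇ-false (λ e → ℕₚ.<⇒≢ k<n (sym (ℕₚ.suc-injective e)))))) ⟩
    suc n ∷ fromMultiplicities (suc n) (λ k → countB (_≡ᵇ suc k) ps)
      ≡⟨ cong (suc n ∷_) (go ps (Linked.tail dec) (All.tail pos) le) ⟩
    suc n ∷ ps ∎

cycleType-cycles : ∀ ps → Linked ℕ._≥_ ps → All (1 ≤_) ps → cycleType (cycles ps) ≡ ps
cycleType-cycles ps dec pos = begin
  fromMultiplicities m (cyclesOfLen π)                          ≡⟨ fromMultiplicities-cong m (λ k _ → exact k) ⟩
  fromMultiplicities m (λ k → countB (_≡ᵇ suc k) ps)            ≡⟨ cong (λ m → fromMultiplicities m (λ k → countB (_≡ᵇ suc k) ps)) (length-cycles ps) ⟩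
  fromMultiplicities (sum ps) (λ k → countB (_≡ᵇ suc k) ps)     ≡⟨ fromMultiplicities-parts (sum ps) ps dec pos (≤-sum ps) ⟩
  ps                                                            ∎
  where
  open ≡-Reasoning
  π = cycles ps
  m = length π
  exact : ∀ k → cyclesOfLen π k ≡ countB (_≡ᵇ suc k) ps
  exact k = trans (cong (ℕD._/ suc k) (ℤₚ.+-injective (begin
    + cyclePoints π k                                   ≡⟨ ∑-countB _ (upTo m) ⟩
    (∑[ i ∈ upTo m ] 𝟙 (cycleLen π i ≡ᵇ suc k))         ≡⟨ count-cycles ps m k (ℕₚ.≤-reflexive (sym (length-cycles ps))) ⟩
    + countB (_≡ᵇ suc k) ps * + suc k                   ≡⟨ sym (ℤₚ.pos-* (countB (_≡ᵇ suc k) ps) (suc k)) ⟩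
    + (countB (_≡ᵇ suc k) ps ℕ.* suc k)                 ∎)))
    (ℕD.m*n/n≡m (countB (_≡ᵇ suc k) ps) (suc k))

Unique⇒distinctB : ∀ xs → Unique xs → distinctB xs ≡ true
Unique⇒distinctB []       _        = refl
Unique⇒distinctB (x ∷ xs) (p ∷ ps) = ∧-true (notInB-true xs p) (Unique⇒distinctB xs ps)

-- Since `_//_` returns 0 on a zero divisor, the mean is the true average only because every class
-- has a member, exhibited here.
∈-ofType-cycles : ∀ {n} ps → Linked ℕ._≥_ ps → All (1 ≤_) ps → sum ps ≡ n → cycles ps ∈ ofType n ps
∈-ofType-cycles ps dec pos refl = ∈-filterB⁺ _
  (∈-filterB⁺ distinctB (∈-words⁺ (sum ps) (sum ps) (length-cycles ps) (subst (λ m → All (_< m) (cycles ps)) (length-cycles ps) (proj₁ lab)))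
    (Unique⇒distinctB (cycles ps) (proj₂ lab)))
  (subst (λ t → eqListB t ps ≡ true) (sym (cycleType-cycles ps dec pos)) (eqListB-refl ps))
  where lab = cycles-Labelling ps

-- Polynomials with integer coefficients

-- Horner form: the coefficients of the powers of the first variable, each a polynomial in the
-- remaining ones. Trailing zeros are allowed, so equality is tested by whether the difference has
-- only zero coefficients.
Poly : ℕ → Set
Poly zero    = ℤ
Poly (suc k) = List (Poly k)

eval : ∀ {k} → Poly k → Vec ℤ k → ℤ
eval {zero}  c       ε       = c
eval {suc k} []      ε       = 0ℤ
eval {suc k} (a ∷ f) (x ∷ ε) = eval a ε + x * eval {suc k} f (x ∷ ε)

constₚ : ∀ {k} → ℤ → Poly k
constₚ {zero}  c = c
constₚ {suc k} c = constₚ c ∷ []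

varₚ : ∀ {k} → Fin k → Poly k
varₚ {suc k} Fin.zero    = constₚ 0ℤ ∷ constₚ 1ℤ ∷ []
varₚ {suc k} (Fin.suc i) = varₚ i ∷ []

infixl 6 _⊞_
infixl 7 _⊠_

_⊞_ : ∀ {k} → Poly k → Poly k → Poly k
_⊞_ {zero}  a       b       = a + b
_⊞_ {suc k} []      g       = g
_⊞_ {suc k} (a ∷ f) []      = a ∷ f
_⊞_ {suc k} (a ∷ f) (b ∷ g) = (a ⊞ b) ∷ (_⊞_ {suc k} f g)

negₚ : ∀ {k} → Poly k → Poly k
negₚ {zero}  a       = - a
negₚ {suc k} []      = []
negₚ {suc k} (a ∷ f) = negₚ a ∷ negₚ {suc k} f

mutual
  _⊠_ : ∀ {k} → Poly k → Poly k → Poly k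
  _⊠_ {zero}  a       b = a * b
  _⊠_ {suc k} []      g = []
  _⊠_ {suc k} (a ∷ f) g = _⊞_ {suc k} (scaleₚ a g) (constₚ 0ℤ ∷ (_⊠_ {suc k} f g))

  scaleₚ : ∀ {k} → Poly k → Poly (suc k) → Poly (suc k)
  scaleₚ c []      = []
  scaleₚ c (a ∷ f) = (c ⊠ a) ∷ scaleₚ c f

eval-const : ∀ {k} c (ε : Vec ℤ k) → eval (constₚ c) ε ≡ c
eval-const {zero}  c ε       = refl
eval-const {suc k} c (x ∷ ε) = trans (cong₂ _+_ (eval-const c ε) (ℤₚ.*-zeroʳ x)) (ℤₚ.+-identityʳ c)

eval-var : ∀ {k} i (ε : Vec ℤ k) → eval (varₚ i) ε ≡ lookup ε i
eval-var {suc k} Fin.zero    (x ∷ ε) rewrite eval-const {k} 0ℤ ε | eval-const {k} 1ℤ ε = lem x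
  where
  lem : ∀ x → 0ℤ + x * (1ℤ + x * 0ℤ) ≡ x
  lem = solve-∀
eval-var {suc k} (Fin.suc i) (x ∷ ε) = trans (cong₂ _+_ (eval-var i ε) (ℤₚ.*-zeroʳ x)) (ℤₚ.+-identityʳ _)

eval-⊞ : ∀ {k} (f g : Poly k) ε → eval (f ⊞ g) ε ≡ eval f ε + eval g ε
eval-⊞ {zero}  a       b       ε       = refl
eval-⊞ {suc k} []      g       ε       = sym (ℤₚ.+-identityˡ _)
eval-⊞ {suc k} (a ∷ f) []      ε       = sym (ℤₚ.+-identityʳ _)
eval-⊞ {suc k} (a ∷ f) (b ∷ g) (x ∷ ε)
  rewrite eval-⊞ a b ε | eval-⊞ {suc k} f g (x ∷ ε) = lem (eval a ε) (eval b ε) x (eval {suc k} f (x ∷ ε)) (eval {suc k} g (x ∷ ε))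
  where
  lem : ∀ a b x f g → a + b + x * (f + g) ≡ a + x * f + (b + x * g)
  lem = solve-∀

eval-neg : ∀ {k} (f : Poly k) ε → eval (negₚ f) ε ≡ - eval f ε
eval-neg {zero}  a       ε       = refl
eval-neg {suc k} []      ε       = refl
eval-neg {suc k} (a ∷ f) (x ∷ ε) rewrite eval-neg a ε | eval-neg {suc k} f (x ∷ ε) = lem (eval a ε) x (eval {suc k} f (x ∷ ε))
  where
  lem : ∀ a x f → - a + x * - f ≡ - (a + x * f)
  lem = solve-∀

mutual
  eval-⊠ : ∀ {k} (f g : Poly k) ε → eval (f ⊠ g) ε ≡ eval f ε * eval g ε
  eval-⊠ {zero}  a       b ε       = refl
  eval-⊠ {suc k} []      g ε       = sym (ℤₚ.*-zeroˡ (eval g ε))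
  eval-⊠ {suc k} (a ∷ f) g (x ∷ ε)
    rewrite eval-⊞ {suc k} (scaleₚ a g) (constₚ 0ℤ ∷ (_⊠_ {suc k} f g)) (x ∷ ε)
          | eval-scale a g x ε | eval-const 0ℤ ε | eval-⊠ {suc k} f g (x ∷ ε) =
    lem (eval a ε) x (eval {suc k} f (x ∷ ε)) (eval {suc k} g (x ∷ ε))
    where
    lem : ∀ a x f g → a * g + (0ℤ + x * (f * g)) ≡ (a + x * f) * g
    lem = solve-∀

  eval-scale : ∀ {k} (c : Poly k) (g : Poly (suc k)) x ε → eval {suc k} (scaleₚ c g) (x ∷ ε) ≡ eval c ε * eval {suc k} g (x ∷ ε)
  eval-scale c []      x ε = sym (ℤₚ.*-zeroʳ (eval c ε))
  eval-scale c (a ∷ g) x ε rewrite eval-⊠ c a ε | eval-scale c g x ε = lem (eval c ε) (eval a ε) x _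
    where
    lem : ∀ c a x g → c * a + x * (c * g) ≡ c * (a + x * g)
    lem = solve-∀

isZero : ∀ {k} → Poly k → Bool
isZero {zero}  (+ zero) = true
isZero {zero}  _        = false
isZero {suc k} []       = true
isZero {suc k} (a ∷ f)  = isZero a ∧ isZero {suc k} f

isZero-sound : ∀ {k} (f : Poly k) → isZero f ≡ true → ∀ ε → eval f ε ≡ 0ℤ
isZero-sound {zero}  (+ zero) e ε       = refl
isZero-sound {suc k} []       e ε       = refl
isZero-sound {suc k} (a ∷ f)  e (x ∷ ε) with p , q ← ∧-true⁻¹ {isZero a} e
  rewrite isZero-sound a p ε | isZero-sound {suc k} f q (x ∷ ε) = trans (ℤₚ.+-identityˡ _) (ℤₚ.*-zeroʳ x)

equal : ∀ {k} → Poly k → Poly k → Bool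
equal f g = isZero (f ⊞ negₚ g)

equal-sound : ∀ {k} (f g : Poly k) → equal f g ≡ true → ∀ ε → eval f ε ≡ eval g ε
equal-sound f g e ε = ℤₚ.i-j≡0⇒i≡j _ _ (trans (sym (trans (eval-⊞ f (negₚ g) ε) (cong (_+_ (eval f ε)) (eval-neg g ε)))) (isZero-sound (f ⊞ negₚ g) e ε))

nonneg pos : ∀ {k} → Poly k → Bool
nonneg {zero}  (+ _)    = true
nonneg {zero}  -[1+ _ ] = false
nonneg {suc k} []       = true
nonneg {suc k} (a ∷ f)  = nonneg a ∧ nonneg {suc k} f
pos {zero}  (+ suc _) = true
pos {zero}  _         = false
pos {suc k} []        = false
pos {suc k} (a ∷ f)   = pos a ∧ nonneg {suc k} f

naturals : ∀ {k} → Vec ℕ k → Vec ℤ k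
naturals []      = []
naturals (m ∷ ε) = + m ∷ naturals ε

nonneg-sound : ∀ {k} (f : Poly k) → nonneg f ≡ true → ∀ ε → ∃ λ m → eval f (naturals ε) ≡ + m
nonneg-sound {zero}  (+ m)   e ε       = m , refl
nonneg-sound {suc k} []      e ε       = 0 , refl
nonneg-sound {suc k} (a ∷ f) e (x ∷ ε) with p , q ← ∧-true⁻¹ {nonneg a} e
  with i , eᵢ ← nonneg-sound a p ε | j , eⱼ ← nonneg-sound {suc k} f q (x ∷ ε) =
  i ℕ.+ x ℕ.* j , trans (cong₂ (λ u v → u + + x * v) eᵢ eⱼ) (cong (_+_ (+ i)) (sym (ℤₚ.pos-* x j)))

pos-sound : ∀ {k} (f : Poly k) → pos f ≡ true → ∀ ε → ∃ λ m → eval f (naturals ε) ≡ + suc m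
pos-sound {zero}  (+ suc m) e ε       = m , refl
pos-sound {suc k} (a ∷ f)   e (x ∷ ε) with p , q ← ∧-true⁻¹ {pos a} e
  with i , eᵢ ← pos-sound a p ε | j , eⱼ ← nonneg-sound {suc k} f q (x ∷ ε) =
  i ℕ.+ x ℕ.* j , trans (cong₂ (λ u v → u + + x * v) eᵢ eⱼ) (cong (_+_ (+ suc i)) (sym (ℤₚ.pos-* x j)))

pos≢0 : ∀ {k} (f : Poly k) → pos f ≡ true → ∀ ε → eval f (naturals ε) ≢ 0ℤ
pos≢0 f e ε z with _ , eq ← pos-sound f e ε with () ← trans (sym eq) z

-- Polynomial expressions

infixl 6 _+ᶻ_ _-ᶻ_
infixl 7 _*ᶻ_

data ZExpr (k : ℕ) : Set where
  var            : Fin k → ZExpr k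
  con            : ℕ → ZExpr k
  _+ᶻ_ _-ᶻ_ _*ᶻ_ : ZExpr k → ZExpr k → ZExpr k

⟦_⟧ᶻ : ∀ {k} → ZExpr k → Vec ℤ k → ℤ
⟦ var i  ⟧ᶻ ε = lookup ε i
⟦ con c  ⟧ᶻ ε = + c
⟦ a +ᶻ b ⟧ᶻ ε = ⟦ a ⟧ᶻ ε + ⟦ b ⟧ᶻ ε
⟦ a -ᶻ b ⟧ᶻ ε = ⟦ a ⟧ᶻ ε - ⟦ b ⟧ᶻ ε
⟦ a *ᶻ b ⟧ᶻ ε = ⟦ a ⟧ᶻ ε * ⟦ b ⟧ᶻ ε

poly : ∀ {k} → ZExpr k → Poly k
poly (var i)  = varₚ i
poly (con c)  = constₚ (+ c)
poly (a +ᶻ b) = poly a ⊞ poly b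
poly (a -ᶻ b) = poly a ⊞ negₚ (poly b)
poly (a *ᶻ b) = poly a ⊠ poly b

eval-poly : ∀ {k} (a : ZExpr k) ε → eval (poly a) ε ≡ ⟦ a ⟧ᶻ ε
eval-poly (var i)  ε = eval-var i ε
eval-poly (con c)  ε = eval-const (+ c) ε
eval-poly (a +ᶻ b) ε = trans (eval-⊞ (poly a) (poly b) ε) (cong₂ _+_ (eval-poly a ε) (eval-poly b ε))
eval-poly (a -ᶻ b) ε = trans (eval-⊞ (poly a) (negₚ (poly b)) ε)
  (cong₂ _+_ (eval-poly a ε) (trans (eval-neg (poly b) ε) (cong -_ (eval-poly b ε))))
eval-poly (a *ᶻ b) ε = trans (eval-⊠ (poly a) (poly b) ε) (cong₂ _*_ (eval-poly a ε) (eval-poly b ε))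

-- The embedding of ℤ into ℚ

ι : ℤ → ℚ
ι i = i ℚ./ 1

private
  ι-toℚᵘ : ∀ i → ℚ.toℚᵘ (ι i) ℚᵘ.≃ ℚᵘ.mkℚᵘ i 0
  ι-toℚᵘ i = ℚₚ.toℚᵘ-fromℚᵘ (ℚᵘ.mkℚᵘ i 0)

ι-+ : ∀ i j → ι (i + j) ≡ ι i ℚ.+ ι j
ι-+ i j = ℚₚ.toℚᵘ-injective (ℚᵘₚ.≃-trans (ι-toℚᵘ (i + j)) (ℚᵘₚ.≃-sym (ℚᵘₚ.≃-trans (ℚₚ.toℚᵘ-homo-+ (ι i) (ι j))
  (ℚᵘₚ.≃-trans (ℚᵘₚ.+-cong (ι-toℚᵘ i) (ι-toℚᵘ j)) (ℚᵘ.*≡* (lem i j))))))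
  where
  lem : ∀ i j → (i * 1ℤ + j * 1ℤ) * 1ℤ ≡ (i + j) * 1ℤ
  lem = solve-∀

ι-* : ∀ i j → ι (i * j) ≡ ι i ℚ.* ι j
ι-* i j = ℚₚ.toℚᵘ-injective (ℚᵘₚ.≃-trans (ι-toℚᵘ (i * j)) (ℚᵘₚ.≃-sym (ℚᵘₚ.≃-trans (ℚₚ.toℚᵘ-homo-* (ι i) (ι j))
  (ℚᵘₚ.≃-trans (ℚᵘₚ.*-cong (ι-toℚᵘ i) (ι-toℚᵘ j)) (ℚᵘ.*≡* refl)))))

ι-neg : ∀ i → ι (- i) ≡ ℚ.- ι i
ι-neg i = ℚₚ.toℚᵘ-injective (ℚᵘₚ.≃-trans (ι-toℚᵘ (- i)) (ℚᵘₚ.≃-sym (ℚᵘₚ.≃-trans (ℚₚ.toℚᵘ-homo‿- (ι i))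
  (ℚᵘₚ.≃-trans (ℚᵘₚ.-‿cong (ι-toℚᵘ i)) (ℚᵘ.*≡* refl)))))

ι-injective : ∀ {i j} → ι i ≡ ι j → i ≡ j
ι-injective {i} {j} e with ℚᵘ.*≡* eq ← ℚᵘₚ.≃-trans (ℚᵘₚ.≃-sym (ι-toℚᵘ i)) (ℚᵘₚ.≃-trans (ℚₚ.toℚᵘ-cong e) (ι-toℚᵘ j)) =
  trans (sym (ℤₚ.*-identityʳ i)) (trans eq (ℤₚ.*-identityʳ j))

ι≢0 : ∀ {i} → i ≢ 0ℤ → ι i ≢ 0ℚ
ι≢0 ne e = ne (ι-injective e)

//-* : ∀ p {q} → q ≢ 0ℚ → (p // q) ℚ.* q ≡ p
//-* p {q} ne with q ℚₚ.≟ 0ℚ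
... | yes e  = ⊥-elim (ne e)
... | no q≢0 = trans (ℚₚ.*-assoc p _ q) (trans (cong (p ℚ.*_) (ℚₚ.*-inverseˡ q {{ℚ.≢-nonZero q≢0}})) (ℚₚ.*-identityʳ p))

*-cancelʳ-≢0 : ∀ {p q r} → r ≢ 0ℚ → p ℚ.* r ≡ q ℚ.* r → p ≡ q
*-cancelʳ-≢0 {p} {q} {r} ne e = trans (undo p) (trans (cong (ℚ._* ℚ.1/_ r {{nz}}) e) (sym (undo q)))
  where
  nz = ℚ.≢-nonZero ne
  undo : ∀ p → p ≡ p ℚ.* r ℚ.* ℚ.1/_ r {{nz}}
  undo p = sym (trans (ℚₚ.*-assoc p r _) (trans (cong (p ℚ.*_) (ℚₚ.*-inverseʳ r {{nz}})) (ℚₚ.*-identityʳ p)))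

-- As an argument of solve, an overloaded literal is resolved too late.
#4 : ℕ
#4 = 4

*-≢0 : ∀ {p q} → p ≢ 0ℚ → q ≢ 0ℚ → p ℚ.* q ≢ 0ℚ
*-≢0 {p} {q} np nq e = np (*-cancelʳ-≢0 nq (trans e (sym (ℚₚ.*-zeroˡ q))))

-- The expressions of the table

infixl 6 _⊕_ _⊖_
infixl 7 _⊗_ _⊘_

-- The binomial coefficients are atoms, for which `num` and `den` supply the fractions (n)₃ / 6 and
-- (n - 1)₂ / 2; the remaining forms are those in which the table is written.
data QExpr : Set where
  N P Q R C₃ C₂           : QExpr
  lit                     : ℕ → QExpr
  _⊕_ _⊖_ _⊗_ _⊘_         : QExpr → QExpr → QExpr
  ⊝_                      : QExpr → QExpr

-- The variables of the polynomials are p, q, r and n - 3: all of them are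
-- natural numbers, and the denominators are positive for n ≥ 3.
pattern #p = Fin.zero
pattern #q = Fin.suc Fin.zero
pattern #r = Fin.suc (Fin.suc Fin.zero)
pattern #m = Fin.suc (Fin.suc (Fin.suc Fin.zero))

nᶻ : ZExpr 4
nᶻ = con 3 +ᶻ var #m

-- (n - 1)₂ and (n)₃
[n-1]₂ n₃ : ZExpr 4
[n-1]₂ = (con 2 +ᶻ var #m) *ᶻ (con 1 +ᶻ var #m)
n₃     = nᶻ *ᶻ [n-1]₂

module _ (m p q r : ℕ) where
  private
    n = 3 ℕ.+ m

  env : Vec ℕ 4
  env = p ∷ q ∷ r ∷ m ∷ []

  ⟦_⟧ : QExpr → ℚ
  ⟦ N ⟧     = ℕ→ℚ n
  ⟦ P ⟧     = ℕ→ℚ p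
  ⟦ Q ⟧     = ℕ→ℚ q
  ⟦ R ⟧     = ℕ→ℚ r
  ⟦ C₃ ⟧    = ℕ→ℚ (n Comb.C 3)
  ⟦ C₂ ⟧    = ℕ→ℚ ((n ∸ 1) Comb.C 2)
  ⟦ lit k ⟧ = fromNat k
  ⟦ a ⊕ b ⟧ = ⟦ a ⟧ ℚ.+ ⟦ b ⟧
  ⟦ a ⊖ b ⟧ = ⟦ a ⟧ ℚ.- ⟦ b ⟧
  ⟦ a ⊗ b ⟧ = ⟦ a ⟧ ℚ.* ⟦ b ⟧
  ⟦ a ⊘ b ⟧ = ⟦ a ⟧ // ⟦ b ⟧
  ⟦ ⊝ a ⟧   = ℚ.- ⟦ a ⟧

-- The fractions are never reduced; they are compared by cross-multiplication.
num den : QExpr → Poly 4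
num N       = poly nᶻ
num P       = varₚ #p
num Q       = varₚ #q
num R       = varₚ #r
num C₃      = poly n₃
num C₂      = poly [n-1]₂
num (lit k) = constₚ (+ k)
num (a ⊕ b) = num a ⊠ den b ⊞ num b ⊠ den a
num (a ⊖ b) = num a ⊠ den b ⊞ negₚ (num b ⊠ den a)
num (a ⊗ b) = num a ⊠ num b
num (a ⊘ b) = num a ⊠ den b
num (⊝ a)   = negₚ (num a)
den C₃      = constₚ (+ 6)
den C₂      = constₚ (+ 2)
den (a ⊕ b) = den a ⊠ den b
den (a ⊖ b) = den a ⊠ den b
den (a ⊗ b) = den a ⊠ den b
den (a ⊘ b) = den a ⊠ num b
den (⊝ a)   = den a
den _       = constₚ 1ℤ

-- The default value of `_//_` at 0 must be ruled out, so the numerator of every divisor has to pass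
-- the positivity test.
defined : QExpr → Bool
defined (a ⊕ b) = defined a ∧ defined b
defined (a ⊖ b) = defined a ∧ defined b
defined (a ⊗ b) = defined a ∧ defined b
defined (a ⊘ b) = defined a ∧ (defined b ∧ pos (num b))
defined (⊝ a)   = defined a
defined _       = true

C-ff : ∀ n k → (n Comb.C k) ℕ.* k ! ≡ ff n k
C-ff n       zero    = refl
C-ff zero    (suc k) = refl
C-ff (suc n) (suc k) = begin
  (suc n Comb.C suc k) ℕ.* (suc k) !                                     ≡⟨ cong (ℕ._* (suc k) !) (sym (Comb.nCk+nC[k+1]≡[n+1]C[k+1] n k)) ⟩
  ((n Comb.C k) ℕ.+ (n Comb.C suc k)) ℕ.* (suc k ℕ.* k !)                     ≡⟨ lem (n Comb.C k) (n Comb.C suc k) (suc k) (k !) ⟩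
  (n Comb.C suc k) ℕ.* (suc k ℕ.* k !) ℕ.+ suc k ℕ.* ((n Comb.C k) ℕ.* k !)   ≡⟨ cong₂ (λ x y → x ℕ.+ suc k ℕ.* y) (C-ff n (suc k)) (C-ff n k) ⟩
  ff n (suc k) ℕ.+ suc k ℕ.* ff n k                                 ≡⟨ sym (ff-pascal n k) ⟩
  ff (suc n) (suc k)                                                ∎
  where
  open ≡-Reasoning
  lem : ∀ a b c d → (a ℕ.+ b) ℕ.* (c ℕ.* d) ≡ b ℕ.* (c ℕ.* d) ℕ.+ c ℕ.* (a ℕ.* d)
  lem = ℕSolver.solve-∀

ι-lit : ∀ k → fromNat k ≡ ι (+ k)
ι-lit k = ℚₚ.toℚᵘ-injective (ℚᵘₚ.≃-sym (ι-toℚᵘ (+ k)))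

module _ (m p q r : ℕ) where
  private
    ε = naturals (env m p q r)

    value-of-n : eval (poly nᶻ) ε ≡ + (3 ℕ.+ m)
    value-of-n = eval-poly nᶻ ε

    val dn nm : QExpr → ℚ
    val e = ⟦_⟧ m p q r e
    dn e  = ι (eval (den e) ε)
    nm e  = ι (eval (num e) ε)

    Fraction : QExpr → Set
    Fraction e = eval (den e) ε ≢ 0ℤ × val e ℚ.* dn e ≡ nm e

    integer : ∀ {x} (f : Poly 4) → x ≡ ι (eval f ε) → eval (constₚ 1ℤ) ε ≢ 0ℤ × x ℚ.* ι (eval (constₚ 1ℤ) ε) ≡ ι (eval f ε)
    integer {x} f e rewrite eval-const 1ℤ ε = (λ ()) , trans (ℚₚ.*-identityʳ x) e

    *-nonzero : ∀ {i j} → i ≢ 0ℤ → j ≢ 0ℤ → i * j ≢ 0ℤ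
    *-nonzero {i} ni nj e with ℤₚ.i*j≡0⇒i≡0∨j≡0 i e
    ... | inj₁ z = ni z
    ... | inj₂ z = nj z

    over-common : ∀ x y b d a c → x ℚ.* b ≡ a → y ℚ.* d ≡ c → (x ℚ.+ y) ℚ.* (b ℚ.* d) ≡ a ℚ.* d ℚ.+ c ℚ.* b
    over-common x y b d a c refl refl = lem x y b d
      where
      lem : ∀ x y b d → (x ℚ.+ y) ℚ.* (b ℚ.* d) ≡ x ℚ.* b ℚ.* d ℚ.+ y ℚ.* d ℚ.* b
      open ℚSolver.+-*-Solver using (solve; _:=_; _:+_; _:*_)
      lem = solve #4 (λ x y b d → (x :+ y) :* (b :* d) := x :* b :* d :+ y :* d :* b) refl

    product : ∀ x y b d a c → x ℚ.* b ≡ a → y ℚ.* d ≡ c → (x ℚ.* y) ℚ.* (b ℚ.* d) ≡ a ℚ.* c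
    product x y b d a c refl refl = lem x y b d
      where
      lem : ∀ x y b d → (x ℚ.* y) ℚ.* (b ℚ.* d) ≡ x ℚ.* b ℚ.* (y ℚ.* d)
      open ℚSolver.+-*-Solver using (solve; _:=_; _:+_; _:*_)
      lem = solve #4 (λ x y b d → (x :* y) :* (b :* d) := x :* b :* (y :* d)) refl

    quotient : ∀ x y z b d a c → x ℚ.* b ≡ a → z ℚ.* y ≡ x → y ℚ.* d ≡ c → z ℚ.* (b ℚ.* c) ≡ a ℚ.* d
    quotient x y z b d a c refl refl refl = lem y z b d
      where
      lem : ∀ y z b d → z ℚ.* (b ℚ.* (y ℚ.* d)) ≡ z ℚ.* y ℚ.* b ℚ.* d
      open ℚSolver.+-*-Solver using (solve; _:=_; _:+_; _:*_)
      lem = solve #4 (λ y z b d → z :* (b :* (y :* d)) := z :* y :* b :* d) refl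

    ι-⊠ : ∀ (f g : Poly 4) → ι (eval (f ⊠ g) ε) ≡ ι (eval f ε) ℚ.* ι (eval g ε)
    ι-⊠ f g = trans (cong ι (eval-⊠ f g ε)) (ι-* (eval f ε) (eval g ε))

    ι-⊞ : ∀ (f g : Poly 4) → ι (eval (f ⊞ g) ε) ≡ ι (eval f ε) ℚ.+ ι (eval g ε)
    ι-⊞ f g = trans (cong ι (eval-⊞ f g ε)) (ι-+ (eval f ε) (eval g ε))

    ι-negₚ : ∀ (f : Poly 4) → ι (eval (negₚ f) ε) ≡ ℚ.- ι (eval f ε)
    ι-negₚ f = trans (cong ι (eval-neg f ε)) (ι-neg (eval f ε))

    ⊠-nonzero : ∀ (f g : Poly 4) → eval f ε ≢ 0ℤ → eval g ε ≢ 0ℤ → eval (f ⊠ g) ε ≢ 0ℤ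
    ⊠-nonzero f g nf ng e = *-nonzero nf ng (trans (sym (eval-⊠ f g ε)) e)

    choose : ∀ n k d (f : ZExpr 4) → k ! ≡ d → d ≢ 0 → + ff n k ≡ ⟦ f ⟧ᶻ ε →
      eval (constₚ (+ d)) ε ≢ 0ℤ × ℕ→ℚ (n Comb.C k) ℚ.* ι (eval (constₚ (+ d)) ε) ≡ ι (eval (poly f) ε)
    choose n k d f refl d≢0 e rewrite eval-const (+ d) ε = (λ z → d≢0 (ℤₚ.+-injective z)) ,
      trans (sym (ι-* (+ (n Comb.C k)) (+ d))) (cong ι (trans (sym (ℤₚ.pos-* (n Comb.C k) d)) (trans (cong +_ (C-ff n k)) (trans e (sym (eval-poly f ε))))))

    ff-2 : + ff (2 ℕ.+ m) 2 ≡ + (2 ℕ.+ m) * + (1 ℕ.+ m)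
    ff-2 = trans (ℤₚ.pos-* (2 ℕ.+ m) (ff (1 ℕ.+ m) 1)) (cong (λ z → + (2 ℕ.+ m) * + z) (ℕₚ.*-identityʳ (1 ℕ.+ m)))

  fraction : ∀ e → defined e ≡ true → Fraction e
  fraction N       _ = integer (poly nᶻ) (cong ι (sym value-of-n))
  fraction P       _ = integer (varₚ #p) (cong ι (sym (eval-var #p ε)))
  fraction Q       _ = integer (varₚ #q) (cong ι (sym (eval-var #q ε)))
  fraction R       _ = integer (varₚ #r) (cong ι (sym (eval-var #r ε)))
  fraction C₃      _ = choose (3 ℕ.+ m) 3 6 n₃ refl (λ ()) (trans (ℤₚ.pos-* (3 ℕ.+ m) (ff (2 ℕ.+ m) 2)) (cong (+ (3 ℕ.+ m) *_) ff-2))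
  fraction C₂      _ = choose (2 ℕ.+ m) 2 2 [n-1]₂ refl (λ ()) ff-2
  fraction (lit k) _ = integer (constₚ (+ k)) (trans (ι-lit k) (cong ι (sym (eval-const (+ k) ε))))
  fraction (⊝ a)   e with na , ea ← fraction a e =
    na , trans (sym (ℚₚ.neg-distribˡ-* (val a) (dn a))) (trans (cong ℚ.-_ ea) (sym (ι-negₚ (num a))))
  fraction (a ⊕ b) e with e₁ , e₂ ← ∧-true⁻¹ {defined a} e
    with na , ea ← fraction a e₁ | nb , eb ← fraction b e₂ = ⊠-nonzero (den a) (den b) na nb ,
    trans (cong ((val a ℚ.+ val b) ℚ.*_) (ι-⊠ (den a) (den b)))
      (trans (over-common (val a) (val b) (dn a) (dn b) (nm a) (nm b) ea eb)
      (sym (trans (ι-⊞ (num a ⊠ den b) (num b ⊠ den a)) (cong₂ ℚ._+_ (ι-⊠ (num a) (den b)) (ι-⊠ (num b) (den a))))))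
  fraction (a ⊖ b) e with e₁ , e₂ ← ∧-true⁻¹ {defined a} e
    with na , ea ← fraction a e₁ | nb , eb ← fraction b e₂ = ⊠-nonzero (den a) (den b) na nb ,
    trans (cong ((val a ℚ.- val b) ℚ.*_) (ι-⊠ (den a) (den b)))
      (trans (over-common (val a) (ℚ.- val b) (dn a) (dn b) (nm a) (ℚ.- nm b) ea
        (trans (sym (ℚₚ.neg-distribˡ-* (val b) (dn b))) (cong ℚ.-_ eb)))
      (trans (cong (nm a ℚ.* dn b ℚ.+_) (sym (ℚₚ.neg-distribˡ-* (nm b) (dn a))))
      (sym (trans (ι-⊞ (num a ⊠ den b) (negₚ (num b ⊠ den a))) (cong₂ ℚ._+_ (ι-⊠ (num a) (den b))
        (trans (ι-negₚ (num b ⊠ den a)) (cong ℚ.-_ (ι-⊠ (num b) (den a)))))))))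
  fraction (a ⊗ b) e with e₁ , e₂ ← ∧-true⁻¹ {defined a} e
    with na , ea ← fraction a e₁ | nb , eb ← fraction b e₂ = ⊠-nonzero (den a) (den b) na nb ,
    trans (cong ((val a ℚ.* val b) ℚ.*_) (ι-⊠ (den a) (den b)))
      (trans (product (val a) (val b) (dn a) (dn b) (nm a) (nm b) ea eb) (sym (ι-⊠ (num a) (num b))))
  fraction (a ⊘ b) e with e₁ , e₂₃ ← ∧-true⁻¹ {defined a} e with e₂ , e₃ ← ∧-true⁻¹ {defined b} e₂₃
    with na , ea ← fraction a e₁ | nb , eb ← fraction b e₂ =
    ⊠-nonzero (den a) (num b) na (pos≢0 (num b) e₃ (env m p q r)) ,
    trans (cong ((val a // val b) ℚ.*_) (ι-⊠ (den a) (num b)))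
      (trans (quotient (val a) (val b) (val a // val b) (dn a) (dn b) (nm a) (nm b) ea (//-* (val a) b≢0) eb)
             (sym (ι-⊠ (num a) (den b))))
    where
    b≢0 : val b ≢ 0ℚ
    b≢0 z = pos≢0 (num b) e₃ (env m p q r) (ι-injective (trans (sym eb) (trans (cong (ℚ._* dn b) z) (ℚₚ.*-zeroˡ (dn b)))))

-- Evaluation of the pattern sums

guard : ∀ b → Maybe (b ≡ true)
guard true  = just refl
guard false = nothing

eqGraphB : Graph → Graph → Bool
eqGraphB []            []              = true
eqGraphB ((i , j) ∷ E) ((i′ , j′) ∷ F) = (i ≡ᵇ i′) ∧ ((j ≡ᵇ j′) ∧ eqGraphB E F)
eqGraphB _             _               = false

eqGraphB-sound : ∀ E F → eqGraphB E F ≡ true → E ≡ F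
eqGraphB-sound []            []              e = refl
eqGraphB-sound ((i , j) ∷ E) ((i′ , j′) ∷ F) e =
  let p , e′ = ∧-true⁻¹ {i ≡ᵇ i′} e
      q , r  = ∧-true⁻¹ {j ≡ᵇ j′} e′
  in cong₂ _∷_ (cong₂ _,_ (≡ᵇ-true⁻¹ p) (≡ᵇ-true⁻¹ q)) (eqGraphB-sound E F r)

-- Numbering the vertices in order of first appearance brings a graph into
-- normal form, up to the order of its edges.
vertices : Graph → List ℕ
vertices = go []
  where
  add : ℕ → List ℕ → List ℕ
  add x xs = if notInB x xs then xs ++ x ∷ [] else xs
  go : List ℕ → Graph → List ℕ
  go acc []            = acc
  go acc ((i , j) ∷ E) = go (add j (add i acc)) E

-- A certificate that `E` is, up to the order of its edges, a renamed standard graph. As it carries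
-- its own evidence, the search that finds it needs no separate correctness proof.
record Shaped (k : ℕ) (E : Graph) : Set where
  field
    shape    : Shape
    names    : List ℕ
    size≡    : size shape ≡ k
    length≡  : length names ≡ k
    below    : All (_< k) names
    distinct : Unique names
    graph≡   : E ↭ relabel (app names) (graph shape)

distinctB⇒Unique : ∀ xs → distinctB xs ≡ true → Unique xs
distinctB⇒Unique []       e = []
distinctB⇒Unique (x ∷ xs) e = let p , q = ∧-true⁻¹ {notInB x xs} e in notInB-true⁻¹ xs p ∷ distinctB⇒Unique xs q

allB-sound : ∀ k xs → all (_<ᵇ k) xs ≡ true → All (_< k) xs
allB-sound k []       e = []
allB-sound k (x ∷ xs) e = let p , q = ∧-true⁻¹ {x <ᵇ k} e in <ᵇ-true⁻¹ p ∷ allB-sound k xs q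

matches : ℕ → Graph → List ℕ → Shape → Bool
matches k E names t = (size t ≡ᵇ k) ∧ ((length names ≡ᵇ k) ∧ (all (_<ᵇ k) names ∧ (distinctB names ∧
  eqGraphB E (relabel (app names) (graph t)))))

shaped : ∀ {k E F} → E ↭ F → ∀ t → matches k F (vertices F) t ≡ true → Shaped k E
shaped {k} {E} {F} E↭F t e =
  let a , e₁ = ∧-true⁻¹ {size t ≡ᵇ k} e
      b , e₂ = ∧-true⁻¹ {length (vertices F) ≡ᵇ k} e₁
      c , e₃ = ∧-true⁻¹ {all (_<ᵇ k) (vertices F)} e₂
      d , f  = ∧-true⁻¹ {distinctB (vertices F)} e₃
  in record
  { shape    = t
  ; names    = vertices F
  ; size≡    = ≡ᵇ-true⁻¹ a
  ; length≡  = ≡ᵇ-true⁻¹ b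
  ; below    = allB-sound k (vertices F) c
  ; distinct = distinctB⇒Unique (vertices F) d
  ; graph≡   = subst (E ↭_) (eqGraphB-sound F _ f) E↭F
  }

-- The numbering of the vertices depends on the order of the edges, while a standard graph lists its
-- edges in one fixed order; hence all six orders are tried.
orderings : (E : Graph) → List (∃ (E ↭_))
orderings (x ∷ y ∷ z ∷ []) =
  (_ , ↭-refl) ∷ (_ , prep x (↭-swap y z ↭-refl)) ∷ (_ , ↭-swap x y ↭-refl) ∷
  (_ , ↭-trans (↭-swap x y ↭-refl) (prep y (↭-swap x z ↭-refl))) ∷
  (_ , ↭-trans (prep x (↭-swap y z ↭-refl)) (↭-swap x z ↭-refl)) ∷
  (_ , ↭-trans (prep x (↭-swap y z ↭-refl)) (↭-trans (↭-swap x z ↭-refl) (prep z (↭-swap x y ↭-refl)))) ∷ []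
orderings E = (E , ↭-refl) ∷ []

classify : ∀ k E → Maybe (Shaped k E)
classify k E = search (orderings E)
  where
  shapes : List Shape
  shapes = c₁c₁c₁ ∷ c₁c₂ ∷ c₃ ∷ c₁c₁e ∷ c₁p₂ ∷ c₂e ∷ p₃ ∷ c₁ee ∷ p₂e ∷ eee ∷ []
  match : ∀ {F} → E ↭ F → List Shape → Maybe (Shaped k E)
  match         E↭F []       = nothing
  match {F} E↭F (t ∷ ts) with guard (matches k F (vertices F) t)
  ... | just e  = just (shaped E↭F t e)
  ... | nothing = match E↭F ts
  search : List (∃ (E ↭_)) → Maybe (Shaped k E)
  search []               = nothing
  search ((F , E↭F) ∷ Fs) with match E↭F shapes
  ... | just s  = just s
  ... | nothing = search Fs

order? : ∀ f₁ f₂ f₃ → Maybe (Order f₁ f₂ f₃)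
order? 1 2 3 = just o123
order? 1 3 2 = just o132
order? 2 1 3 = just o213
order? 2 3 1 = just o231
order? 3 1 2 = just o312
order? 3 2 1 = just o321
order? _ _ _ = nothing

#right : List Step → ℕ
#right []         = zero
#right (inL ∷ ℓ)  = #right ℓ
#right (inR ∷ ℓ)  = suc (#right ℓ)
#right (inLR ∷ ℓ) = suc (#right ℓ)

-- A merged sequence of length k with f + 1 free and c tight gaps has
-- (n)_k / (f! (n)_c) realisations, and f ≤ 6; 720 = 6! clears the denominators f!.
data Term (f₁ f₂ f₃ : ℕ) (ts : List Bool) (ℓ : List Step) : Set where
  infeasible : pull ℓ ts ≡ nothing → #left ℓ ≡ 3 → Term f₁ f₂ f₃ ts ℓ
  feasible   : ∀ {us} c f → pull ℓ ts ≡ just us → #free us ≡ suc f → c ℕ.* f ! ≡ 720 →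
    #left ℓ ≡ 3 → #right ℓ ≡ 3 →
    Shaped (length ℓ) (edges f₁ f₂ f₃ (left ℓ (upTo (length ℓ))) (right ℓ (upTo (length ℓ)))) → Term f₁ f₂ f₃ ts ℓ

-- 720 / f! for f ≤ 6, the last clause serving f = 6; larger f fail the test `inverse! f ℕ.* f !` =
-- 720 in `term`.
inverse! : ℕ → ℕ
inverse! 0 = 720
inverse! 1 = 720
inverse! 2 = 360
inverse! 3 = 120
inverse! 4 = 30
inverse! 5 = 6
inverse! _ = 1

private
  guard-≡ : ∀ m n → Maybe (m ≡ n)
  guard-≡ m n with guard (m ≡ᵇ n)
  ... | just e  = just (≡ᵇ-true⁻¹ e)
  ... | nothing = nothing

term : ∀ f₁ f₂ f₃ ts ℓ → Maybe (Term f₁ f₂ f₃ ts ℓ)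
term f₁ f₂ f₃ ts ℓ = go (pull ℓ ts) refl
  where
  go : ∀ us → pull ℓ ts ≡ us → Maybe (Term f₁ f₂ f₃ ts ℓ)
  go nothing   e = guard-≡ (#left ℓ) 3 >>= λ l → just (infeasible e l)
  go (just us) e = guard-≡ (#free us) (suc f) >>= λ free → guard-≡ (inverse! f ℕ.* f !) 720 >>= λ fact →
    guard-≡ (#left ℓ) 3 >>= λ l → guard-≡ (#right ℓ) 3 >>= λ r →
    classify (length ℓ) _ >>= λ s → just (feasible (inverse! f) f e free fact l r s)
    where f = ℕ.pred (#free us)

coefficient : ∀ {f₁ f₂ f₃ ts ℓ} → Term f₁ f₂ f₃ ts ℓ → ℕ
coefficient (infeasible _ _)           = 0
coefficient (feasible c _ _ _ _ _ _ _) = c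

termShape : ∀ {f₁ f₂ f₃ ts ℓ} → Term f₁ f₂ f₃ ts ℓ → Shape
-- An arbitrary default, since the coefficient of an infeasible term is 0.
termShape (infeasible _ _)             = eee
termShape (feasible _ _ _ _ _ _ _ s) = Shaped.shape s

left-map : ∀ (g : ℕ → ℕ) ℓ s → left ℓ (map g s) ≡ map g (left ℓ s)
left-map g []         s       = refl
left-map g (inL ∷ ℓ)  []      = refl
left-map g (inR ∷ ℓ)  []      = refl
left-map g (inLR ∷ ℓ) []      = refl
left-map g (inL ∷ ℓ)  (x ∷ s) = cong (g x ∷_) (left-map g ℓ s)
left-map g (inR ∷ ℓ)  (x ∷ s) = left-map g ℓ s
left-map g (inLR ∷ ℓ) (x ∷ s) = cong (g x ∷_) (left-map g ℓ s)

right-map : ∀ (g : ℕ → ℕ) ℓ s → right ℓ (map g s) ≡ map g (right ℓ s)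
right-map g []         s       = refl
right-map g (inL ∷ ℓ)  []      = refl
right-map g (inR ∷ ℓ)  []      = refl
right-map g (inLR ∷ ℓ) []      = refl
right-map g (inL ∷ ℓ)  (x ∷ s) = right-map g ℓ s
right-map g (inR ∷ ℓ)  (x ∷ s) = cong (g x ∷_) (right-map g ℓ s)
right-map g (inLR ∷ ℓ) (x ∷ s) = cong (g x ∷_) (right-map g ℓ s)

length-left : ∀ ℓ s → length s ≡ length ℓ → length (left ℓ s) ≡ #left ℓ
length-left []         s       e = refl
length-left (inL ∷ ℓ)  (x ∷ s) e = cong suc (length-left ℓ s (ℕₚ.suc-injective e))
length-left (inR ∷ ℓ)  (x ∷ s) e = length-left ℓ s (ℕₚ.suc-injective e)
length-left (inLR ∷ ℓ) (x ∷ s) e = cong suc (length-left ℓ s (ℕₚ.suc-injective e))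

length-right : ∀ ℓ s → length s ≡ length ℓ → length (right ℓ s) ≡ #right ℓ
length-right []         s       e = refl
length-right (inL ∷ ℓ)  (x ∷ s) e = length-right ℓ s (ℕₚ.suc-injective e)
length-right (inR ∷ ℓ)  (x ∷ s) e = cong suc (length-right ℓ s (ℕₚ.suc-injective e))
length-right (inLR ∷ ℓ) (x ∷ s) e = cong suc (length-right ℓ s (ℕₚ.suc-injective e))

map-app-upTo : ∀ s → map (app s) (upTo (length s)) ≡ s
map-app-upTo s = app-ext _ s len (λ i i< → let i<s = subst (i <_) len i< in
  trans (app-map (app s) (upTo (length s)) (subst (i <_) (sym (Listₚ.length-upTo (length s))) i<s)) (cong (app s) (app-upTo i<s)))
  where
  len : length (map (app s) (upTo (length s))) ≡ length s
  len = trans (Listₚ.length-map (app s) (upTo (length s))) (Listₚ.length-upTo (length s))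

edges-map : ∀ {f₁ f₂ f₃} → Order f₁ f₂ f₃ → ∀ g s t → length s ≡ 3 → length t ≡ 3 →
  edges f₁ f₂ f₃ (map g s) (map g t) ≡ relabel g (edges f₁ f₂ f₃ s t)
edges-map o123 g (x ∷ y ∷ z ∷ []) (u ∷ v ∷ w ∷ []) _ _ = refl
edges-map o132 g (x ∷ y ∷ z ∷ []) (u ∷ v ∷ w ∷ []) _ _ = refl
edges-map o213 g (x ∷ y ∷ z ∷ []) (u ∷ v ∷ w ∷ []) _ _ = refl
edges-map o231 g (x ∷ y ∷ z ∷ []) (u ∷ v ∷ w ∷ []) _ _ = refl
edges-map o312 g (x ∷ y ∷ z ∷ []) (u ∷ v ∷ w ∷ []) _ _ = refl
edges-map o321 g (x ∷ y ∷ z ∷ []) (u ∷ v ∷ w ∷ []) _ _ = refl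

-- Vertex i stands for the entry of the merged sequence at index i. One graph, computed from `upTo`,
-- thus represents all realisations of a path.
edges-relabel : ∀ {f₁ f₂ f₃} → Order f₁ f₂ f₃ → ∀ ℓ s → #left ℓ ≡ 3 → #right ℓ ≡ 3 → length s ≡ length ℓ →
  edges f₁ f₂ f₃ (left ℓ s) (right ℓ s) ≡ relabel (app s) (edges f₁ f₂ f₃ (left ℓ (upTo (length ℓ))) (right ℓ (upTo (length ℓ))))
edges-relabel {f₁} {f₂} {f₃} o ℓ s l r e = begin
  edges f₁ f₂ f₃ (left ℓ s) (right ℓ s)
    ≡⟨ cong (λ z → edges f₁ f₂ f₃ (left ℓ z) (right ℓ z)) (trans (sym (map-app-upTo s)) (cong (λ k → map (app s) (upTo k)) e)) ⟩
  edges f₁ f₂ f₃ (left ℓ (map (app s) ids)) (right ℓ (map (app s) ids))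
    ≡⟨ cong₂ (edges f₁ f₂ f₃) (left-map (app s) ℓ ids) (right-map (app s) ℓ ids) ⟩
  edges f₁ f₂ f₃ (map (app s) (left ℓ ids)) (map (app s) (right ℓ ids))
    ≡⟨ edges-map o (app s) (left ℓ ids) (right ℓ ids) (trans (length-left ℓ ids len) l) (trans (length-right ℓ ids len) r) ⟩
  relabel (app s) (edges f₁ f₂ f₃ (left ℓ ids) (right ℓ ids)) ∎
  where
  open ≡-Reasoning
  ids = upTo (length ℓ)
  len = Listₚ.length-upTo (length ℓ)

respects-↭ : ∀ π {E F} → E ↭ F → respects π E ≡ respects π F
respects-↭ π _↭_.refl        = refl
respects-↭ π (prep (i , j) p) = cong ((app π i ≡ᵇ j) ∧_) (respects-↭ π p)
respects-↭ π {_ ∷ _ ∷ E} {_ ∷ _ ∷ F} (↭-swap (i , j) (i′ , j′) p) = begin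
  (app π i ≡ᵇ j) ∧ ((app π i′ ≡ᵇ j′) ∧ respects π E)  ≡⟨ sym (∧-assoc (app π i ≡ᵇ j) _ _) ⟩
  ((app π i ≡ᵇ j) ∧ (app π i′ ≡ᵇ j′)) ∧ respects π E  ≡⟨ cong₂ _∧_ (∧-comm (app π i ≡ᵇ j) _) (respects-↭ π p) ⟩
  ((app π i′ ≡ᵇ j′) ∧ (app π i ≡ᵇ j)) ∧ respects π F  ≡⟨ ∧-assoc (app π i′ ≡ᵇ j′) _ _ ⟩
  (app π i′ ≡ᵇ j′) ∧ ((app π i ≡ᵇ j) ∧ respects π F)  ∎
  where open ≡-Reasoning
respects-↭ π (_↭_.trans p q)  = trans (respects-↭ π p) (respects-↭ π q)

weight-↭ : ∀ n ps {E F} → E ↭ F → weight n ps E ≡ weight n ps F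
weight-↭ n ps p = ∑-cong (ofType n ps) (λ {π} _ → cong 𝟙 (respects-↭ π p))

graph-Below : ∀ t → Below (size t) (graph t)
graph-Below t = check t (accepted t)
  where
  belowB : ℕ → Graph → Bool
  belowB k []            = true
  belowB k ((i , j) ∷ E) = (i <ᵇ k) ∧ ((j <ᵇ k) ∧ belowB k E)
  belowB-sound : ∀ k E → belowB k E ≡ true → Below k E
  belowB-sound k []            e = []
  belowB-sound k ((i , j) ∷ E) e =
    let p , e′ = ∧-true⁻¹ {i <ᵇ k} e ; q , r = ∧-true⁻¹ {j <ᵇ k} e′ in (<ᵇ-true⁻¹ p , <ᵇ-true⁻¹ q) ∷ belowB-sound k E r
  check : ∀ t → belowB (size t) (graph t) ≡ true → Below (size t) (graph t)
  check t = belowB-sound (size t) (graph t)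
  accepted : ∀ t → belowB (size t) (graph t) ≡ true
  accepted c₁c₁c₁ = refl
  accepted c₁c₂   = refl
  accepted c₃     = refl
  accepted c₁c₁e  = refl
  accepted c₁p₂   = refl
  accepted c₂e    = refl
  accepted p₃     = refl
  accepted c₁ee   = refl
  accepted p₂e    = refl
  accepted eee    = refl

map-app-Labelling : ∀ {n k s t} → length s ≡ k → Labelling n s → Labelling k t → Labelling n (map (app s) t)
map-app-Labelling {n} {k} {s} refl (b , u) (b′ , u′) = Allₚ.map⁺ (All.map (app-All s b) b′) , unique _ b′ u′
  where
  inj-s : Injective k s
  inj-s = distinctB⇒Injective s (Unique⇒distinctB s u)
  unique : ∀ t → All (_< k) t → Unique t → Unique (map (app s) t)
  unique []       _        _        = []
  unique (x ∷ xs) (p ∷ ps) (v ∷ vs) = Allₚ.map⁺ (All.zipWith (λ { (q , ne) e → ne (inj-s p q e) }) (ps , v)) ∷ unique xs ps vs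

relabel-↭ : ∀ f {E F} → E ↭ F → relabel f E ↭ relabel f F
relabel-↭ f = ↭-map⁺ _

module _ (n : ℕ) (ps : List ℕ) where
  private
    allCopies : Shape → ℤ
    allCopies t = ∑[ π ∈ ofType n ps ] copies n π t

  -- The names of the vertices of the standard graph, followed by `s`, form a labelling again, so
  -- the double counting of `∑-weight` applies to the shape itself.
  weight-Shaped : ∀ {k E} (S : Shaped k E) → let open Shaped S in ∀ {s} → length s ≡ k → Labelling n s →
    + ff n k * weight n ps (relabel (app s) E) ≡ allCopies shape
  weight-Shaped {k} {E} S {s} l lab = begin
    + ff n k * weight n ps (relabel (app s) E)
      ≡⟨ cong (+ ff n k *_) (weight-↭ n ps (relabel-↭ (app s) graph≡)) ⟩
    + ff n k * weight n ps (relabel (app s) (relabel (app names) (graph shape)))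
      ≡⟨ cong (λ F → + ff n k * weight n ps F) (sym (relabel-map (app s) names (graph shape) below′)) ⟩
    + ff n k * weight n ps (relabel (app (map (app s) names)) (graph shape))
      ≡⟨ sym (trans (cong (λ z → ∑[ π ∈ ofType n ps ] ∑[ t ∈ inj n z [] ] 𝟙 (respects π (relabel (app t) (graph shape)))) size≡)
           (∑-weight n k ps (graph shape) below″ (trans (Listₚ.length-map (app s) names) length≡)
           (map-app-Labelling l lab (below , distinct)))) ⟩
    allCopies shape ∎
    where
    open ≡-Reasoning
    open Shaped S
    below″ : Below k (graph shape)
    below″ = subst (λ z → Below z (graph shape)) size≡ (graph-Below shape)
    below′ : Below (length names) (graph shape)
    below′ = subst (λ z → Below z (graph shape)) (sym length≡) below″

  -- For n < k there are (n)_k = 0 labellings. This covers the larger shapes when n is 3, 4 or 5.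
  allCopies-empty : ∀ t → n < size t → allCopies t ≡ 0ℤ
  allCopies-empty t n<k = ∑-zero (ofType n ps) (λ {π} _ → cong (λ xs → ∑[ s ∈ xs ] 𝟙 (respects π (relabel (app s) (graph t))))
    (empty (inj n (size t) []) (ℤₚ.+-injective (trans (sym (∑-length (inj n (size t) []))) (trans (count-inj n (size t)) (cong +_ (ff-< n<k)))))))
    where
    empty : ∀ (xs : List (List ℕ)) → length xs ≡ 0 → xs ≡ []
    empty [] _ = refl

  -- With T realisations of common weight ω and t tight gaps, T f! (n)_t = (n)_k by
  -- `count-tight-ff`, and (n)_k ω is the total number of copies by `weight-Shaped`; the two
  -- combine. For n < k both sides vanish.
  contribution : ∀ {f₁ f₂ f₃} → Order f₁ f₂ f₃ → ∀ ts → length ts ≡ 4 → ∀ {ℓ} (T : Term f₁ f₂ f₃ ts ℓ) →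
    + (720 ℕ.* ff n (#tight ts)) * (∑[ s ∈ dec (length ℓ) n ] (𝟙 (tight ts n (left ℓ s)) * weight n ps (edges f₁ f₂ f₃ (left ℓ s) (right ℓ s)))) ≡
    + coefficient T * allCopies (termShape T)
  contribution {f₁} {f₂} {f₃} o ts lts {ℓ} (infeasible none l3) = trans (cong (+ (720 ℕ.* ff n (#tight ts)) *_) (∑-zero (dec (length ℓ) n) (λ {s} s∈ →
      let ls , d = ∈-dec⁻ (length ℓ) n s∈ in
      trans (cong (λ b → 𝟙 b * weight n ps (edges f₁ f₂ f₃ (left ℓ s) (right ℓ s))) (trans (tight-pull ℓ ts n s (trans lts (cong suc (sym l3))) ls d) (cong (λ m → tight-maybe m n s) none)))
            (ℤₚ.*-zeroˡ (weight n ps (edges f₁ f₂ f₃ (left ℓ s) (right ℓ s)))))))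
    (trans (ℤₚ.*-zeroʳ (+ (720 ℕ.* ff n (#tight ts)))) (sym (ℤₚ.*-zeroˡ (allCopies eee))))
  contribution {f₁} {f₂} {f₃} o ts lts {ℓ} (feasible {us} c f pulled free fact l r S) with length ℓ ℕ.≤? n
  ... | no k≰n rewrite dec-empty {length ℓ} {n} (ℕₚ.≰⇒> k≰n) =
    trans (ℤₚ.*-zeroʳ (+ (720 ℕ.* ff n (#tight ts)))) (sym (trans (cong (+ c *_)
      (allCopies-empty (Shaped.shape S) (subst (n <_) (sym (Shaped.size≡ S)) (ℕₚ.≰⇒> k≰n)))) (ℤₚ.*-zeroʳ (+ c))))
  ... | yes k≤n = begin
    + (720 ℕ.* ffc) * (∑[ s ∈ dec k n ] (𝟙 (tight ts n (left ℓ s)) * weight n ps (edges f₁ f₂ f₃ (left ℓ s) (right ℓ s))))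
      ≡⟨ cong (+ (720 ℕ.* ffc) *_) (∑-cong (dec k n) (λ {s} s∈ → let ls , d = ∈-dec⁻ k n s∈ in
           cong₂ (λ b w → 𝟙 b * w)
             (trans (tight-pull ℓ ts n s (trans lts (cong suc (sym l))) ls d) (cong (λ m → tight-maybe m n s) pulled))
             (same-weight ls (Desc⇒Labelling n s d)))) ⟩
    + (720 ℕ.* ffc) * (∑[ s ∈ dec k n ] (𝟙 (tight us n s) * ω))
      ≡⟨ cong₂ _*_ (cong (λ z → + (z ℕ.* ffc)) (sym fact)) (∑-*ʳ (dec k n) (λ s → 𝟙 (tight us n s)) ω) ⟩
    + (c ℕ.* f ! ℕ.* ffc) * ((∑[ s ∈ dec k n ] 𝟙 (tight us n s)) * ω)
      ≡⟨ cong (_* ((∑[ s ∈ dec k n ] 𝟙 (tight us n s)) * ω)) (trans (cong +_ (ℕₚ.*-assoc c (f !) ffc)) (ℤₚ.pos-* c (f ! ℕ.* ffc))) ⟩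
    (+ c * + (f ! ℕ.* ffc)) * ((∑[ s ∈ dec k n ] 𝟙 (tight us n s)) * ω)
      ≡⟨ rearrange (+ c) (+ (f ! ℕ.* ffc)) (∑[ s ∈ dec k n ] 𝟙 (tight us n s)) ω ⟩
    + c * ((∑[ s ∈ dec k n ] 𝟙 (tight us n s)) * + (f ! ℕ.* ffc) * ω)
      ≡⟨ cong (λ z → + c * (z * ω)) (trans (cong (λ z → (∑[ s ∈ dec k n ] 𝟙 (tight us n s)) * + (f ! ℕ.* ff n z)) (sym #us)) (count-tight-ff us k f n lus free k≤n)) ⟩
    + c * (+ ff n k * ω)
      ≡⟨ cong (+ c *_) (weight-Shaped S (Listₚ.length-upTo k) labk) ⟩
    + c * allCopies (Shaped.shape S) ∎
    where
    open ≡-Reasoning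
    k = length ℓ
    ffc = ff n (#tight ts)
    E = edges f₁ f₂ f₃ (left ℓ (upTo k)) (right ℓ (upTo k))
    ω = weight n ps (relabel (app (upTo k)) E)
    lus : length us ≡ suc k
    lus = proj₁ (pull-just ℓ ts (trans lts (cong suc (sym l))) pulled)
    #us : #tight us ≡ #tight ts
    #us = proj₂ (pull-just ℓ ts (trans lts (cong suc (sym l))) pulled)
    labk : Labelling n (upTo k)
    labk = All.tabulate (λ x∈ → ℕₚ.<-≤-trans (∈-upTo⁻ x∈) k≤n) , Uniqueₚ.upTo⁺ k
    rearrange : ∀ c q t w → (c * q) * (t * w) ≡ c * (t * q * w)
    rearrange = solve-∀
    -- Both weights times (n)_k equal the same total number of copies, and (n)_k is nonzero as k ≤
    -- n.
    same-weight : ∀ {s} → length s ≡ k → Labelling n s → weight n ps (edges f₁ f₂ f₃ (left ℓ s) (right ℓ s)) ≡ ω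
    same-weight {s} ls lab = trans (cong (weight n ps) (edges-relabel o ℓ s l r ls))
      (ℤₚ.*-cancelˡ-≡ (+ ff n k) _ _ {{ff-NonZero k≤n}} (trans (weight-Shaped S ls lab) (sym (weight-Shaped S (Listₚ.length-upTo k) labk))))

-- With p = F₁, 2 q = F₂ - F₁ and 3 r = F₃ - F₁.

value : Shape → ZExpr 4
value = go nᶻ (var #p) (var #q *ᶻ con 2) (var #r *ᶻ con 3)
  where
  go : ZExpr 4 → ZExpr 4 → ZExpr 4 → ZExpr 4 → Shape → ZExpr 4
  go n f d e c₁c₁c₁ = f *ᶻ ((f -ᶻ con 1) *ᶻ (f -ᶻ con 2))
  go n f d e c₁c₂   = f *ᶻ d
  go n f d e c₃     = e
  go n f d e c₁c₁e  = f *ᶻ ((f -ᶻ con 1) *ᶻ (n -ᶻ f))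
  go n f d e c₁p₂   = f *ᶻ (n -ᶻ f -ᶻ d)
  go n f d e c₂e    = d *ᶻ (n -ᶻ f -ᶻ con 2)
  go n f d e p₃     = n -ᶻ f -ᶻ d -ᶻ e
  go n f d e c₁ee   = f *ᶻ ((n -ᶻ f) *ᶻ (n -ᶻ f -ᶻ con 3) +ᶻ d)
  go n f d e p₂e    = (n -ᶻ f -ᶻ d) *ᶻ (n -ᶻ f -ᶻ con 4) +ᶻ e
  go n f d e eee    = (n -ᶻ f -ᶻ con 6) *ᶻ ((n -ᶻ f) *ᶻ (n -ᶻ f -ᶻ con 3) +ᶻ d) +ᶻ
    con 2 *ᶻ (d *ᶻ (n -ᶻ f -ᶻ con 2)) +ᶻ con 2 *ᶻ (n -ᶻ f -ᶻ d -ᶻ e)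

module _ (m : ℕ) {ps π} (w : IsWord (3 ℕ.+ m) π) (injective : Injective (3 ℕ.+ m) π)
         (total : sum ps ≡ 3 ℕ.+ m) (type : cycleType π ≡ ps) where
  private
    n = 3 ℕ.+ m
    open Copies n π w injective
    p = countB (_≡ᵇ 1) ps
    q = countB (_≡ᵇ 2) ps
    r = countB (_≡ᵇ 3) ps
    3≤n : 3 ≤ n
    3≤n = s≤s (s≤s (s≤s z≤n))

    form : (k f d e : ℤ) → Shape → ℤ
    form k f d e c₁c₁c₁ = f * ((f - 1ℤ) * (f - + 2))
    form k f d e c₁c₂   = f * d
    form k f d e c₃     = e
    form k f d e c₁c₁e  = f * ((f - 1ℤ) * (k - f))
    form k f d e c₁p₂   = f * (k - f - d)
    form k f d e c₂e    = d * (k - f - + 2)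
    form k f d e p₃     = k - f - d - e
    form k f d e c₁ee   = f * ((k - f) * (k - f - + 3) + d)
    form k f d e p₂e    = (k - f - d) * (k - f - + 4) + e
    form k f d e eee    = (k - f - + 6) * ((k - f) * (k - f - + 3) + d) + + 2 * (d * (k - f - + 2)) + + 2 * (k - f - d - e)

    nonpath₂ : ∀ k f g → k - g ≡ k - f - (g - f)
    nonpath₂ = solve-∀
    nonpath₃ : ∀ k f g h → k - g - h + f ≡ k - f - (g - f) - (h - f)
    nonpath₃ = solve-∀

    copies-form : ∀ t → copies n π t ≡ form (+ n) F₁ (F₂ - F₁) (F₃ - F₁) t
    copies-form c₁c₁c₁ = copies-c₁c₁c₁
    copies-form c₁c₂   = copies-c₁c₂
    copies-form c₃     = copies-c₃
    copies-form c₁c₁e  = copies-c₁c₁e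
    copies-form c₁p₂   = trans copies-c₁p₂ (cong (F₁ *_) (nonpath₂ (+ n) F₁ F₂))
    copies-form c₂e    = copies-c₂e
    copies-form p₃     = trans copies-p₃ (nonpath₃ (+ n) F₁ F₂ F₃)
    copies-form c₁ee   = copies-c₁ee
    copies-form p₂e    = trans copies-p₂e (cong (λ z → z * (+ n - F₁ - + 4) + (F₃ - F₁)) (nonpath₂ (+ n) F₁ F₂))
    copies-form eee    = trans copies-eee (cong (λ z → (+ n - F₁ - + 6) * ((+ n - F₁) * (+ n - F₁ - + 3) + (F₂ - F₁)) +
      + 2 * ((F₂ - F₁) * (+ n - F₁ - + 2)) + + 2 * z) (nonpath₃ (+ n) F₁ F₂ F₃))

    form-value : ∀ t → form (+ n) (+ p) (+ q * + 2) (+ r * + 3) t ≡ ⟦ value t ⟧ᶻ (naturals (env m p q r))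
    form-value c₁c₁c₁ = refl
    form-value c₁c₂   = refl
    form-value c₃     = refl
    form-value c₁c₁e  = refl
    form-value c₁p₂   = refl
    form-value c₂e    = refl
    form-value p₃     = refl
    form-value c₁ee   = refl
    form-value p₂e    = refl
    form-value eee    = refl

    cong₃ : ∀ {a a′ b b′ c c′} t → a ≡ a′ → b ≡ b′ → c ≡ c′ → form (+ n) a b c t ≡ form (+ n) a′ b′ c′ t
    cong₃ t refl refl refl = refl

  copies-value : ∀ t → copies n π t ≡ ⟦ value t ⟧ᶻ (naturals (env m p q r))
  copies-value t = trans (copies-form t) (trans
    (cong₃ t (F₁-mult w injective 3≤n total type) (F₂-mult w injective 3≤n total type) (F₃-mult w injective 3≤n total type))
    (form-value t))

Terms : ℕ → ℕ → ℕ → List Bool → List (List Step) → Set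
Terms f₁ f₂ f₃ ts = All (Term f₁ f₂ f₃ ts)

terms : ∀ f₁ f₂ f₃ ts ℓs → Maybe (Terms f₁ f₂ f₃ ts ℓs)
terms f₁ f₂ f₃ ts []       = just []
terms f₁ f₂ f₃ ts (ℓ ∷ ℓs) = term f₁ f₂ f₃ ts ℓ >>= λ T → terms f₁ f₂ f₃ ts ℓs >>= λ Ts → just (T ∷ Ts)

-- By `pat-total`, its value is 720 (n)_c times the mean of the pattern over the class, where c is
-- the number of tight flags.
patternPoly : ∀ {f₁ f₂ f₃ ts ℓs} → Terms f₁ f₂ f₃ ts ℓs → Poly 4
patternPoly []       = constₚ 0ℤ
patternPoly (T ∷ Ts) = constₚ (+ coefficient T) ⊠ poly (value (termShape T)) ⊞ patternPoly Ts

-- (n)_c, for c ≤ 3 only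
ffᶻ : ℕ → ZExpr 4
ffᶻ 0 = con 1
ffᶻ 1 = nᶻ
ffᶻ 2 = nᶻ *ᶻ (con 2 +ᶻ var #m)
ffᶻ _ = n₃

ffᶻ-value : ∀ m p q r c → c < 4 → ⟦ ffᶻ c ⟧ᶻ (naturals (env m p q r)) ≡ + ff (3 ℕ.+ m) c
ffᶻ-value m p q r 0 _ = refl
ffᶻ-value m p q r 1 _ = cong +_ (sym (ℕₚ.*-identityʳ (3 ℕ.+ m)))
ffᶻ-value m p q r 2 _ = trans (sym (ℤₚ.pos-* (3 ℕ.+ m) (2 ℕ.+ m))) (cong (λ z → + ((3 ℕ.+ m) ℕ.* z)) (sym (ℕₚ.*-identityʳ (2 ℕ.+ m))))
ffᶻ-value m p q r 3 _ = trans (cong (+ (3 ℕ.+ m) *_) (sym (ℤₚ.pos-* (2 ℕ.+ m) (1 ℕ.+ m))))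
  (trans (sym (ℤₚ.pos-* (3 ℕ.+ m) ((2 ℕ.+ m) ℕ.* (1 ℕ.+ m)))) (cong (λ z → + ((3 ℕ.+ m) ℕ.* ((2 ℕ.+ m) ℕ.* z))) (sym (ℕₚ.*-identityʳ (1 ℕ.+ m)))))
ffᶻ-value m p q r (suc (suc (suc (suc c)))) (s≤s (s≤s (s≤s (s≤s ()))))

module _ (m : ℕ) (ps : List ℕ) (total : sum ps ≡ 3 ℕ.+ m) where
  private
    n = 3 ℕ.+ m
    C = ofType n ps
    ε = naturals (env m (countB (_≡ᵇ 1) ps) (countB (_≡ᵇ 2) ps) (countB (_≡ᵇ 3) ps))

  ∑-copies : ∀ t → (∑[ π ∈ C ] copies n π t) ≡ + length C * ⟦ value t ⟧ᶻ ε
  ∑-copies t = trans (∑-cong C (λ π∈ → let w , i , type = ∈-ofType⁻ {n} {ps} π∈ in copies-value m w i total type t))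
    (∑-const C (⟦ value t ⟧ᶻ ε))

  pat-total : ∀ l f₁ g₁ f₂ g₂ f₃ r → Order f₁ f₂ f₃ → let φ = vp l f₁ g₁ f₂ g₂ f₃ r in
    (Ts : Terms f₁ f₂ f₃ (flags φ) (paths 3 3)) →
    + (720 ℕ.* ff n (#tight (flags φ))) * (∑[ π ∈ C ] (+ pat φ π)) ≡ + length C * eval (patternPoly Ts) ε
  pat-total l f₁ g₁ f₂ g₂ f₃ r o Ts = trans (cong (A *_) (∑-pat n ps l f₁ g₁ f₂ g₂ f₃ r o))
    (trans (sym (∑-*ˡ (paths 3 3) A part)) (go {paths 3 3} Ts))
    where
    open ≡-Reasoning
    φ = vp l f₁ g₁ f₂ g₂ f₃ r
    A = + (720 ℕ.* ff n (#tight (flags φ)))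
    part : List Step → ℤ
    part ℓ = ∑[ s ∈ dec (length ℓ) n ] (𝟙 (tight (flags φ) n (left ℓ s)) * weight n ps (edges f₁ f₂ f₃ (left ℓ s) (right ℓ s)))
    lem : ∀ c k v w → c * (k * v) + k * w ≡ k * (c * v + w)
    lem = solve-∀
    go : ∀ {ℓs} (Ts : Terms f₁ f₂ f₃ (flags φ) ℓs) → (∑[ ℓ ∈ ℓs ] (A * part ℓ)) ≡ + length C * eval (patternPoly Ts) ε
    go []       = sym (trans (cong (+ length C *_) (eval-const {4} 0ℤ ε)) (ℤₚ.*-zeroʳ (+ length C)))
    go {ℓ ∷ ℓs} (T ∷ Ts) = begin
      A * part ℓ + (∑[ ℓ ∈ ℓs ] (A * part ℓ))
        ≡⟨ cong₂ _+_ (trans (contribution n ps o (flags φ) refl T) (cong (+ coefficient T *_) (∑-copies (termShape T)))) (go Ts) ⟩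
      + coefficient T * (+ length C * ⟦ value (termShape T) ⟧ᶻ ε) + + length C * eval (patternPoly Ts) ε
        ≡⟨ lem (+ coefficient T) (+ length C) _ _ ⟩
      + length C * (+ coefficient T * ⟦ value (termShape T) ⟧ᶻ ε + eval (patternPoly Ts) ε)
        ≡⟨ cong (+ length C *_) (sym (trans (eval-⊞ (constₚ (+ coefficient T) ⊠ poly (value (termShape T))) (patternPoly Ts) ε)
             (cong (_+ eval (patternPoly Ts) ε) (trans (eval-⊠ (constₚ (+ coefficient T)) (poly (value (termShape T))) ε)
               (cong₂ _*_ (eval-const {4} (+ coefficient T) ε) (eval-poly (value (termShape T)) ε)))))) ⟩
      + length C * eval (patternPoly (T ∷ Ts)) ε ∎

-- The table, symbolically

record QRow : Set where
  constructor qrow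
  field
    pats          : List VPat
    b₁ b₂ b₃ b₄ b₆ : QExpr
open QRow

-- The claimed mean `num e` / `den e` is compared with `patternPoly Ts` / (720 (n)_c) after
-- cross-multiplication; c < 4 is the range in which `ffᶻ` represents (n)_c.
validTerms : ∀ (e : QExpr) {f₁ f₂ f₃ ts} → Maybe (Order f₁ f₂ f₃) → Maybe (Terms f₁ f₂ f₃ ts (paths 3 3)) → Bool
validTerms e {ts = ts} (just _) (just Ts) =
  (#tight ts <ᵇ 4) ∧ equal (poly (con 720 *ᶻ ffᶻ (#tight ts)) ⊠ num e) (patternPoly Ts ⊠ den e)
validTerms e _ _ = false

valid : QExpr → VPat → Bool
valid e φ@(vp l f₁ g₁ f₂ g₂ f₃ r) = validTerms e (order? f₁ f₂ f₃) (terms f₁ f₂ f₃ (flags φ) (paths 3 3))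

qrhs : QRow → QExpr
qrhs ρ = b₁ ρ ⊗ lit 1 ⊕ b₂ ρ ⊗ p₁ ⊕ b₃ ρ ⊗ (binom₂ ⊕ Q ⊖ lit 1) ⊕ b₄ ρ ⊗ (binom₂ ⊖ Q) ⊕ b₆ ρ ⊗ (lit 2 ⊗ binom₃ ⊖ P ⊖ R ⊕ lit 2)
  where
  p₁ binom₂ binom₃ : QExpr
  p₁     = P ⊖ lit 1
  binom₂ = p₁ ⊗ (p₁ ⊖ lit 1) ⊘ lit 2
  binom₃ = p₁ ⊗ (p₁ ⊖ lit 1) ⊗ (p₁ ⊖ lit 2) ⊘ lit 6

validRow : QRow → Bool
validRow ρ = defined (qrhs ρ) ∧ all (valid (qrhs ρ)) (pats ρ)

qtable : List QRow
qtable =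
    qrow ((vp rd 1 dash 2 dash 3 rd) ∷ [])
      (C₃ ⊘ lit 6) ((N ⊕ lit 1) ⊗ (lit 3 ⊗ N ⊖ lit 4) ⊘ lit 60) ((N ⊕ lit 1) ⊘ lit 30) ((lit 3 ⊗ N ⊖ lit 2) ⊘ lit 30) (lit 1 ⊘ lit 15)
  ∷ qrow ((vp rd 1 dash 3 dash 2 rd) ∷ (vp rd 2 dash 1 dash 3 rd) ∷ [])
      (C₃ ⊘ lit 6) ((N ⊕ lit 1) ⊗ (N ⊖ lit 3) ⊘ lit 60) (⊝ ((N ⊕ lit 1) ⊘ lit 60)) (⊝ ((N ⊕ lit 1) ⊘ lit 20)) (⊝ (lit 1 ⊘ lit 30))
  ∷ qrow ((vp rd 2 dash 3 dash 1 rd) ∷ (vp rd 3 dash 1 dash 2 rd) ∷ [])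
      (C₃ ⊘ lit 6) (⊝ ((N ⊕ lit 1) ⊗ (lit 3 ⊗ N ⊖ lit 4) ⊘ lit 120)) (⊝ ((N ⊕ lit 1) ⊘ lit 60)) ((N ⊕ lit 1) ⊘ lit 30) (⊝ (lit 1 ⊘ lit 30))
  ∷ qrow ((vp rd 3 dash 2 dash 1 rd) ∷ [])
      (C₃ ⊘ lit 6) (⊝ ((N ⊕ lit 1) ⊗ (N ⊖ lit 3) ⊘ lit 30)) ((N ⊕ lit 1) ⊘ lit 30) (⊝ ((lit 2 ⊗ N ⊖ lit 3) ⊘ lit 30)) (lit 1 ⊘ lit 15)
  ∷ qrow ((vp rd 1 adj 2 dash 3 rd) ∷ (vp rd 1 dash 2 adj 3 rd) ∷ [])
      (C₂ ⊘ lit 6) ((N ⊗ N ⊕ lit 3 ⊗ N ⊖ lit 6) ⊘ (lit 12 ⊗ N)) ((N ⊕ lit 2) ⊘ (lit 12 ⊗ N)) ((lit 5 ⊗ N ⊖ lit 6) ⊘ (lit 12 ⊗ N)) (lit 1 ⊘ (lit 4 ⊗ N))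
  ∷ qrow ((vp rd 1 adj 3 dash 2 rd) ∷ (vp rd 2 dash 1 adj 3 rd) ∷ [])
      (C₂ ⊘ lit 6) ((N ⊖ lit 3) ⊘ (lit 6 ⊗ N)) (⊝ ((N ⊖ lit 1) ⊘ (lit 6 ⊗ N))) (⊝ (lit 1 ⊘ (lit 2 ⊗ N))) (lit 0)
  ∷ qrow ((vp rd 2 adj 1 dash 3 rd) ∷ (vp rd 1 dash 3 adj 2 rd) ∷ [])
      (C₂ ⊘ lit 6) (N ⊗ (N ⊖ lit 3) ⊘ (lit 12 ⊗ N)) ((N ⊖ lit 4) ⊘ (lit 12 ⊗ N)) (⊝ (lit 1 ⊘ lit 4)) (⊝ (lit 1 ⊘ (lit 4 ⊗ N)))
  ∷ qrow ((vp rd 2 adj 3 dash 1 rd) ∷ (vp rd 3 dash 1 adj 2 rd) ∷ [])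
      (C₂ ⊘ lit 6) (⊝ (N ⊗ (N ⊖ lit 1) ⊘ (lit 12 ⊗ N))) ((N ⊖ lit 4) ⊘ (lit 12 ⊗ N)) (lit 1 ⊘ lit 12) (⊝ (lit 1 ⊘ (lit 4 ⊗ N)))
  ∷ qrow ((vp rd 3 adj 1 dash 2 rd) ∷ (vp rd 2 dash 3 adj 1 rd) ∷ [])
      (C₂ ⊘ lit 6) (⊝ ((lit 2 ⊗ N ⊖ lit 3) ⊘ (lit 6 ⊗ N))) (⊝ ((N ⊖ lit 1) ⊘ (lit 6 ⊗ N))) (lit 1 ⊘ (lit 2 ⊗ N)) (lit 0)
  ∷ qrow ((vp rd 3 adj 2 dash 1 rd) ∷ (vp rd 3 dash 2 adj 1 rd) ∷ [])
      (C₂ ⊘ lit 6) (⊝ ((N ⊕ lit 2) ⊗ (N ⊖ lit 3) ⊘ (lit 12 ⊗ N))) ((N ⊕ lit 2) ⊘ (lit 12 ⊗ N)) (⊝ ((N ⊖ lit 2) ⊘ (lit 4 ⊗ N))) (lit 1 ⊘ (lit 4 ⊗ N))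
  ∷ qrow ((vp sq 1 dash 2 dash 3 rd) ∷ (vp rd 1 dash 2 dash 3 sq) ∷ [])
      (C₂ ⊘ lit 6) ((lit 5 ⊗ N ⊖ lit 7) ⊘ lit 24) (lit 1 ⊘ lit 8) (lit 5 ⊘ lit 24) (lit 1 ⊘ (lit 8 ⊗ N))
  ∷ qrow ((vp sq 1 dash 3 dash 2 rd) ∷ (vp rd 2 dash 1 dash 3 sq) ∷ [])
      (C₂ ⊘ lit 6) ((N ⊖ lit 3) ⊘ lit 8) (⊝ (lit 1 ⊘ lit 8)) (⊝ (lit 5 ⊘ lit 24)) (⊝ (lit 1 ⊘ (lit 8 ⊗ N)))
  ∷ qrow ((vp sq 2 dash 1 dash 3 rd) ∷ (vp rd 1 dash 3 dash 2 sq) ∷ [])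
      (C₂ ⊘ lit 6) (lit 0) (lit 0) (⊝ (lit 1 ⊘ lit 6)) (lit 0)
  ∷ qrow ((vp sq 2 dash 3 dash 1 rd) ∷ (vp rd 3 dash 1 dash 2 sq) ∷ [])
      (C₂ ⊘ lit 6) (⊝ ((N ⊖ lit 2) ⊘ lit 6)) (lit 0) (lit 1 ⊘ lit 6) (lit 0)
  ∷ qrow ((vp sq 3 dash 1 dash 2 rd) ∷ (vp rd 2 dash 3 dash 1 sq) ∷ [])
      (C₂ ⊘ lit 6) (⊝ ((N ⊕ lit 1) ⊘ lit 24)) (⊝ (lit 1 ⊘ lit 8)) (lit 1 ⊘ lit 8) (⊝ (lit 1 ⊘ (lit 8 ⊗ N)))
  ∷ qrow ((vp sq 3 dash 2 dash 1 rd) ∷ (vp rd 3 dash 2 dash 1 sq) ∷ [])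
      (C₂ ⊘ lit 6) (⊝ ((N ⊖ lit 3) ⊘ lit 8)) (lit 1 ⊘ lit 8) (⊝ (lit 1 ⊘ lit 8)) (lit 1 ⊘ (lit 8 ⊗ N))
  ∷ qrow ((vp rd 1 adj 2 dash 3 sq) ∷ (vp sq 1 dash 2 adj 3 rd) ∷ [])
      ((N ⊖ lit 2) ⊘ lit 6) (lit 1 ⊘ lit 3) ((N ⊕ lit 2) ⊘ (lit 6 ⊗ N₂)) (lit 1 ⊘ (lit 2 ⊗ (N ⊖ lit 1))) (lit 1 ⊘ (lit 2 ⊗ N₂))
  ∷ qrow ((vp rd 1 adj 3 dash 2 sq) ∷ (vp sq 2 dash 1 adj 3 rd) ∷ [])
      ((N ⊖ lit 2) ⊘ lit 6) (⊝ ((N ⊖ lit 3) ⊘ (lit 6 ⊗ N))) (⊝ ((lit 2 ⊗ N ⊖ lit 5) ⊘ (lit 6 ⊗ N₂))) (⊝ (lit 1 ⊘ (lit 2 ⊗ N₂))) (lit 1 ⊘ (lit 2 ⊗ N₂))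
  ∷ qrow ((vp rd 2 adj 1 dash 3 sq) ∷ (vp sq 1 dash 3 adj 2 rd) ∷ [])
      ((N ⊖ lit 2) ⊘ lit 6) ((lit 2 ⊗ N ⊕ lit 1) ⊗ (N ⊖ lit 3) ⊘ (lit 6 ⊗ N₂)) ((N ⊖ lit 7) ⊘ (lit 6 ⊗ N₂)) (⊝ ((N ⊕ lit 1) ⊘ (lit 2 ⊗ N₂))) (⊝ (lit 1 ⊘ N₂))
  ∷ qrow ((vp rd 2 adj 3 dash 1 sq) ∷ (vp sq 3 dash 1 adj 2 rd) ∷ [])
      ((N ⊖ lit 2) ⊘ lit 6) (⊝ ((N ⊗ N ⊖ lit 4 ⊗ N ⊕ lit 9) ⊘ (lit 6 ⊗ N₂))) ((N ⊖ lit 7) ⊘ (lit 6 ⊗ N₂)) ((N ⊖ lit 3) ⊘ (lit 2 ⊗ N₂)) (⊝ (lit 1 ⊘ N₂))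
  ∷ qrow ((vp rd 3 adj 1 dash 2 sq) ∷ (vp sq 2 dash 3 adj 1 rd) ∷ [])
      ((N ⊖ lit 2) ⊘ lit 6) (⊝ ((N ⊗ N ⊕ lit 2 ⊗ N ⊖ lit 9) ⊘ (lit 6 ⊗ N₂))) (⊝ ((lit 2 ⊗ N ⊖ lit 5) ⊘ (lit 6 ⊗ N₂))) (lit 3 ⊘ (lit 2 ⊗ N₂)) (lit 1 ⊘ (lit 2 ⊗ N₂))
  ∷ qrow ((vp rd 3 adj 2 dash 1 sq) ∷ (vp sq 3 dash 2 adj 1 rd) ∷ [])
      ((N ⊖ lit 2) ⊘ lit 6) (⊝ ((N ⊕ lit 2) ⊗ (N ⊖ lit 3) ⊘ (lit 6 ⊗ N₂))) ((N ⊕ lit 2) ⊘ (lit 6 ⊗ N₂)) (⊝ ((N ⊖ lit 2) ⊘ (lit 2 ⊗ N₂))) (lit 1 ⊘ (lit 2 ⊗ N₂))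
  ∷ qrow ((vp sq 1 adj 2 dash 3 rd) ∷ (vp rd 1 dash 2 adj 3 sq) ∷ [])
      ((N ⊖ lit 2) ⊘ lit 6) ((N ⊗ N ⊕ lit 5 ⊗ N ⊖ lit 12) ⊘ (lit 6 ⊗ N₂)) (lit 1 ⊘ (lit 3 ⊗ N)) ((N ⊖ lit 2) ⊘ N₂) (lit 0)
  ∷ qrow ((vp sq 1 adj 3 dash 2 rd) ∷ (vp rd 2 dash 1 adj 3 sq) ∷ [])
      ((N ⊖ lit 2) ⊘ lit 6) ((N ⊕ lit 2) ⊗ (N ⊖ lit 3) ⊘ (lit 6 ⊗ N₂)) (⊝ (lit 2 ⊘ (lit 3 ⊗ N))) (⊝ (lit 1 ⊘ N₂)) (lit 0)
  ∷ qrow ((vp sq 2 adj 1 dash 3 rd) ∷ (vp rd 1 dash 3 adj 2 sq) ∷ [])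
      ((N ⊖ lit 2) ⊘ lit 6) ((N ⊖ lit 3) ⊗ (N ⊖ lit 4) ⊘ (lit 6 ⊗ N₂)) (lit 1 ⊘ (lit 3 ⊗ N)) (⊝ ((N ⊖ lit 2) ⊘ N₂)) (lit 0)
  ∷ qrow ((vp sq 2 adj 3 dash 1 rd) ∷ (vp rd 3 dash 1 adj 2 sq) ∷ [])
      ((N ⊖ lit 2) ⊘ lit 6) (⊝ ((N ⊗ N ⊖ N ⊖ lit 3) ⊘ (lit 3 ⊗ N₂))) (lit 1 ⊘ (lit 3 ⊗ N)) (lit 1 ⊘ N₂) (lit 0)
  ∷ qrow ((vp sq 3 adj 1 dash 2 rd) ∷ (vp rd 2 dash 3 adj 1 sq) ∷ [])
      ((N ⊖ lit 2) ⊘ lit 6) ((N ⊖ lit 6) ⊘ (lit 6 ⊗ N)) (⊝ (lit 2 ⊘ (lit 3 ⊗ N))) (lit 1 ⊘ N₂) (lit 0)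
  ∷ qrow ((vp sq 3 adj 2 dash 1 rd) ∷ (vp rd 3 dash 2 adj 1 sq) ∷ (vp sq 3 dash 2 dash 1 sq) ∷ [])
      ((N ⊖ lit 2) ⊘ lit 6) (⊝ ((N ⊖ lit 3) ⊘ (lit 3 ⊗ N))) (lit 1 ⊘ (lit 3 ⊗ N)) (⊝ (lit 1 ⊘ N₂)) (lit 0)
  ∷ qrow ((vp sq 1 dash 2 dash 3 sq) ∷ [])
      ((N ⊖ lit 2) ⊘ lit 6) ((lit 2 ⊗ N ⊖ lit 3) ⊘ (lit 3 ⊗ N)) (lit 1 ⊘ (lit 3 ⊗ N)) (lit 1 ⊘ N₂) (lit 0)
  ∷ qrow ((vp sq 1 dash 3 dash 2 sq) ∷ (vp sq 2 dash 1 dash 3 sq) ∷ [])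
      ((N ⊖ lit 2) ⊘ lit 6) ((N ⊖ lit 3) ⊘ (lit 6 ⊗ N)) (⊝ (lit 1 ⊘ (lit 6 ⊗ N))) (⊝ (lit 1 ⊘ (lit 2 ⊗ N))) (lit 0)
  ∷ qrow ((vp sq 2 dash 3 dash 1 sq) ∷ (vp sq 3 dash 1 dash 2 sq) ∷ [])
      ((N ⊖ lit 2) ⊘ lit 6) (⊝ ((lit 2 ⊗ N ⊖ lit 3) ⊘ (lit 6 ⊗ N))) (⊝ (lit 1 ⊘ (lit 6 ⊗ N))) (lit 1 ⊘ (lit 2 ⊗ N)) (lit 0)
  ∷ qrow ((vp rd 1 adj 2 adj 3 rd) ∷ [])
      ((N ⊖ lit 2) ⊘ lit 6) (lit 1 ⊘ N) (lit 1 ⊘ N₂) (lit 1 ⊘ N) (lit 1 ⊘ N₂)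
  ∷ qrow ((vp rd 1 adj 3 adj 2 rd) ∷ (vp rd 2 adj 1 adj 3 rd) ∷ [])
      ((N ⊖ lit 2) ⊘ lit 6) ((N ⊖ lit 3) ⊘ (lit 2 ⊗ N₂)) (⊝ (lit 1 ⊘ (lit 2 ⊗ N₂))) (⊝ (lit 3 ⊘ (lit 2 ⊗ N₂))) (⊝ (lit 1 ⊘ (lit 2 ⊗ N₂)))
  ∷ qrow ((vp rd 2 adj 3 adj 1 rd) ∷ (vp rd 3 adj 1 adj 2 rd) ∷ [])
      ((N ⊖ lit 2) ⊘ lit 6) (⊝ (lit 1 ⊘ (lit 2 ⊗ N))) (⊝ (lit 1 ⊘ (lit 2 ⊗ N₂))) (lit 1 ⊘ (lit 2 ⊗ N₂)) (⊝ (lit 1 ⊘ (lit 2 ⊗ N₂)))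
  ∷ qrow ((vp rd 3 adj 2 adj 1 rd) ∷ [])
      ((N ⊖ lit 2) ⊘ lit 6) (⊝ ((N ⊖ lit 3) ⊘ N₂)) (lit 1 ⊘ N₂) (⊝ ((N ⊖ lit 3) ⊘ N₂)) (lit 1 ⊘ N₂)
  ∷ qrow ((vp sq 1 adj 2 adj 3 rd) ∷ (vp rd 1 adj 2 adj 3 sq) ∷ [])
      (lit 1 ⊘ lit 6) (lit 1 ⊘ (N ⊗ (N ⊖ lit 2))) (lit 1 ⊘ N₃) (lit 1 ⊘ (N ⊗ (N ⊖ lit 2))) (lit 1 ⊘ N₃)
  ∷ qrow ((vp sq 1 adj 3 adj 2 rd) ∷ (vp rd 2 adj 1 adj 3 sq) ∷ [])
      (lit 1 ⊘ lit 6) ((lit 2 ⊗ N ⊖ lit 6) ⊘ N₃) (⊝ (lit 2 ⊘ N₃)) ((N ⊖ lit 6) ⊘ N₃) (⊝ (lit 2 ⊘ N₃))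
  ∷ qrow ((vp sq 2 adj 1 adj 3 rd) ∷ (vp rd 1 adj 3 adj 2 sq) ∷ (vp sq 3 adj 2 adj 1 rd) ∷ (vp rd 3 adj 2 adj 1 sq) ∷ [])
      (lit 1 ⊘ lit 6) (⊝ ((N ⊖ lit 3) ⊘ N₃)) (lit 1 ⊘ N₃) (⊝ ((N ⊖ lit 3) ⊘ N₃)) (lit 1 ⊘ N₃)
  ∷ qrow ((vp sq 2 adj 3 adj 1 rd) ∷ (vp rd 3 adj 1 adj 2 sq) ∷ [])
      (lit 1 ⊘ lit 6) (⊝ ((lit 2 ⊗ N ⊖ lit 5) ⊘ N₃)) (lit 1 ⊘ N₃) (⊝ ((N ⊖ lit 5) ⊘ N₃)) (lit 1 ⊘ N₃)
  ∷ qrow ((vp sq 3 adj 1 adj 2 rd) ∷ (vp rd 2 adj 3 adj 1 sq) ∷ [])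
      (lit 1 ⊘ lit 6) ((N ⊖ lit 4) ⊘ N₃) (⊝ (lit 2 ⊘ N₃)) ((N ⊖ lit 4) ⊘ N₃) (⊝ (lit 2 ⊘ N₃))
  ∷ qrow ((vp sq 1 adj 2 dash 3 sq) ∷ (vp sq 1 dash 2 adj 3 sq) ∷ [])
      (lit 1 ⊘ lit 6) ((N ⊕ lit 1) ⊘ (lit 2 ⊗ N₂)) (lit 1 ⊘ (lit 2 ⊗ N₂)) (lit 1 ⊘ (lit 2 ⊗ N₂)) (⊝ (lit 1 ⊘ (lit 2 ⊗ N₃)))
  ∷ qrow ((vp sq 1 adj 3 dash 2 sq) ∷ (vp sq 2 dash 1 adj 3 sq) ∷ [])
      (lit 1 ⊘ lit 6) (lit 0) (⊝ (lit 1 ⊘ N₂)) (lit 0) (lit 1 ⊘ N₃)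
  ∷ qrow ((vp sq 2 adj 1 dash 3 sq) ∷ (vp sq 1 dash 3 adj 2 sq) ∷ [])
      (lit 1 ⊘ lit 6) ((N ⊖ lit 3) ⊘ (lit 2 ⊗ N₂)) (lit 1 ⊘ (lit 2 ⊗ N₂)) (⊝ (lit 3 ⊘ (lit 2 ⊗ N₂))) (⊝ (lit 1 ⊘ (lit 2 ⊗ N₃)))
  ∷ qrow ((vp sq 2 adj 3 dash 1 sq) ∷ (vp sq 3 dash 1 adj 2 sq) ∷ [])
      (lit 1 ⊘ lit 6) (⊝ (lit 1 ⊘ (lit 2 ⊗ N))) (lit 1 ⊘ (lit 2 ⊗ N₂)) (lit 1 ⊘ (lit 2 ⊗ N₂)) (⊝ (lit 1 ⊘ (lit 2 ⊗ N₃)))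
  ∷ qrow ((vp sq 3 adj 1 dash 2 sq) ∷ (vp sq 2 dash 3 adj 1 sq) ∷ [])
      (lit 1 ⊘ lit 6) (⊝ (lit 1 ⊘ N₂)) (⊝ (lit 1 ⊘ N₂)) (lit 2 ⊘ N₃) (lit 1 ⊘ N₃)
  ∷ qrow ((vp sq 3 adj 2 dash 1 sq) ∷ (vp sq 3 dash 2 adj 1 sq) ∷ [])
      (lit 1 ⊘ lit 6) (⊝ ((N ⊖ lit 3) ⊘ (lit 2 ⊗ N₂))) (lit 1 ⊘ (lit 2 ⊗ N₂)) ((N ⊖ lit 6) ⊘ (lit 2 ⊗ N₃)) (⊝ (lit 1 ⊘ (lit 2 ⊗ N₃)))
  ∷ []
  where
  N₂ N₃ : QExpr
  N₂ = N ⊗ (N ⊖ lit 1)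
  N₃ = N ⊗ (N ⊖ lit 1) ⊗ (N ⊖ lit 2)

rowValue : ℕ → ℕ → ℕ → ℕ → QRow → Row
rowValue m p q r ρ = row (pats ρ) (val (b₁ ρ)) (val (b₂ ρ)) (val (b₃ ρ)) (val (b₄ ρ)) (val (b₆ ρ))
  where val = ⟦_⟧ m p q r

-- `QExpr` mirrors the entries of `table` symbol by symbol, so evaluation reproduces the table
-- itself. The entries depend on n alone, which leaves `p`, `q`, `r` arbitrary.
table-value : ∀ m p q r → table (3 ℕ.+ m) ≡ map (rowValue m p q r) qtable
table-value m p q r = refl

all-∈ : ∀ {A : Set} (f : A → Bool) {xs x} → all f xs ≡ true → x ∈ xs → f x ≡ true
all-∈ f {y ∷ xs} e (here refl) = proj₁ (∧-true⁻¹ {f y} e)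
all-∈ f {y ∷ xs} e (there x∈)  = all-∈ f (proj₂ (∧-true⁻¹ {f y} e)) x∈

abstract
  -- One evaluation settles every pattern of every row, each as an identity between polynomials in
  -- p, q, r and n - 3.
  valid-rows : all validRow qtable ≡ true
  valid-rows = refl

  valid-table : ∀ {σ} → σ ∈ qtable → validRow σ ≡ true
  valid-table = all-∈ validRow {qtable} valid-rows

-- The mean of a pattern over a conjugacy class

module _ {m : ℕ} (λ′ : Partition (3 ℕ.+ m)) where
  private
    n = 3 ℕ.+ m
    p = mult 1 λ′
    q = mult 2 λ′
    r = mult 3 λ′
    ε = naturals (env m p q r)
    C = conjClass λ′

    C-nonempty : + length C ≢ 0ℤ
    C-nonempty e = empty C (ℤₚ.+-injective e) (∈-ofType-cycles (parts λ′) (decreasing λ′) (positive λ′) (total λ′))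
      where
      empty : ∀ (xs : List (List ℕ)) {x} → length xs ≡ 0 → x ∈ xs → ⊥
      empty [] _ ()

    -- Both sides are S D A / (L D A), where S is the sum over the class,
    -- L its size, D the denominator of e and A = 720 (n)_c.
    cancel : ∀ (x y : ℚ) (S L V A D Nm : ℤ) → L ≢ 0ℤ → A ≢ 0ℤ → D ≢ 0ℤ →
      x ℚ.* ι L ≡ ι S → y ℚ.* ι D ≡ ι Nm → A * S ≡ L * V → A * Nm ≡ V * D → x ≡ y
    cancel x y S L V A D Nm L≢0 A≢0 D≢0 x≡ y≡ AS≡ AN≡ =
      *-cancelʳ-≢0 (*-≢0 (*-≢0 (ι≢0 L≢0) (ι≢0 D≢0)) (ι≢0 A≢0)) (begin
        x ℚ.* (ι L ℚ.* ι D ℚ.* ι A)     ≡⟨ lem₁ x (ι L) (ι D) (ι A) ⟩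
        x ℚ.* ι L ℚ.* (ι A ℚ.* ι D)     ≡⟨ cong₂ ℚ._*_ x≡ (sym (ι-* A D)) ⟩
        ι S ℚ.* ι (A * D)               ≡⟨ sym (ι-* S (A * D)) ⟩
        ι (S * (A * D))                 ≡⟨ cong ι integers ⟩
        ι (Nm * (L * A))                ≡⟨ ι-* Nm (L * A) ⟩
        ι Nm ℚ.* ι (L * A)              ≡⟨ cong₂ ℚ._*_ (sym y≡) (ι-* L A) ⟩
        y ℚ.* ι D ℚ.* (ι L ℚ.* ι A)     ≡⟨ lem₂ y (ι L) (ι D) (ι A) ⟩
        y ℚ.* (ι L ℚ.* ι D ℚ.* ι A)     ∎)
      where
      open ≡-Reasoning
      open ℚSolver.+-*-Solver using (solve; _:=_; _:*_)
      lem₁ : ∀ x l d a → x ℚ.* (l ℚ.* d ℚ.* a) ≡ x ℚ.* l ℚ.* (a ℚ.* d)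
      lem₁ = solve #4 (λ x l d a → x :* (l :* d :* a) := x :* l :* (a :* d)) refl
      lem₂ : ∀ y l d a → y ℚ.* d ℚ.* (l ℚ.* a) ≡ y ℚ.* (l ℚ.* d ℚ.* a)
      lem₂ = solve #4 (λ y l d a → y :* d :* (l :* a) := y :* (l :* d :* a)) refl
      lem₃ : ∀ s a d → s * (a * d) ≡ (a * s) * d
      lem₃ = solve-∀
      lem₄ : ∀ l v d → (l * v) * d ≡ l * (v * d)
      lem₄ = solve-∀
      lem₅ : ∀ l a k → l * (a * k) ≡ k * (l * a)
      lem₅ = solve-∀
      integers : S * (A * D) ≡ Nm * (L * A)
      integers = trans (lem₃ S A D) (trans (cong (_* D) AS≡) (trans (lem₄ L V D) (trans (cong (L *_) (sym AN≡)) (lem₅ L A Nm))))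

  mean-validTerms : ∀ e l f₁ g₁ f₂ g₂ f₃ r′ → let φ = vp l f₁ g₁ f₂ g₂ f₃ r′ in defined e ≡ true →
    ∀ o (Ts : Maybe (Terms f₁ f₂ f₃ (flags φ) (paths 3 3))) → validTerms e o Ts ≡ true → mean (pat φ) λ′ ≡ ⟦_⟧ m p q r e
  mean-validTerms e l f₁ g₁ f₂ g₂ f₃ r′ def (just o) (just Ts) ok =
    cancel (mean (pat φ) λ′) (⟦_⟧ m p q r e) (+ sum (map (pat φ) C)) (+ length C) (eval (patternPoly Ts) ε) (+ (720 ℕ.* ff n c))
      (eval (den e) ε) (eval (num e) ε) C-nonempty A≢0 (proj₁ e≡) (//-* (ℕ→ℚ (sum (map (pat φ) C))) (ι≢0 C-nonempty)) (proj₂ e≡)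
      (trans (cong (+ (720 ℕ.* ff n c) *_) (∑-sum-map (pat φ) C)) (pat-total m (parts λ′) (total λ′) l f₁ g₁ f₂ g₂ f₃ r′ o Ts))
      (begin
        + (720 ℕ.* ff n c) * eval (num e) ε
          ≡⟨ cong (_* eval (num e) ε) (sym A≡) ⟩
        eval (poly (con 720 *ᶻ ffᶻ c)) ε * eval (num e) ε
          ≡⟨ sym (eval-⊠ (poly (con 720 *ᶻ ffᶻ c)) (num e) ε) ⟩
        eval (poly (con 720 *ᶻ ffᶻ c) ⊠ num e) ε
          ≡⟨ equal-sound (poly (con 720 *ᶻ ffᶻ c) ⊠ num e) (patternPoly Ts ⊠ den e) (proj₂ checked) ε ⟩
        eval (patternPoly Ts ⊠ den e) ε
          ≡⟨ eval-⊠ (patternPoly Ts) (den e) ε ⟩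
        eval (patternPoly Ts) ε * eval (den e) ε ∎)
    where
    open ≡-Reasoning
    φ = vp l f₁ g₁ f₂ g₂ f₃ r′
    c = #tight (flags φ)
    e≡ = fraction m p q r e def
    checked = ∧-true⁻¹ {c <ᵇ 4} ok
    c<4 : c < 4
    c<4 = <ᵇ-true⁻¹ (proj₁ checked)
    A≡ : eval (poly (con 720 *ᶻ ffᶻ c)) ε ≡ + (720 ℕ.* ff n c)
    A≡ = trans (eval-poly (con 720 *ᶻ ffᶻ c) ε)
      (trans (cong (+ 720 *_) (ffᶻ-value m p q r c c<4)) (sym (ℤₚ.pos-* 720 (ff n c))))
    A≢0 : + (720 ℕ.* ff n c) ≢ 0ℤ
    A≢0 z = ℕ.≢-nonZero⁻¹ (720 ℕ.* ff n c)
      {{ℕₚ.m*n≢0 720 (ff n c) {{_}} {{ff-NonZero (ℕₚ.≤-trans (ℕₚ.≤-pred c<4) (s≤s (s≤s (s≤s z≤n))))}}}} (ℤₚ.+-injective z)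

  mean-valid : ∀ e φ → defined e ≡ true → valid e φ ≡ true → mean (pat φ) λ′ ≡ ⟦_⟧ m p q r e
  mean-valid e φ@(vp l f₁ g₁ f₂ g₂ f₃ r′) def ok =
    mean-validTerms e l f₁ g₁ f₂ g₂ f₃ r′ def (order? f₁ f₂ f₃) (terms f₁ f₂ f₃ (flags φ) (paths 3 3)) ok

  mean-row : ∀ {ρ φ} → (∃ λ σ → σ ∈ qtable × ρ ≡ rowValue m p q r σ) → φ ∈ patterns ρ → mean (pat φ) λ′ ≡ rhs ρ λ′
  mean-row {φ = φ} (σ , σ∈ , refl) φ∈ =
    mean-valid (qrhs σ) φ (proj₁ ok) (all-∈ (valid (qrhs σ)) {pats σ} (proj₂ ok) φ∈)
    where
    ok : defined (qrhs σ) ≡ true × all (valid (qrhs σ)) (pats σ) ≡ true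
    ok = ∧-true⁻¹ {defined (qrhs σ)} (valid-table σ∈)

  mean-table : ∀ {ρ φ} → ρ ∈ table n → φ ∈ patterns ρ → mean (pat φ) λ′ ≡ rhs ρ λ′
  mean-table {ρ} ρ∈ φ∈ = mean-row (∈-map⁻ (rowValue m p q r) (subst (ρ ∈_) (table-value m p q r) ρ∈)) φ∈

theorem4p5 : (n : ℕ) → 3 ≤ n →
    (ρ : Row) → ρ ∈ table n →
    (φ : VPat) → φ ∈ patterns ρ →
    (λ′ : Partition n) →
    mean (pat φ) λ′ ≡ rhs ρ λ′
theorem4p5 (suc (suc (suc m))) (s≤s (s≤s (s≤s _))) ρ ρ∈ φ φ∈ λ′ = mean-table λ′ ρ∈ φ∈
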